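{- Let $p\ge1$, and let $m_2,\ldots,m_{p-1},r\ge0$ and $m_1,m_p\ge1$ be integers. Put $|\mathbf m|=m_1+\cdots+m_p$. Then $$\begin{aligned}&\sum_{j=1}^p(-1)^{j-1}\zeta(m_p+1,m_{p-1}+1,\ldots,m_{j+1}+1)\,\zeta_B^\star(r+2,\mathbf m_j^\vee)\\ &=\sum_{j=1}^r(-1)^{r-j}\zeta(m_p+1,\ldots,m_1+1,\{1\}_{r-j})\,\zeta_B^\star(j+1)\\ &\quad+(-1)^r2^{|\mathbf m|+1}\log(2)\sum_{\sigma_1,\ldots,\sigma_{p+r}\in\{\pm1\}}\mathrm{Li}_{m_p+1,\ldots,m_1+1,\{1\}_r}\bigl(\sigma_{p+r},\,\sigma_{p+r}\sigma_{p+r-1},\,\sigma_{p+r-1}\sigma_{p+r-2},\ldots,\sigma_2\sigma_1\bigr)\\ &\quad+(-1)^r2^{|\mathbf m|+1}\sum_{\sigma_1,\ldots,\sigma_{p+r}\in\{\pm1\}}\mathrm{Li}_{m_p+1,\ldots,m_1+1,\{1\}_{r+1}}\bigl(\sigma_{p+r},\,\sigma_{p+r}\sigma_{p+r-1},\ldots,\sigma_2\sigma_1,\,-\sigma_1\bigr).\end{aligned}$$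
   Context: $\zeta(k_1,\ldots,k_r)=\sum_{n_1>\cdots>n_r\ge1}\prod n_j^{ -k_j}$ ($k_1\ge2$), with $\zeta(\emptyset)=1$ (this occurs for $j=p$ on the left). $\zeta_n^\star(k_1,\ldots,k_r)=\sum_{n\ge n_1\ge\cdots\ge n_r\ge1}\prod n_j^{ -k_j}$, $\zeta_n^\star(\emptyset)=1$. The Apéry-type multiple zeta $B$-star value is $$\zeta_B^\star(k_1,\ldots,k_r)=\sum_{n=1}^\infty\frac{\zeta_n^\star(k_2,\ldots,k_r)}{n^{k_1}4^n}\binom{2n}{n}.$$ Multivariable polylogarithm: $\mathrm{Li}_{a_1,\ldots,a_q}(x_1,\ldots,x_q)=\sum_{n_1>\cdots>n_q\ge1}\frac{x_1^{n_1}\cdots x_q^{n_q}}{n_1^{a_1}\cdots n_q^{a_q}}$. In the first polylogarithm sum the argument list consists of $\sigma_{p+r}$ followed by $\sigma_{p+r+1-i}\sigma_{p+r-i}$ for $i=1,\ldots,p+r-1$ (nothing follows if $p+r=1$); in the second, the same list followed by $-\sigma_1$. $\{1\}_d$ is $1$ repeated $d$ times. Put $\mathbf m_j=(m_1,m_2+1,\ldots,m_j+1)$, $\mathbf m_1=(m_1)$. The Hoffman dual of an index (finite sequence of positive integers) $\mathbf a=(a_1,\ldots,a_q)$ is the index $\mathbf a^\vee=(a'_1,\ldots,a'_{q'})$ of the same weight $|\mathbf a|=a_1+\cdots+a_q$ such that $\{1,\ldots,|\mathbf a|-1\}$ is the disjoint union of $\{a_1,a_1+a_2,\ldots,a_1+\cdots+a_{q-1}\}$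 and $\{a'_1,a'_1+a'_2,\ldots,a'_1+\cdots+a'_{q'-1}\}$. -}

module Defs where

import Algebra.Definitions.RawSemiring
open import Data.Empty using (⊥)
open import Data.Integer as ℤ using (+_)
import Data.Integer.Properties as ℤ
open import Data.List as List using (List; []; _∷_)
open import Data.List.Membership.Propositional using (_∈_)
open import Data.List.Membership.Propositional.Properties using (∈-map⁺; ∈-map⁻)
open import Data.List.Relation.Unary.All using (All; []; _∷_)
import Data.List.Relation.Unary.All.Properties as All
open import Data.List.Relation.Unary.Any using (here; there)
open import Data.Nat as ℕ using (ℕ; zero; suc; pred; z≤n; s≤s)
import Data.Nat.ListAction as ℕ using (sum)
open import Data.Nat.Combinatorics using (_C_; nCk+nC[k+1]≡[n+1]C[k+1])
import Data.Nat.Properties as ℕ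
open import Data.Product using (∃-syntax; _×_; _,_; proj₁; proj₂)
open import Data.Rational hiding (_≃_)
import Data.Rational.Properties as ℚ
open import Data.Rational.Solver using (module +-*-Solver)
open import Data.Rational.Unnormalised as ℚᵘ using (mkℚᵘ; *≡*)
import Data.Rational.Unnormalised.Properties as ℚᵘ
open import Data.Sign as Sign using (Sign)
open import Data.Sum using (_⊎_; inj₁; inj₂; swap)
open import Data.Unit using (⊤; tt)
open import Data.Vec as Vec using (Vec; []; _∷_)
open import Data.Vec.Relation.Unary.All as VecAll using ([]; _∷_)
open import Function using (_⇔_; mk⇔; Equivalence; _∘_)
open import Relation.Binary.PropositionalEquality
open import Relation.Nullary using (¬_; yes; no)

open Algebra.Definitions.RawSemiring ℚ.+-*-rawSemiring using (_^_)

≤-by : ∀ {p q r} → q - p ≡ r → 0ℚ ≤ r → p ≤ q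
≤-by {p} {q} {r} eq 0≤r = begin
  p            ≡⟨ ℚ.+-identityʳ p ⟨
  p + 0ℚ       ≤⟨ ℚ.+-monoʳ-≤ p 0≤r ⟩
  p + r        ≡⟨ cong (_+_ p) eq ⟨
  p + (q - p)  ≡⟨ solve 2 (λ x y → x :+ (y :- x) := y) refl p q ⟩
  q            ∎
  where open ℚ.≤-Reasoning
        open +-*-Solver

p≤q⇒0≤q-p : ∀ {p q} → p ≤ q → 0ℚ ≤ q - p
p≤q⇒0≤q-p {p} {q} p≤q = begin
  0ℚ     ≡⟨ ℚ.+-inverseʳ p ⟨
  p - p  ≤⟨ ℚ.+-monoˡ-≤ (- p) p≤q ⟩
  q - p  ∎
  where open ℚ.≤-Reasoning

0≤+ : ∀ {p q} → 0ℚ ≤ p → 0ℚ ≤ q → 0ℚ ≤ p + q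
0≤+ = ℚ.+-mono-≤

0≤* : ∀ {p q} → 0ℚ ≤ p → 0ℚ ≤ q → 0ℚ ≤ p * q
0≤* {p} {q} 0≤p 0≤q =
  ℚ.nonNegative⁻¹ (p * q) {{ℚ.nonNeg*nonNeg⇒nonNeg p {{nonNegative 0≤p}} q {{nonNegative 0≤q}}}}

*-mono-≤ : ∀ {p q r s} → 0ℚ ≤ q → 0ℚ ≤ r → p ≤ q → r ≤ s → p * r ≤ q * s
*-mono-≤ {p} {q} {r} {s} 0≤q 0≤r p≤q r≤s = ℚ.≤-trans
  (ℚ.*-monoʳ-≤-nonNeg r {{nonNegative 0≤r}} p≤q)
  (ℚ.*-monoˡ-≤-nonNeg q {{nonNegative 0≤q}} r≤s)

0<* : ∀ {p q} → 0ℚ < p → 0ℚ < q → 0ℚ < p * q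
0<* {p} {q} 0<p 0<q =
  ℚ.positive⁻¹ (p * q) {{ℚ.pos*pos⇒pos p {{positive 0<p}} q {{positive 0<q}}}}

0<½ : 0ℚ < ½
0<½ = ℚ.positive⁻¹ ½

0≤1 : 0ℚ ≤ 1ℚ
0≤1 = ℚ.nonNegative⁻¹ 1ℚ

½+½ : ∀ p → ½ * p + ½ * p ≡ p
½+½ p = trans (sym (ℚ.*-distribʳ-+ p ½ ½)) (ℚ.*-identityˡ p)

∣-∣-sym : ∀ p q → ∣ p - q ∣ ≡ ∣ q - p ∣
∣-∣-sym p q = trans (sym (ℚ.∣-p∣≡∣p∣ (p - q)))
  (cong ∣_∣ (solve 2 (λ x y → :- (x :- y) := y :- x) refl p q))
  where open +-*-Solver

Cauchy : (ℕ → ℚ) → Set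
Cauchy s = ∀ ε → 0ℚ < ε →
  ∃[ N ] (∀ i j → N ℕ.≤ i → N ℕ.≤ j → ∣ s i - s j ∣ ≤ ε)

-- Cauchy sequences are not quotiented; equality of reals is _≃_ below.
record ℝ : Set where
  constructor lim
  field
    seq    : ℕ → ℚ
    cauchy : Cauchy seq

open ℝ public

infix 4 _≃_

_≃_ : ℝ → ℝ → Set
x ≃ y = ∀ ε → 0ℚ < ε → ∃[ N ] (∀ n → N ℕ.≤ n → ∣ seq x n - seq y n ∣ ≤ ε)

fromℚ : ℚ → ℝ
fromℚ q = lim (λ _ → q) λ ε 0<ε → 0 , λ _ _ _ _ →
  ℚ.≤-trans (ℚ.≤-reflexive (cong ∣_∣ (ℚ.+-inverseʳ q))) (ℚ.<⇒≤ 0<ε)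

fromℕ : ℕ → ℝ
fromℕ n = fromℚ (+ n / 1)

infixl 6 _+ᴿ_
infixl 7 _*ᴿ_

_+ᴿ_ : ℝ → ℝ → ℝ
x +ᴿ y = lim (λ n → seq x n + seq y n) λ ε 0<ε →
  let N₁ , h₁ = cauchy x (½ * ε) (0<* 0<½ 0<ε)
      N₂ , h₂ = cauchy y (½ * ε) (0<* 0<½ 0<ε)
  in N₁ ℕ.⊔ N₂ , λ i j N≤i N≤j → begin
    ∣ seq x i + seq y i - (seq x j + seq y j) ∣
      ≡⟨ cong ∣_∣ (solve 4 (λ a b c d → a :+ b :- (c :+ d) := (a :- c) :+ (b :- d)) refl
           (seq x i) (seq y i) (seq x j) (seq y j)) ⟩
    ∣ (seq x i - seq x j) + (seq y i - seq y j) ∣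
      ≤⟨ ℚ.∣p+q∣≤∣p∣+∣q∣ (seq x i - seq x j) (seq y i - seq y j) ⟩
    ∣ seq x i - seq x j ∣ + ∣ seq y i - seq y j ∣
      ≤⟨ ℚ.+-mono-≤ (h₁ i j (ℕ.m⊔n≤o⇒m≤o N₁ N₂ N≤i) (ℕ.m⊔n≤o⇒m≤o N₁ N₂ N≤j))
                    (h₂ i j (ℕ.m⊔n≤o⇒n≤o N₁ N₂ N≤i) (ℕ.m⊔n≤o⇒n≤o N₁ N₂ N≤j)) ⟩
    ½ * ε + ½ * ε
      ≡⟨ ½+½ ε ⟩
    ε ∎
  where open ℚ.≤-Reasoning
        open +-*-Solver

eventually-bounded : (x : ℝ) →
  ∃[ N ] ∃[ B ] (0ℚ < B × (∀ n → N ℕ.≤ n → ∣ seq x n ∣ ≤ B))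
eventually-bounded x =
  let N , h = cauchy x 1ℚ (ℚ.positive⁻¹ 1ℚ)
  in N , ∣ seq x N ∣ + 1ℚ ,
     ℚ.+-mono-≤-< (ℚ.0≤∣p∣ (seq x N)) (ℚ.positive⁻¹ 1ℚ) ,
     λ n N≤n → begin
       ∣ seq x n ∣
         ≡⟨ cong ∣_∣ (solve 2 (λ a b → a := b :+ (a :- b)) refl (seq x n) (seq x N)) ⟩
       ∣ seq x N + (seq x n - seq x N) ∣
         ≤⟨ ℚ.∣p+q∣≤∣p∣+∣q∣ (seq x N) (seq x n - seq x N) ⟩
       ∣ seq x N ∣ + ∣ seq x n - seq x N ∣
         ≤⟨ ℚ.+-monoʳ-≤ ∣ seq x N ∣ (h n N N≤n ℕ.≤-refl) ⟩
       ∣ seq x N ∣ + 1ℚ ∎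
  where open ℚ.≤-Reasoning
        open +-*-Solver

-- δ with B * δ = ε
quotient : ∀ B ε → 0ℚ < B → 0ℚ < ε → ∃[ δ ] (0ℚ < δ × B * δ ≡ ε)
quotient B ε 0<B 0<ε = 1/ B * ε ,
  0<* (ℚ.positive⁻¹ (1/ B) {{ℚ.1/pos⇒pos B}}) 0<ε ,
  trans (sym (ℚ.*-assoc B (1/ B) ε))
    (trans (cong (_* ε) (ℚ.*-inverseʳ B)) (ℚ.*-identityˡ ε))
  where instance
          B>0 : Positive B
          B>0 = positive 0<B
          B≢0 : NonZero B
          B≢0 = ℚ.pos⇒nonZero B

_*ᴿ_ : ℝ → ℝ → ℝ
x *ᴿ y = lim (λ n → seq x n * seq y n) λ ε 0<ε →
  let N₁ , A , 0<A , hA = eventually-bounded x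
      N₂ , B , 0<B , hB = eventually-bounded y
      δ₁ , 0<δ₁ , eq₁   = quotient A (½ * ε) 0<A (0<* 0<½ 0<ε)
      δ₂ , 0<δ₂ , eq₂   = quotient B (½ * ε) 0<B (0<* 0<½ 0<ε)
      N₃ , hy = cauchy y δ₁ 0<δ₁
      N₄ , hx = cauchy x δ₂ 0<δ₂
      N₁₂ = N₁ ℕ.⊔ N₂
      N₃₄ = N₃ ℕ.⊔ N₄
  in N₁₂ ℕ.⊔ N₃₄ , λ i j N≤i N≤j →
    let 12≤i = ℕ.m⊔n≤o⇒m≤o N₁₂ N₃₄ N≤i
        34≤i = ℕ.m⊔n≤o⇒n≤o N₁₂ N₃₄ N≤i
        12≤j = ℕ.m⊔n≤o⇒m≤o N₁₂ N₃₄ N≤j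
        34≤j = ℕ.m⊔n≤o⇒n≤o N₁₂ N₃₄ N≤j
        a = seq x i ; b = seq y i ; c = seq x j ; d = seq y j
    in begin
    ∣ a * b - c * d ∣
      ≡⟨ cong ∣_∣ (solve 4 (λ a b c d → a :* b :- c :* d := a :* (b :- d) :+ d :* (a :- c))
           refl a b c d) ⟩
    ∣ a * (b - d) + d * (a - c) ∣
      ≤⟨ ℚ.∣p+q∣≤∣p∣+∣q∣ (a * (b - d)) (d * (a - c)) ⟩
    ∣ a * (b - d) ∣ + ∣ d * (a - c) ∣
      ≡⟨ cong₂ _+_ (ℚ.∣p*q∣≡∣p∣*∣q∣ a (b - d)) (ℚ.∣p*q∣≡∣p∣*∣q∣ d (a - c)) ⟩
    ∣ a ∣ * ∣ b - d ∣ + ∣ d ∣ * ∣ a - c ∣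
      ≤⟨ ℚ.+-mono-≤
           (*-mono-≤ (ℚ.<⇒≤ 0<A) (ℚ.0≤∣p∣ (b - d))
             (hA i (ℕ.m⊔n≤o⇒m≤o N₁ N₂ 12≤i))
             (hy i j (ℕ.m⊔n≤o⇒m≤o N₃ N₄ 34≤i) (ℕ.m⊔n≤o⇒m≤o N₃ N₄ 34≤j)))
           (*-mono-≤ (ℚ.<⇒≤ 0<B) (ℚ.0≤∣p∣ (a - c))
             (hB j (ℕ.m⊔n≤o⇒n≤o N₁ N₂ 12≤j))
             (hx i j (ℕ.m⊔n≤o⇒n≤o N₃ N₄ 34≤i) (ℕ.m⊔n≤o⇒n≤o N₃ N₄ 34≤j))) ⟩
    A * δ₁ + B * δ₂
      ≡⟨ cong₂ _+_ eq₁ eq₂ ⟩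
    ½ * ε + ½ * ε
      ≡⟨ ½+½ ε ⟩
    ε ∎
  where open ℚ.≤-Reasoning
        open +-*-Solver

-- Ranges start at 1: ∑ N f = f 1 + ⋯ + f N.

∑ : ℕ → (ℕ → ℚ) → ℚ
∑ zero    f = 0ℚ
∑ (suc n) f = ∑ n f + f (suc n)

∑ᴿ : ℕ → (∀ j → 1 ℕ.≤ j → ℝ) → ℝ
∑ᴿ zero    f = fromℚ 0ℚ
∑ᴿ (suc n) f = ∑ᴿ n f +ᴿ f (suc n) (s≤s z≤n)

∑ℕ : ℕ → (ℕ → ℕ) → ℕ
∑ℕ zero    f = 0
∑ℕ (suc n) f = ∑ℕ n f ℕ.+ f (suc n)

-- Sum over all of {±1}ⁿ.
∑± : ∀ n → (Vec Sign n → ℝ) → ℝ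
∑± zero    f = f []
∑± (suc n) f = ∑± n (λ σ → f (Sign.+ ∷ σ)) +ᴿ ∑± n (λ σ → f (Sign.- ∷ σ))

-- 1/n; the value at 0 is never used, since every sum starts at 1.
recip : ℕ → ℚ
recip zero    = 0ℚ
recip (suc n) = + 1 / suc n

sgn : Sign → ℚ
sgn Sign.+ = 1ℚ
sgn Sign.- = - 1ℚ

-- Sum over N ≥ n₁ > ⋯ > n_q ≥ 1; truncating in n₁ is the usual iterated summation.
ζ-sum : ∀ {q} → Vec ℕ q → ℕ → ℚ
ζ-sum []       N = 1ℚ
ζ-sum (k ∷ ks) N = ∑ N λ n → recip n ^ k * ζ-sum ks (pred n)

Li-sum : ∀ {q} → Vec ℕ q → Vec Sign q → ℕ → ℚ
Li-sum []       []       N = 1ℚ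
Li-sum (a ∷ as) (x ∷ xs) N = ∑ N λ n → sgn x ^ n * recip n ^ a * Li-sum as xs (pred n)

-- Sum over N ≥ n₁ ≥ ⋯ ≥ n_q ≥ 1.
ζ⋆-sum : List ℕ → ℕ → ℚ
ζ⋆-sum []       N = 1ℚ
ζ⋆-sum (k ∷ ks) N = ∑ N λ n → recip n ^ k * ζ⋆-sum ks n

centralBinomial/4^ : ℕ → ℚ
centralBinomial/4^ n = _/_ (+ ((2 ℕ.* n) C n)) (4 ℕ.^ n) {{ℕ.m^n≢0 4 n}}

ζB⋆-sum : ℕ → List ℕ → ℕ → ℚ
ζB⋆-sum k ks N = ∑ N λ n → recip n ^ k * ζ⋆-sum ks n * centralBinomial/4^ n

-- Convergence: every inner sum of depth d at n is at most M d n, and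
-- ∑ M d n / n² is dominated by a telescoping sum of the null sequence G d.

Null : (ℕ → ℚ) → Set
Null A = ∀ ε → 0ℚ < ε → ∃[ N ] (∀ n → N ℕ.≤ n → A n ≤ ε)

telescope⇒cauchy : ∀ {s G} → (∀ n → 0ℚ ≤ G n) → Null G →
  (∀ n → ∣ s (suc (suc n)) - s (suc n) ∣ ≤ G (suc n) - G (suc (suc n))) →
  Cauchy s
telescope⇒cauchy {s} {G} 0≤G null step ε 0<ε =
  let N , h = null ε 0<ε
  in suc N , λ where
    i j (s≤s {n = i′} N≤i) (s≤s {n = j′} N≤j) → case′ h i′ j′ N≤i N≤j
  where
  open ℚ.≤-Reasoning
  open +-*-Solver
  far : ∀ k n → ∣ s (suc (k ℕ.+ n)) - s (suc n) ∣ ≤ G (suc n) - G (suc (k ℕ.+ n))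
  far zero n = begin
    ∣ s (suc n) - s (suc n) ∣  ≡⟨ cong ∣_∣ (ℚ.+-inverseʳ (s (suc n))) ⟩
    0ℚ                         ≡⟨ ℚ.+-inverseʳ (G (suc n)) ⟨
    G (suc n) - G (suc n)      ∎
  far (suc k) n = begin
    ∣ c - a ∣              ≡⟨ cong ∣_∣ (solve 3 (λ a b c → c :- a := (c :- b) :+ (b :- a)) refl a b c) ⟩
    ∣ (c - b) + (b - a) ∣  ≤⟨ ℚ.∣p+q∣≤∣p∣+∣q∣ (c - b) (b - a) ⟩
    ∣ c - b ∣ + ∣ b - a ∣  ≤⟨ ℚ.+-mono-≤ (step (k ℕ.+ n)) (far k n) ⟩
    (y - z) + (x - y)      ≡⟨ solve 3 (λ x y z → (y :- z) :+ (x :- y) := x :- z) refl x y z ⟩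
    x - z                  ∎
    where
    a = s (suc n) ; b = s (suc (k ℕ.+ n)) ; c = s (suc (suc (k ℕ.+ n)))
    x = G (suc n) ; y = G (suc (k ℕ.+ n)) ; z = G (suc (suc (k ℕ.+ n)))
  near : ∀ {N} → (∀ n → N ℕ.≤ n → G n ≤ ε) → ∀ i j → N ℕ.≤ i → i ℕ.≤ j →
         ∣ s (suc j) - s (suc i) ∣ ≤ ε
  near h i j N≤i i≤j with far (j ℕ.∸ i) i
  ... | bound rewrite ℕ.m∸n+n≡m i≤j = begin
    ∣ s (suc j) - s (suc i) ∣  ≤⟨ bound ⟩
    G (suc i) - G (suc j)      ≤⟨ ≤-by (solve 2 (λ x y → x :- (x :- y) := y) refl (G (suc i)) (G (suc j))) (0≤G (suc j)) ⟩
    G (suc i)                  ≤⟨ h (suc i) (ℕ.m≤n⇒m≤1+n N≤i) ⟩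
    ε                          ∎
  case′ : ∀ {N} → (∀ n → N ℕ.≤ n → G n ≤ ε) → ∀ i j → N ℕ.≤ i → N ℕ.≤ j →
          ∣ s (suc i) - s (suc j) ∣ ≤ ε
  case′ h i j N≤i N≤j with ℕ.≤-total i j
  ... | inj₁ i≤j = ℚ.≤-trans (ℚ.≤-reflexive (∣-∣-sym (s (suc i)) (s (suc j)))) (near h i j N≤i i≤j)
  ... | inj₂ j≤i = near h j i N≤j j≤i

ι : ℕ → ℚ
ι n = + n / 1

private
  /ᵘ : ∀ n d → toℚᵘ (+ n / suc d) ℚᵘ.≃ mkℚᵘ (+ n) d
  /ᵘ n d = ℚ.toℚᵘ-fromℚᵘ (mkℚᵘ (+ n) d)

ι-suc : ∀ n → ι (suc n) ≡ ι n + 1ℚ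
ι-suc n = ℚ.toℚᵘ-injective (begin
  toℚᵘ (ι (suc n))                ≈⟨ /ᵘ (suc n) 0 ⟩
  mkℚᵘ (+ suc n) 0                ≈⟨ *≡* (trans (ℤ.*-identityʳ (+ suc n)) (sym (trans (ℤ.*-identityʳ (+ n ℤ.* + 1 ℤ.+ + 1)) (trans (cong (ℤ._+ + 1) (ℤ.*-identityʳ (+ n))) (cong +_ (ℕ.+-comm n 1)))))) ⟩
  mkℚᵘ (+ n) 0 ℚᵘ.+ ℚᵘ.1ℚᵘ        ≈⟨ ℚᵘ.+-congˡ ℚᵘ.1ℚᵘ (ℚᵘ.≃-sym (/ᵘ n 0)) ⟩
  toℚᵘ (ι n) ℚᵘ.+ toℚᵘ 1ℚ         ≈⟨ ℚ.toℚᵘ-homo-+ (ι n) 1ℚ ⟨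
  toℚᵘ (ι n + 1ℚ)                 ∎)
  where open ℚᵘ.≃-Reasoning

recip-ι : ∀ n → recip (suc n) * ι (suc n) ≡ 1ℚ
recip-ι n = ℚ.toℚᵘ-injective (begin
  toℚᵘ (recip (suc n) * ι (suc n))               ≈⟨ ℚ.toℚᵘ-homo-* (recip (suc n)) (ι (suc n)) ⟩
  toℚᵘ (recip (suc n)) ℚᵘ.* toℚᵘ (ι (suc n))     ≈⟨ ℚᵘ.*-cong (/ᵘ 1 n) (/ᵘ (suc n) 0) ⟩
  mkℚᵘ (+ 1) n ℚᵘ.* mkℚᵘ (+ suc n) 0             ≈⟨ *≡* (trans (ℤ.*-identityʳ (+ 1 ℤ.* + suc n)) (trans (ℤ.*-identityˡ (+ suc n)) (sym (trans (ℤ.*-identityˡ (+ (suc n ℕ.* 1))) (cong +_ (ℕ.*-identityʳ (suc n))))))) ⟩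
  ℚᵘ.1ℚᵘ                                         ∎)
  where open ℚᵘ.≃-Reasoning

recip-nonNeg : ∀ n → 0ℚ ≤ recip n
recip-nonNeg zero    = ℚ.≤-refl
recip-nonNeg (suc n) = ℚ.nonNegative⁻¹ (recip (suc n)) {{ℚ.normalize-nonNeg 1 (suc n)}}

recip-diff : ∀ n → recip (suc n) - recip (suc (suc n)) ≡ recip (suc n) * recip (suc (suc n))
recip-diff n = begin
  a - b                              ≡⟨ cong₂ _-_ (sym (ℚ.*-identityʳ a)) (sym (ℚ.*-identityʳ b)) ⟩
  a * 1ℚ - b * 1ℚ                    ≡⟨ cong₂ (λ u v → a * u - b * v) (sym (trans (cong (b *_) (sym (ι-suc (suc n)))) (recip-ι (suc n)))) (sym (recip-ι n)) ⟩
  a * (b * (x + 1ℚ)) - b * (a * x)   ≡⟨ solve 3 (λ a b x → a :* (b :* (x :+ con 1ℚ)) :- b :* (a :* x) := a :* b) refl a b x ⟩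
  a * b                              ∎
  where
  open ≡-Reasoning
  open +-*-Solver
  a = recip (suc n) ; b = recip (suc (suc n)) ; x = ι (suc n)

recip-suc-≤ : ∀ n → recip (suc (suc n)) ≤ recip (suc n)
recip-suc-≤ n = ≤-by (recip-diff n) (0≤* (recip-nonNeg (suc n)) (recip-nonNeg (suc (suc n))))

recip-≤1 : ∀ n → recip n ≤ 1ℚ
recip-≤1 zero          = 0≤1
recip-≤1 (suc zero)    = ℚ.≤-refl
recip-≤1 (suc (suc n)) = ℚ.≤-trans (recip-suc-≤ n) (recip-≤1 (suc n))

recip-antitone : ∀ k n → recip (suc (k ℕ.+ n)) ≤ recip (suc n)
recip-antitone zero    n = ℚ.≤-refl
recip-antitone (suc k) n = ℚ.≤-trans (recip-suc-≤ (k ℕ.+ n)) (recip-antitone k n)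

recip-≤-double : ∀ n → 0ℚ ≤ (recip (suc (suc n)) + recip (suc (suc n))) - recip (suc n)
recip-≤-double n = subst (0ℚ ≤_) eq (0≤* (p≤q⇒0≤q-p (recip-≤1 (suc n))) (recip-nonNeg (suc (suc n))))
  where
  open +-*-Solver
  a = recip (suc n) ; b = recip (suc (suc n))
  eq : (1ℚ - a) * b ≡ (b + b) - a
  eq = trans (solve 2 (λ a b → (con 1ℚ :- a) :* b := b :- a :* b) refl a b)
       (trans (cong (λ u → b - u) (sym (recip-diff n)))
         (solve 2 (λ a b → b :- (a :- b) := (b :+ b) :- a) refl a b))

recip-null : Null recip
recip-null (mkℚ (+ zero) _ _) 0<ε with () ← positive 0<ε
recip-null (mkℚ ℤ.-[1+ _ ] _ _) 0<ε with () ← positive 0<ε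
recip-null ε@(mkℚ (+ suc a) d c) 0<ε = suc d , λ where
      (suc n) (s≤s d≤n) → begin
        recip (suc n)              ≡⟨ cong (recip ∘ suc) (sym (ℕ.m∸n+n≡m d≤n)) ⟩
        recip (suc (n ℕ.∸ d ℕ.+ d)) ≤⟨ recip-antitone (n ℕ.∸ d) d ⟩
        recip (suc d)              ≤⟨ ℚ.toℚᵘ-cancel-≤ (ℚᵘ.≤-respˡ-≃ (ℚᵘ.≃-sym (/ᵘ 1 d))
                                        (ℚᵘ.*≤* (ℤ.+≤+ (ℕ.*-monoˡ-≤ (suc d) (s≤s (z≤n {a})))))) ⟩
        ε                          ∎
  where open ℚ.≤-Reasoning

Null-scale : ∀ {A} c → 0ℚ ≤ c → (∀ n → 0ℚ ≤ A n) → Null A → Null (λ n → c * A n)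
Null-scale {A} c 0≤c 0≤A null ε 0<ε =
  let δ , 0<δ , eq = quotient (c + 1ℚ) ε (ℚ.+-mono-≤-< 0≤c (ℚ.positive⁻¹ 1ℚ)) 0<ε
      N , h = null δ 0<δ
  in N , λ n N≤n → begin
    c * A n        ≤⟨ *-mono-≤ (0≤+ 0≤c 0≤1) (0≤A n) (≤-by (solve 1 (λ c → (c :+ con 1ℚ) :- c := con 1ℚ) refl c) 0≤1) (h n N≤n) ⟩
    (c + 1ℚ) * δ   ≡⟨ eq ⟩
    ε              ∎
  where open ℚ.≤-Reasoning
        open +-*-Solver

Null-+ : ∀ {A B} → Null A → Null B → Null (λ n → A n + B n)
Null-+ {A} {B} nA nB ε 0<ε =
  let N₁ , h₁ = nA (½ * ε) (0<* 0<½ 0<ε)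
      N₂ , h₂ = nB (½ * ε) (0<* 0<½ 0<ε)
  in N₁ ℕ.⊔ N₂ , λ n N≤n → begin
    A n + B n      ≤⟨ ℚ.+-mono-≤ (h₁ n (ℕ.m⊔n≤o⇒m≤o N₁ N₂ N≤n)) (h₂ n (ℕ.m⊔n≤o⇒n≤o N₁ N₂ N≤n)) ⟩
    ½ * ε + ½ * ε  ≡⟨ ½+½ ε ⟩
    ε              ∎
  where open ℚ.≤-Reasoning

∑-nonNeg : ∀ {f} n → (∀ k → 0ℚ ≤ f k) → 0ℚ ≤ ∑ n f
∑-nonNeg zero    h = ℚ.≤-refl
∑-nonNeg (suc n) h = 0≤+ (∑-nonNeg n h) (h (suc n))

cesàro : ∀ {A} → (∀ n → 0ℚ ≤ A n) → Null A → Null (λ n → ∑ n A * recip n)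
cesàro {A} 0≤A null ε 0<ε =
  let N , h   = null (½ * ε) (0<* 0<½ 0<ε)
      N′ , h′ = Null-scale (∑ N A) (∑-nonNeg N 0≤A) recip-nonNeg recip-null (½ * ε) (0<* 0<½ 0<ε)
  in suc (N ℕ.⊔ N′) , λ where
    (suc n) (s≤s N≤n) → begin
      ∑ (suc n) A * recip (suc n)
        ≤⟨ ℚ.*-monoʳ-≤-nonNeg (recip (suc n)) {{nonNegative (recip-nonNeg (suc n))}}
             (bound N h (suc n) (ℕ.m≤n⇒m≤1+n (ℕ.m⊔n≤o⇒m≤o N N′ N≤n))) ⟩
      (∑ N A + ι (suc n) * (½ * ε)) * recip (suc n)
        ≡⟨ solve 4 (λ s i e r → (s :+ i :* e) :* r := s :* r :+ (r :* i) :* e) refl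
             (∑ N A) (ι (suc n)) (½ * ε) (recip (suc n)) ⟩
      ∑ N A * recip (suc n) + (recip (suc n) * ι (suc n)) * (½ * ε)
        ≤⟨ ℚ.+-mono-≤ (h′ (suc n) (ℕ.m≤n⇒m≤1+n (ℕ.m⊔n≤o⇒n≤o N N′ N≤n)))
             (ℚ.≤-reflexive (trans (cong (_* (½ * ε)) (recip-ι n)) (ℚ.*-identityˡ (½ * ε)))) ⟩
      ½ * ε + ½ * ε
        ≡⟨ ½+½ ε ⟩
      ε ∎
  where
  open ℚ.≤-Reasoning
  open +-*-Solver
  e = ½ * ε
  bound′ : ∀ N → (∀ n → N ℕ.≤ n → A n ≤ e) → ∀ k → ∑ (k ℕ.+ N) A ≤ ∑ N A + ι k * e
  bound′ N h zero    = ℚ.≤-reflexive (solve 2 (λ s e → s := s :+ con 0ℚ :* e) refl (∑ N A) e)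
  bound′ N h (suc k) = begin
    ∑ (k ℕ.+ N) A + A (suc (k ℕ.+ N))
      ≤⟨ ℚ.+-mono-≤ (bound′ N h k) (h _ (ℕ.m≤n⇒m≤1+n (ℕ.m≤n+m N k))) ⟩
    (∑ N A + ι k * e) + e
      ≡⟨ solve 3 (λ s i e → (s :+ i :* e) :+ e := s :+ (i :+ con 1ℚ) :* e) refl (∑ N A) (ι k) e ⟩
    ∑ N A + (ι k + 1ℚ) * e
      ≡⟨ cong (λ i → ∑ N A + i * e) (ι-suc k) ⟨
    ∑ N A + ι (suc k) * e ∎
  ι-nonNeg : ∀ k → 0ℚ ≤ ι k
  ι-nonNeg k = ℚ.nonNegative⁻¹ (ι k) {{ℚ.normalize-nonNeg k 1}}
  ι-mono : ∀ k N → ι k ≤ ι (N ℕ.+ k)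
  ι-mono k zero    = ℚ.≤-refl
  ι-mono k (suc N) = ℚ.≤-trans (ι-mono k N) (≤-by
    (trans (cong (_- ι (N ℕ.+ k)) (ι-suc (N ℕ.+ k))) (solve 1 (λ x → (x :+ con 1ℚ) :- x := con 1ℚ) refl (ι (N ℕ.+ k)))) 0≤1)
  bound : ∀ N → (∀ n → N ℕ.≤ n → A n ≤ e) → ∀ n → N ℕ.≤ n → ∑ n A ≤ ∑ N A + ι n * e
  bound N h n N≤n = begin
    ∑ n A                       ≡⟨ cong (λ n → ∑ n A) (ℕ.m∸n+n≡m N≤n) ⟨
    ∑ (n ℕ.∸ N ℕ.+ N) A         ≤⟨ bound′ N h (n ℕ.∸ N) ⟩
    ∑ N A + ι (n ℕ.∸ N) * e     ≤⟨ ℚ.+-monoʳ-≤ (∑ N A) (ℚ.*-monoʳ-≤-nonNeg e {{nonNegative (ℚ.<⇒≤ (0<* 0<½ 0<ε))}}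
                                     (subst (λ n′ → ι (n ℕ.∸ N) ≤ ι n′) (ℕ.m+[n∸m]≡n N≤n) (ι-mono (n ℕ.∸ N) N))) ⟩
    ∑ N A + ι n * e             ∎

M : ℕ → ℕ → ℚ
M zero    n = 1ℚ
M (suc d) n = ∑ n λ k → M d k * recip k

M-nonNeg : ∀ d n → 0ℚ ≤ M d n
M-nonNeg zero    n = 0≤1
M-nonNeg (suc d) n = ∑-nonNeg n λ k → 0≤* (M-nonNeg d k) (recip-nonNeg k)

M-suc : ∀ d n → M d n ≤ M d (suc n)
M-suc zero    n = ℚ.≤-refl
M-suc (suc d) n = ≤-by
  (solve 2 (λ x y → (x :+ y) :- x := y) refl (M (suc d) n) (M d (suc n) * recip (suc n)))
  (0≤* (M-nonNeg d (suc n)) (recip-nonNeg (suc n)))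
  where open +-*-Solver

M/n-null : ∀ d → Null (λ n → M d n * recip n)
M/n-null zero    ε 0<ε = let N , h = recip-null ε 0<ε in
  N , λ n N≤n → ℚ.≤-trans (ℚ.≤-reflexive (ℚ.*-identityˡ (recip n))) (h n N≤n)
M/n-null (suc d) = cesàro (λ n → 0≤* (M-nonNeg d n) (recip-nonNeg n)) (M/n-null d)

G : ℕ → ℕ → ℚ
G zero    n = recip n
G (suc d) n = M (suc d) n * recip n + (1ℚ + 1ℚ) * G d n

G-nonNeg : ∀ d n → 0ℚ ≤ G d n
G-nonNeg zero    n = recip-nonNeg n
G-nonNeg (suc d) n = 0≤+ (0≤* (M-nonNeg (suc d) n) (recip-nonNeg n)) (0≤* (0≤+ 0≤1 0≤1) (G-nonNeg d n))

G-null : ∀ d → Null (G d)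
G-null zero    = recip-null
G-null (suc d) = Null-+ (M/n-null (suc d)) (Null-scale (1ℚ + 1ℚ) (0≤+ 0≤1 0≤1) (G-nonNeg d) (G-null d))

G-step : ∀ d n →
  M d (suc (suc n)) * (recip (suc (suc n)) * recip (suc (suc n))) ≤ G d (suc n) - G d (suc (suc n))
G-step d n = go d
  where
  open +-*-Solver
  a = recip (suc n)
  b = recip (suc (suc n))
  b² : 0ℚ ≤ (a - b) - b * b
  b² = subst (0ℚ ≤_)
    (trans (solve 2 (λ a b → b :* (a :- b) := a :* b :- b :* b) refl a b)
           (cong (_- b * b) (sym (recip-diff n))))
    (0≤* (recip-nonNeg (suc (suc n))) (p≤q⇒0≤q-p (recip-suc-≤ n)))
  go : ∀ d → M d (suc (suc n)) * (b * b) ≤ G d (suc n) - G d (suc (suc n))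
  go zero    = ≤-by (solve 2 (λ a b → (a :- b) :- con 1ℚ :* (b :* b) := (a :- b) :- b :* b) refl a b) b²
  go (suc d) = ≤-by
    (solve 6 (λ a b w m g h →
        ((w :* a :+ (con 1ℚ :+ con 1ℚ) :* g)
          :- ((w :+ m :* b) :* b :+ (con 1ℚ :+ con 1ℚ) :* h))
          :- (w :+ m :* b) :* (b :* b)
        := ((w :+ m :* b) :* ((a :- b) :- b :* b)
            :+ (con 1ℚ :+ con 1ℚ) :* ((g :- h) :- m :* (b :* b)))
            :+ (m :* b) :* ((b :+ b) :- a))
      refl a b w m g h)
    (0≤+ (0≤+ (0≤* (M-nonNeg (suc d) (suc (suc n))) b²)
              (0≤* (0≤+ 0≤1 0≤1) (p≤q⇒0≤q-p (go d))))
         (0≤* (0≤* (M-nonNeg d (suc (suc n))) (recip-nonNeg (suc (suc n)))) (recip-≤-double n)))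
    where
    w = M (suc d) (suc n) ; m = M d (suc (suc n)) ; g = G d (suc n) ; h = G d (suc (suc n))

series-cauchy : ∀ d f → (∀ n → ∣ f (suc n) ∣ ≤ M d (suc n) * (recip (suc n) * recip (suc n))) →
  Cauchy (λ N → ∑ N f)
series-cauchy d f dom = telescope⇒cauchy {s = λ N → ∑ N f} (G-nonNeg d) (G-null d) λ n → begin
  ∣ ∑ (suc (suc n)) f - ∑ (suc n) f ∣
    ≡⟨ cong ∣_∣ (solve 2 (λ x y → (x :+ y) :- x := y) refl (∑ (suc n) f) (f (suc (suc n)))) ⟩
  ∣ f (suc (suc n)) ∣
    ≤⟨ dom (suc n) ⟩
  M d (suc (suc n)) * (recip (suc (suc n)) * recip (suc (suc n)))
    ≤⟨ G-step d n ⟩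
  G d (suc n) - G d (suc (suc n)) ∎
  where open ℚ.≤-Reasoning
        open +-*-Solver

∑-∣∣ : ∀ {f g} n → (∀ k → ∣ f (suc k) ∣ ≤ g (suc k)) → ∣ ∑ n f ∣ ≤ ∑ n g
∑-∣∣ zero h = ℚ.≤-refl
∑-∣∣ {f} {g} (suc n) h = ℚ.≤-trans (ℚ.∣p+q∣≤∣p∣+∣q∣ (∑ n f) (f (suc n))) (ℚ.+-mono-≤ (∑-∣∣ n h) (h n))

∣*∣-≤ : ∀ {p q u v} → ∣ p ∣ ≤ u → ∣ q ∣ ≤ v → ∣ p * q ∣ ≤ u * v
∣*∣-≤ {p} {q} p≤u q≤v = ℚ.≤-trans (ℚ.≤-reflexive (ℚ.∣p*q∣≡∣p∣*∣q∣ p q))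
  (*-mono-≤ (ℚ.≤-trans (ℚ.0≤∣p∣ p) p≤u) (ℚ.0≤∣p∣ q) p≤u q≤v)

∣recip∣ : ∀ n → ∣ recip n ∣ ≤ recip n
∣recip∣ n = ℚ.≤-reflexive (ℚ.0≤p⇒∣p∣≡p (recip-nonNeg n))

∣^∣-≤1 : ∀ {p} → ∣ p ∣ ≤ 1ℚ → ∀ k → ∣ p ^ k ∣ ≤ 1ℚ
∣^∣-≤1 h zero    = ℚ.≤-refl
∣^∣-≤1 h (suc k) = ∣*∣-≤ h (∣^∣-≤1 h k)

∣recip^∣-≤1 : ∀ n k → ∣ recip n ^ k ∣ ≤ 1ℚ
∣recip^∣-≤1 n = ∣^∣-≤1 (ℚ.≤-trans (∣recip∣ n) (recip-≤1 n))

∣recip^∣-≤ : ∀ n {k} → 1 ℕ.≤ k → ∣ recip n ^ k ∣ ≤ recip n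
∣recip^∣-≤ n (s≤s {n = k} _) = ℚ.≤-trans (∣*∣-≤ (∣recip∣ n) (∣recip^∣-≤1 n k)) (ℚ.≤-reflexive (ℚ.*-identityʳ (recip n)))

∣recip^∣-≤² : ∀ n {k} → 2 ℕ.≤ k → ∣ recip n ^ k ∣ ≤ recip n * recip n
∣recip^∣-≤² n (s≤s h) = ∣*∣-≤ (∣recip∣ n) (∣recip^∣-≤ n h)

∣sgn^∣-≤1 : ∀ x n → ∣ sgn x ^ n ∣ ≤ 1ℚ
∣sgn^∣-≤1 Sign.+ = ∣^∣-≤1 ℚ.≤-refl
∣sgn^∣-≤1 Sign.- = ∣^∣-≤1 ℚ.≤-refl

ζ-sum-bound : ∀ {q} (k : Vec ℕ q) → VecAll.All (1 ℕ.≤_) k → ∀ n → ∣ ζ-sum k n ∣ ≤ M q n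
ζ-sum-bound []       []       n = ℚ.≤-refl
ζ-sum-bound {suc q} (k ∷ ks) (h ∷ hs) n = ∑-∣∣ n λ i → ℚ.≤-trans
  (∣*∣-≤ (∣recip^∣-≤ (suc i) h) (ℚ.≤-trans (ζ-sum-bound ks hs i) (M-suc q i)))
  (ℚ.≤-reflexive (ℚ.*-comm (recip (suc i)) (M q (suc i))))

Li-sum-bound : ∀ {q} (a : Vec ℕ q) x → VecAll.All (1 ℕ.≤_) a → ∀ n → ∣ Li-sum a x n ∣ ≤ M q n
Li-sum-bound []       []       []       n = ℚ.≤-refl
Li-sum-bound {suc q} (a ∷ as) (x ∷ xs) (h ∷ hs) n = ∑-∣∣ n λ i → ℚ.≤-trans
  (∣*∣-≤ (∣*∣-≤ (∣sgn^∣-≤1 x (suc i)) (∣recip^∣-≤ (suc i) h))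
         (ℚ.≤-trans (Li-sum-bound as xs hs i) (M-suc q i)))
  (ℚ.≤-reflexive (trans (cong (_* M q (suc i)) (ℚ.*-identityˡ (recip (suc i))))
                        (ℚ.*-comm (recip (suc i)) (M q (suc i)))))

ζ⋆-sum-bound : ∀ k → All (1 ℕ.≤_) k → ∀ n → ∣ ζ⋆-sum k n ∣ ≤ M (List.length k) n
ζ⋆-sum-bound []       []       n = ℚ.≤-refl
ζ⋆-sum-bound (k ∷ ks) (h ∷ hs) n = ∑-∣∣ n λ i → ℚ.≤-trans
  (∣*∣-≤ (∣recip^∣-≤ (suc i) h) (ζ⋆-sum-bound ks hs (suc i)))
  (ℚ.≤-reflexive (ℚ.*-comm (recip (suc i)) (M (List.length ks) (suc i))))

nCk≤2^n : ∀ n k → n C k ℕ.≤ 2 ℕ.^ n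
nCk≤2^n zero    zero    = ℕ.≤-refl
nCk≤2^n zero    (suc k) = z≤n
nCk≤2^n (suc n) zero    = ℕ.m^n>0 2 (suc n)
nCk≤2^n (suc n) (suc k) = subst (ℕ._≤ 2 ℕ.^ suc n) (nCk+nC[k+1]≡[n+1]C[k+1] n k)
  (ℕ.+-mono-≤ (nCk≤2^n n k) (subst (n C suc k ℕ.≤_) (sym (ℕ.+-identityʳ (2 ℕ.^ n))) (nCk≤2^n n (suc k))))

centralBinomial/4^-bound : ∀ n → ∣ centralBinomial/4^ n ∣ ≤ 1ℚ
centralBinomial/4^-bound n = bound (4 ℕ.^ n) {{ℕ.m^n≢0 4 n}}
  (subst ((2 ℕ.* n) C n ℕ.≤_) (sym (ℕ.^-*-assoc 2 2 n)) (nCk≤2^n (2 ℕ.* n) n))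
  where
  bound : ∀ {c} d .{{_ : ℕ.NonZero d}} → c ℕ.≤ d → ∣ + c / d ∣ ≤ 1ℚ
  bound {c} (suc d) c≤d = ℚ.≤-trans
    (ℚ.≤-reflexive (ℚ.0≤p⇒∣p∣≡p (ℚ.nonNegative⁻¹ (+ c / suc d) {{ℚ.normalize-nonNeg c (suc d)}})))
    (ℚ.toℚᵘ-cancel-≤ (ℚᵘ.≤-respˡ-≃ (ℚᵘ.≃-sym (/ᵘ c d))
      (ℚᵘ.*≤* (subst₂ ℤ._≤_ (sym (ℤ.*-identityʳ (+ c))) (sym (ℤ.*-identityˡ (+ suc d))) (ℤ.+≤+ c≤d)))))

-- Entries are positive and the first is at least 2; the empty index is allowed.
Admissible : ∀ {q} → Vec ℕ q → Set
Admissible []       = ⊤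
Admissible (k ∷ ks) = 2 ℕ.≤ k × VecAll.All (1 ℕ.≤_) ks

ζ : ∀ {q} (k : Vec ℕ q) → Admissible k → ℝ
ζ k adm = lim (ζ-sum k) (conv k adm)
  where
  conv : ∀ {q} (k : Vec ℕ q) → Admissible k → Cauchy (ζ-sum k)
  conv []       _ = cauchy (fromℚ 1ℚ)
  conv {suc q} (k ∷ ks) (2≤k , h) = series-cauchy q _ λ i → ℚ.≤-trans
    (∣*∣-≤ (∣recip^∣-≤² (suc i) 2≤k) (ℚ.≤-trans (ζ-sum-bound ks h i) (M-suc q i)))
    (ℚ.≤-reflexive (ℚ.*-comm (recip (suc i) * recip (suc i)) (M q (suc i))))

Li : ∀ {q} (a : Vec ℕ q) (x : Vec Sign q) → Admissible a → ℝ
Li a x adm = lim (Li-sum a x) (conv a x adm)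
  where
  conv : ∀ {q} (a : Vec ℕ q) (x : Vec Sign q) → Admissible a → Cauchy (Li-sum a x)
  conv []       []       _ = cauchy (fromℚ 1ℚ)
  conv {suc q} (a ∷ as) (x ∷ xs) (2≤a , h) = series-cauchy q _ λ i → ℚ.≤-trans
    (∣*∣-≤ (∣*∣-≤ (∣sgn^∣-≤1 x (suc i)) (∣recip^∣-≤² (suc i) 2≤a))
           (ℚ.≤-trans (Li-sum-bound as xs h i) (M-suc q i)))
    (ℚ.≤-reflexive (trans (cong (_* M q (suc i)) (ℚ.*-identityˡ (recip (suc i) * recip (suc i))))
                          (ℚ.*-comm (recip (suc i) * recip (suc i)) (M q (suc i)))))

-- The series also converges for k = 1, a case not needed here.
ζB⋆ : (k : ℕ) (ks : List ℕ) → 2 ℕ.≤ k → All (1 ℕ.≤_) ks → ℝ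
ζB⋆ k ks 2≤k h = lim (ζB⋆-sum k ks) (series-cauchy (List.length ks) _ λ i → ℚ.≤-trans
  (∣*∣-≤ (∣*∣-≤ (∣recip^∣-≤² (suc i) 2≤k) (ζ⋆-sum-bound ks h (suc i))) (centralBinomial/4^-bound (suc i)))
  (ℚ.≤-reflexive (trans (ℚ.*-identityʳ _) (ℚ.*-comm (recip (suc i) * recip (suc i)) (M (List.length ks) (suc i))))))

-- log 2 = ∫₁² dt/t, as the limit of the right Riemann sums
-- ∑_{k=1}^{N} (1/N) · 1/(1 + k/N) = ∑_{k=1}^{N} 1/(N + k).
log2-sum : ℕ → ℚ
log2-sum N = ∑ N λ k → recip (N ℕ.+ k)

log2-cauchy : Cauchy log2-sum
log2-cauchy = telescope⇒cauchy {s = log2-sum} recip-nonNeg recip-null step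
  where
  open +-*-Solver
  H : ℕ → ℚ
  H n = ∑ n recip
  H-+ : ∀ n k → H (n ℕ.+ k) ≡ H n + ∑ k (λ i → recip (n ℕ.+ i))
  H-+ n zero    = trans (cong H (ℕ.+-identityʳ n)) (sym (ℚ.+-identityʳ (H n)))
  H-+ n (suc k) = begin
    H (n ℕ.+ suc k)                       ≡⟨ cong H (ℕ.+-suc n k) ⟩
    H (n ℕ.+ k) + recip (suc (n ℕ.+ k))   ≡⟨ cong₂ _+_ (H-+ n k) (cong recip (sym (ℕ.+-suc n k))) ⟩
    (H n + S) + recip (n ℕ.+ suc k)       ≡⟨ ℚ.+-assoc (H n) S (recip (n ℕ.+ suc k)) ⟩
    H n + (S + recip (n ℕ.+ suc k))       ∎
    where open ≡-Reasoning
          S = ∑ k (λ i → recip (n ℕ.+ i))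
  as-H : ∀ n → log2-sum n ≡ H (n ℕ.+ n) - H n
  as-H n = trans (solve 2 (λ h s → s := (h :+ s) :- h) refl (H n) (log2-sum n))
                 (cong (_- H n) (sym (H-+ n n)))
  halve : ∀ n → recip (suc n) ≡ recip (suc n ℕ.+ suc n) + recip (suc n ℕ.+ suc n)
  halve n = begin
    a                        ≡⟨ ℚ.*-identityʳ a ⟨
    a * 1ℚ                   ≡⟨ cong (a *_) (recip-ι (n ℕ.+ suc n)) ⟨
    a * (b * ι (suc n ℕ.+ suc n))  ≡⟨ cong (λ u → a * (b * u)) (ι-+ (suc n) (suc n)) ⟩
    a * (b * (x + x))        ≡⟨ solve 3 (λ a b x → a :* (b :* (x :+ x)) := (a :* x) :* (b :+ b)) refl a b x ⟩
    (a * x) * (b + b)        ≡⟨ trans (cong (_* (b + b)) (recip-ι n)) (ℚ.*-identityˡ (b + b)) ⟩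
    b + b                    ∎
    where
    open ≡-Reasoning
    a = recip (suc n) ; b = recip (suc n ℕ.+ suc n) ; x = ι (suc n)
    ι-+ : ∀ i j → ι (i ℕ.+ j) ≡ ι i + ι j
    ι-+ zero    j = sym (ℚ.+-identityˡ (ι j))
    ι-+ (suc i) j = begin
      ι (suc (i ℕ.+ j))   ≡⟨ trans (ι-suc (i ℕ.+ j)) (cong (_+ 1ℚ) (ι-+ i j)) ⟩
      (ι i + ι j) + 1ℚ    ≡⟨ solve 2 (λ x y → (x :+ y) :+ con 1ℚ := (x :+ con 1ℚ) :+ y) refl (ι i) (ι j) ⟩
      (ι i + 1ℚ) + ι j    ≡⟨ cong (_+ ι j) (ι-suc i) ⟨
      ι (suc i) + ι j     ∎
  diff : ∀ n → log2-sum (suc n) - log2-sum n ≡ recip (suc (n ℕ.+ n)) * recip (suc (suc (n ℕ.+ n)))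
  diff n = begin
    log2-sum (suc n) - log2-sum n
      ≡⟨ cong₂ _-_ (as-H (suc n)) (as-H n) ⟩
    (H (suc (n ℕ.+ suc n)) - H (suc n)) - (H (n ℕ.+ n) - H n)
      ≡⟨ cong (λ k → (H (suc k) - H (suc n)) - (H (n ℕ.+ n) - H n)) (ℕ.+-suc n n) ⟩
    (((h + a) + b) - (g + recip (suc n))) - (h - g)
      ≡⟨ cong (λ u → (((h + a) + b) - (g + u)) - (h - g))
           (trans (halve n) (cong (λ k → recip (suc k) + recip (suc k)) (ℕ.+-suc n n))) ⟩
    (((h + a) + b) - (g + (b + b))) - (h - g)
      ≡⟨ solve 4 (λ h g a b → (((h :+ a) :+ b) :- (g :+ (b :+ b))) :- (h :- g) := a :- b) refl h g a b ⟩
    a - b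
      ≡⟨ recip-diff (n ℕ.+ n) ⟩
    a * b ∎
    where
    open ≡-Reasoning
    h = H (n ℕ.+ n) ; g = H n
    a = recip (suc (n ℕ.+ n)) ; b = recip (suc (suc (n ℕ.+ n)))
  step : ∀ n → ∣ log2-sum (suc (suc n)) - log2-sum (suc n) ∣ ≤ recip (suc n) - recip (suc (suc n))
  step n = begin
    ∣ log2-sum (suc (suc n)) - log2-sum (suc n) ∣
      ≡⟨ cong ∣_∣ (diff (suc n)) ⟩
    ∣ recip (suc (suc n ℕ.+ suc n)) * recip (suc (suc (suc n ℕ.+ suc n))) ∣
      ≤⟨ ∣*∣-≤ (le (suc n ℕ.+ suc n) n (ℕ.m≤n⇒m≤1+n (ℕ.m≤m+n n (suc n))))
               (le (suc (suc n ℕ.+ suc n)) (suc n) (s≤s (ℕ.m≤n⇒m≤1+n (ℕ.m≤m+n n (suc n))))) ⟩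
    recip (suc n) * recip (suc (suc n))
      ≡⟨ recip-diff n ⟨
    recip (suc n) - recip (suc (suc n)) ∎
    where
    open ℚ.≤-Reasoning
    le : ∀ j i → i ℕ.≤ j → ∣ recip (suc j) ∣ ≤ recip (suc i)
    le j i i≤j = ℚ.≤-trans (∣recip∣ (suc j))
      (subst (λ k → recip (suc k) ≤ recip (suc i)) (ℕ.m∸n+n≡m i≤j) (recip-antitone (j ℕ.∸ i) i))

log2 : ℝ
log2 = lim log2-sum log2-cauchy

-- a₁, a₁+a₂, …, a₁+⋯+a_{q-1}
partialSums : List ℕ → List ℕ
partialSums []               = []
partialSums (a ∷ [])         = []
partialSums (a ∷ as@(_ ∷ _)) = a ∷ List.map (a ℕ.+_) (partialSums as)

-- Meaningful when the entries of a are positive.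
record IsHoffmanDual (a a′ : List ℕ) : Set where
  field
    indices≥1 : All (1 ℕ.≤_) a′
    weight   : ℕ.sum a′ ≡ ℕ.sum a
    union    : ∀ n → (n ∈ partialSums a ⊎ n ∈ partialSums a′) ⇔ (1 ℕ.≤ n × n ℕ.< ℕ.sum a)
    disjoint : ∀ n → n ∈ partialSums a → n ∈ partialSums a′ → ⊥

open IsHoffmanDual public

incrementHead : List ℕ → List ℕ
incrementHead []       = []
incrementHead (a ∷ as) = suc a ∷ as

-- The dual of (a₁, …, a_q) starts with {1}_{a₁-1}; the next entry reaches
-- past a₁, so it is one more than the first entry of (a₂, …, a_q)^∨.
_^∨ : List ℕ → List ℕ
[]               ^∨ = []
(a ∷ [])         ^∨ = List.replicate a 1
(a ∷ as@(_ ∷ _)) ^∨ = List.replicate (a ℕ.∸ 1) 1 List.++ incrementHead (as ^∨)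

^∨-positive : ∀ a → All (1 ℕ.≤_) (a ^∨)
^∨-positive []               = []
^∨-positive (a ∷ [])         = ones a
  where
  ones : ∀ n → All (1 ℕ.≤_) (List.replicate n 1)
  ones zero    = []
  ones (suc n) = ℕ.≤-refl ∷ ones n
^∨-positive (a ∷ as@(_ ∷ _)) = ones (a ℕ.∸ 1) (incr (^∨-positive as))
  where
  ones : ∀ {xs} n → All (1 ℕ.≤_) xs → All (1 ℕ.≤_) (List.replicate n 1 List.++ xs)
  ones zero    h = h
  ones (suc n) h = ℕ.≤-refl ∷ ones n h
  incr : ∀ {xs} → All (1 ℕ.≤_) xs → All (1 ℕ.≤_) (incrementHead xs)
  incr []       = []
  incr (_ ∷ hs) = s≤s z≤n ∷ hs

private
  record Complementary (a b : List ℕ) : Set where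
    field
      weight≡ : ℕ.sum b ≡ ℕ.sum a
      sound   : ∀ n → (n ∈ partialSums a ⊎ n ∈ partialSums b) → 1 ℕ.≤ n × n ℕ.< ℕ.sum a
      cover   : ∀ n → 1 ℕ.≤ n × n ℕ.< ℕ.sum a → n ∈ partialSums a ⊎ n ∈ partialSums b
      apart   : ∀ n → n ∈ partialSums a → n ∈ partialSums b → ⊥
  open Complementary

  comp-sym : ∀ {a b} → Complementary a b → Complementary b a
  comp-sym c .weight≡ = sym (weight≡ c)
  comp-sym c .sound n h rewrite weight≡ c = sound c n (swap h)
  comp-sym c .cover n h rewrite weight≡ c = swap (cover c n h)
  comp-sym c .apart n h h′ = apart c n h′ h

  inc-sums : ∀ a as → partialSums (suc a ∷ as) ≡ List.map suc (partialSums (a ∷ as))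
  inc-sums a []       = refl
  inc-sums a (b ∷ bs) = cong (suc a ∷_) (map-suc (partialSums (b ∷ bs)))
    where
    map-suc : ∀ xs → List.map (suc a ℕ.+_) xs ≡ List.map suc (List.map (a ℕ.+_) xs)
    map-suc []       = refl
    map-suc (x ∷ xs) = cong (_ ∷_) (map-suc xs)

  suc∈ : ∀ {n xs} → suc n ∈ List.map suc xs → n ∈ xs
  suc∈ h with ∈-map⁻ suc h
  ... | _ , x∈ , refl = x∈

  0∉ : ∀ {xs} → ¬ 0 ∈ List.map suc xs
  0∉ h with ∈-map⁻ suc h
  ... | _ , _ , ()

  comp-step : ∀ {a as b bs} → 1 ℕ.≤ a → Complementary (a ∷ as) (b ∷ bs) →
              Complementary (suc a ∷ as) (1 ∷ b ∷ bs)
  comp-step {a} {as} {b} {bs} 1≤a c = record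
    { weight≡ = cong suc (weight≡ c)
    ; sound = λ n → λ where
        (inj₁ h) → below n (subst (n ∈_) (inc-sums a as) h) inj₁
        (inj₂ (here refl)) → s≤s z≤n , s≤s (ℕ.≤-trans 1≤a (ℕ.m≤m+n a (ℕ.sum as)))
        (inj₂ (there h)) → below n h inj₂
    ; cover = λ where
        (suc zero) _ → inj₂ (here refl)
        (suc (suc n)) (_ , s≤s lt) → above (suc n) (cover c (suc n) (s≤s z≤n , lt))
    ; apart = λ n h h′ → no-common n (subst (n ∈_) (inc-sums a as) h) h′
    }
    where
    below : ∀ n {xs} → n ∈ List.map suc xs →
            (∀ {k} → k ∈ xs → k ∈ partialSums (a ∷ as) ⊎ k ∈ partialSums (b ∷ bs)) →
            1 ℕ.≤ n × n ℕ.< suc (ℕ.sum (a ∷ as))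
    below zero    h f with () ← 0∉ h
    below (suc n) h f = s≤s z≤n , s≤s (proj₂ (sound c n (f (suc∈ h))))
    above : ∀ n → n ∈ partialSums (a ∷ as) ⊎ n ∈ partialSums (b ∷ bs) →
            suc n ∈ partialSums (suc a ∷ as) ⊎ suc n ∈ partialSums (1 ∷ b ∷ bs)
    above n (inj₁ h) = inj₁ (subst (suc n ∈_) (sym (inc-sums a as)) (∈-map⁺ suc h))
    above n (inj₂ h) = inj₂ (there (∈-map⁺ suc h))
    no-common : ∀ n → n ∈ List.map suc (partialSums (a ∷ as)) → n ∈ partialSums (1 ∷ b ∷ bs) → ⊥
    no-common zero    h h′ = 0∉ h
    no-common (suc n) h (here refl) with proj₁ (sound c 0 (inj₁ (suc∈ h)))
    ... | ()
    no-common (suc n) h (there h′) = apart c n (suc∈ h) (suc∈ h′)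

  comp-steps : ∀ {as b bs} k → Complementary (1 ∷ as) (b ∷ bs) →
               Complementary (suc k ∷ as) (List.replicate k 1 List.++ b ∷ bs)
  comp-steps zero    c = c
  comp-steps (suc zero)    c = comp-step ℕ.≤-refl c
  comp-steps (suc (suc k)) c = comp-step (s≤s z≤n) (comp-steps (suc k) c)

  comp-one : Complementary (1 ∷ []) (1 ∷ [])
  comp-one .weight≡ = refl
  comp-one .sound n (inj₁ ())
  comp-one .sound n (inj₂ ())
  comp-one .cover zero (() , _)
  comp-one .cover (suc n) (_ , s≤s ())
  comp-one .apart n ()

  replicate-snoc : ∀ k → List.replicate k 1 List.++ 1 ∷ [] ≡ List.replicate (suc k) 1
  replicate-snoc zero    = refl
  replicate-snoc (suc k) = cong (1 ∷_) (replicate-snoc k)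

  ^∨-comp : ∀ a as → All (1 ℕ.≤_) (a ∷ as) → Complementary (a ∷ as) ((a ∷ as) ^∨)
  ^∨-comp zero    _  (() ∷ _)
  ^∨-comp (suc a) [] _ = subst (Complementary (suc a ∷ [])) (replicate-snoc a) (comp-steps a comp-one)
  ^∨-comp (suc a) (b ∷ bs) (_ ∷ h)
    with (b ∷ bs) ^∨ | ^∨-comp b bs h | ^∨-positive (b ∷ bs)
  ^∨-comp (suc a) (b ∷ bs) (_ ∷ s≤s _ ∷ _) | [] | c | _ with () ← weight≡ c
  ... | d ∷ ds | c | 1≤d ∷ _ = comp-steps a (comp-sym (comp-step 1≤d (comp-sym c)))

^∨-isHoffmanDual : ∀ a → All (1 ℕ.≤_) a → IsHoffmanDual a (a ^∨)
^∨-isHoffmanDual [] _ = record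
  { indices≥1 = []
  ; weight   = refl
  ; union    = λ n → mk⇔ (λ { (inj₁ ()) ; (inj₂ ()) }) λ { (_ , ()) }
  ; disjoint = λ _ ()
  }
^∨-isHoffmanDual (a ∷ as) h = record
  { indices≥1 = ^∨-positive (a ∷ as)
  ; weight   = weight≡ c
  ; union    = λ n → mk⇔ (sound c n) (cover c n)
  ; disjoint = apart c
  }
  where c = ^∨-comp a as h

-- (m₁, m₂+1, …, m_j+1), for j ≥ 1
prefix : (ℕ → ℕ) → ℕ → List ℕ
prefix m j = m 1 ∷ List.applyUpTo (λ i → suc (m (2 ℕ.+ i))) (j ℕ.∸ 1)

prefix-positive : ∀ m j → 1 ℕ.≤ m 1 → All (1 ℕ.≤_) (prefix m j)
prefix-positive m j h = h ∷ All.applyUpTo⁺₂ _ (j ℕ.∸ 1) λ _ → s≤s z≤n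

-- The k entries m_p+1, m_{p-1}+1, …, m_{p-k+1}+1
descending : (ℕ → ℕ) → ℕ → (k : ℕ) → Vec ℕ k
descending m p zero    = []
descending m p (suc k) = suc (m p) ∷ descending m (p ℕ.∸ 1) k

ones : ∀ r → Vec ℕ r
ones r = Vec.replicate r 1

descending-positive : ∀ m p k → VecAll.All (1 ℕ.≤_) (descending m p k)
descending-positive m p zero    = []
descending-positive m p (suc k) = s≤s z≤n ∷ descending-positive m (p ℕ.∸ 1) k

++ones-positive : ∀ {k} {v : Vec ℕ k} r → VecAll.All (1 ℕ.≤_) v → VecAll.All (1 ℕ.≤_) (v Vec.++ ones r)
++ones-positive zero    []       = []
++ones-positive (suc r) []       = ℕ.≤-refl ∷ ++ones-positive r []
++ones-positive r       (h ∷ hs) = h ∷ ++ones-positive r hs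

∷ʳ1-positive : ∀ {k} {v : Vec ℕ k} → VecAll.All (1 ℕ.≤_) v → VecAll.All (1 ℕ.≤_) (v Vec.∷ʳ 1)
∷ʳ1-positive []       = ℕ.≤-refl ∷ []
∷ʳ1-positive (h ∷ hs) = h ∷ ∷ʳ1-positive hs

descending-admissible : ∀ m p k → 1 ℕ.≤ m p → Admissible (descending m p k)
descending-admissible m p zero    _ = tt
descending-admissible m p (suc k) h = s≤s h , descending-positive m (p ℕ.∸ 1) k

descending++ones-admissible : ∀ m p r → 1 ℕ.≤ p → 1 ℕ.≤ m p → Admissible (descending m p p Vec.++ ones r)
descending++ones-admissible m (suc p) r _ h = s≤s h , ++ones-positive r (descending-positive m p p)

descending++ones∷ʳ1-admissible : ∀ m p r → 1 ℕ.≤ p → 1 ℕ.≤ m p →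
  Admissible ((descending m p p Vec.++ ones r) Vec.∷ʳ 1)
descending++ones∷ʳ1-admissible m (suc p) r _ h =
  s≤s h , ∷ʳ1-positive (++ones-positive r (descending-positive m p p))

-- (σ_n, …, σ_1) ↦ (σ_n, σ_n σ_{n-1}, …, σ_2 σ_1).  Appending σ_0 = -1 to σ
-- makes the result end in the further entry -σ_1.
consecutive : ∀ {n} → Vec Sign n → Vec Sign n
consecutive = from Sign.+
  where
  from : ∀ {n} → Sign → Vec Sign n → Vec Sign n
  from τ []      = []
  from τ (s ∷ σ) = (τ Sign.* s) ∷ from s σ

[-1]^_ : ℕ → ℝ
[-1]^ n = fromℚ ((- 1ℚ) ^ n)

module Submission where

-- For N ≥ n₁ > ⋯ > n_q > M put g(M) = ∑ ∏ nᵢ ^ -lᵢ with l = (m_p + 1, …, m₁ + 1, {1}_{r+1}).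
-- Its Newton series ∑ₙ (-1)ⁿ (z choose n) Δ g 0 n at z = -1/2 has the weights
-- (2n choose n) / 4ⁿ and converges, as N → ∞, to the same nested sum with every nᵢ
-- replaced by nᵢ - 1/2.  Dividing a sequence by its argument turns the differences at 1
-- into their averages; iterating this, Δ g 0 n becomes an alternating sum of products of
-- ζ-values and summands of ζ⋆-sums for Hoffman duals, so the series yields the ζ_B⋆-values.
-- Summing Li over all signs keeps only the terms with all nᵢ even, respectively all of the
-- same parity, and so gives ζ-values and the shifted nested sum.  The case l = (1) is
-- ζ_B⋆(1) = 2 log 2.
--
-- All of this holds for truncated sums up to an error O(N ^ -1/2 · (log N) ^ d): the local
-- errors are differences Δ x M (N - M), which are non-negative and decay like those of 1 / M.

open import Defs

-- Convergence of a Newton series is never invoked. The series at M is cut after K = N - M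
-- differences, so that `Φ` sees only values at M, ..., N: past N the tails change sign, and the
-- positivity behind every bound is lost. Along M + K = N, dividing by the argument and summing a
-- tail each commute with the shift by 1/2 up to one explicit boundary term (`Φ-div`, `Φ-tail`), and
-- g arises from the constant 1 by these two operations alone. Two losses shape the estimates. An
-- error of size N ^ -1/2 summed over all M up to N would not be small, so the factor 1 / M gained
-- in a division is recorded until the next tail is formed. And differences at 1 decay only like 1 /
-- n, so they are bounded apart from the others. Each trailing 1 of l multiplies the n-th difference
-- by -1 / n, apart from a multiple of 1 / n; the r + 1 ones thus produce the exponent r + 2 and the
-- terms ζ_B⋆(j + 1). Truncation also gives the case l = (1) a meaning: there the sum and its
-- shifted version both diverge, and only their difference has a limit.

module Truncations where

  import Algebra.Definitions.RawSemiring
  open import Data.Integer as ℤ using (+_)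
  import Data.Integer.Properties as ℤ
  open import Data.List as List using (List; []; _∷_)
  open import Data.List.Relation.Unary.All using ([]; _∷_)
  open import Data.Nat as ℕ using (ℕ; zero; suc; pred; z≤n; s≤s)
  open import Data.Nat.Combinatorics using (_C_; nCk+nC[k+1]≡[n+1]C[k+1]; nC1≡n; nCk≡nC[n∸k])
  import Data.Nat.Properties as ℕ
  open import Data.Nat.Solver renaming (module +-*-Solver to ℕ-Solver)
  open import Data.Product using (∃-syntax; _×_; _,_)
  open import Data.Rational hiding (_≃_)
  import Data.Rational.Properties as ℚ
  open import Data.Rational.Solver using (module +-*-Solver)
  import Data.Rational.Unnormalised as ℚᵘ
  import Data.Rational.Unnormalised.Properties as ℚᵘ
  open import Data.Sign as Sign using (Sign)
  open import Data.Sum using (inj₁; inj₂)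
  open import Data.Vec as Vec using (Vec; []; _∷_)
  open import Function using (_∘_)
  open import Relation.Binary.PropositionalEquality
  open Algebra.Definitions.RawSemiring ℚ.+-*-rawSemiring using (_^_)
  open +-*-Solver

  -- Finite sums and rational arithmetic

  ∑-cong : ∀ {f g} n → (∀ k → suc k ℕ.≤ n → f (suc k) ≡ g (suc k)) → ∑ n f ≡ ∑ n g
  ∑-cong zero    h = refl
  ∑-cong (suc n) h = cong₂ _+_ (∑-cong n λ k k<n → h k (ℕ.m≤n⇒m≤1+n k<n)) (h n ℕ.≤-refl)

  ∑-mono : ∀ {f g} n → (∀ k → suc k ℕ.≤ n → f (suc k) ≤ g (suc k)) → ∑ n f ≤ ∑ n g
  ∑-mono zero    h = ℚ.≤-refl
  ∑-mono (suc n) h = ℚ.+-mono-≤ (∑-mono n λ k k<n → h k (ℕ.m≤n⇒m≤1+n k<n)) (h n ℕ.≤-refl)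

  ∑-0 : ∀ n → ∑ n (λ _ → 0ℚ) ≡ 0ℚ
  ∑-0 zero    = refl
  ∑-0 (suc n) = trans (ℚ.+-identityʳ _) (∑-0 n)

  ∑-+ : ∀ f g n → ∑ n (λ k → f k + g k) ≡ ∑ n f + ∑ n g
  ∑-+ f g zero    = refl
  ∑-+ f g (suc n) = trans (cong (_+ (f (suc n) + g (suc n))) (∑-+ f g n))
    (solve 4 (λ a b x y → (a :+ b) :+ (x :+ y) := (a :+ x) :+ (b :+ y)) refl
      (∑ n f) (∑ n g) (f (suc n)) (g (suc n)))

  ∑-*ˡ : ∀ c f n → ∑ n (λ k → c * f k) ≡ c * ∑ n f
  ∑-*ˡ c f zero    = sym (ℚ.*-zeroʳ c)
  ∑-*ˡ c f (suc n) = trans (cong (_+ c * f (suc n)) (∑-*ˡ c f n))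
    (sym (ℚ.*-distribˡ-+ c (∑ n f) (f (suc n))))

  ∑-*ʳ : ∀ c f n → ∑ n (λ k → f k * c) ≡ ∑ n f * c
  ∑-*ʳ c f n = trans (∑-cong n λ k _ → ℚ.*-comm (f (suc k)) c)
    (trans (∑-*ˡ c f n) (ℚ.*-comm c (∑ n f)))

  ∑-head : ∀ f n → ∑ (suc n) f ≡ f 1 + ∑ n (f ∘ suc)
  ∑-head f zero    = ℚ.+-comm 0ℚ (f 1)
  ∑-head f (suc n) = trans (cong (_+ f (suc (suc n))) (∑-head f n))
    (ℚ.+-assoc (f 1) (∑ n (f ∘ suc)) (f (suc (suc n))))

  ∑-swap : ∀ (f : ℕ → ℕ → ℚ) m n → ∑ m (λ i → ∑ n (f i)) ≡ ∑ n (λ j → ∑ m (λ i → f i j))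
  ∑-swap f zero    n = sym (∑-0 n)
  ∑-swap f (suc m) n = trans (cong (_+ ∑ n (f (suc m))) (∑-swap f m n))
    (sym (∑-+ (λ j → ∑ m (λ i → f i j)) (f (suc m)) n))

  -- The bracket is the sum of x k over j < k ≤ n, so this is Fubini over j < k. It passes from sums
  -- that begin with the largest variable, as tails do, to sums in the order of `ζ-sum`.
  ∑-triangle : ∀ x y n →
    ∑ n (λ j → y j * (∑ n x - ∑ j x)) ≡ ∑ n (λ k → x k * ∑ (pred k) y)
  ∑-triangle x y zero    = refl
  ∑-triangle x y (suc n) = trans
    (cong₂ _+_
      (trans (∑-cong n λ j _ → solve 4 (λ y s t u → y :* ((s :+ u) :- t) := y :* (s :- t) :+ u :* y) refl
               (y (suc j)) (∑ n x) (∑ (suc j) x) (x (suc n)))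
        (trans (∑-+ (λ j → y j * (∑ n x - ∑ j x)) (λ j → x (suc n) * y j) n)
          (cong₂ _+_ (∑-triangle x y n) (∑-*ˡ (x (suc n)) y n))))
      (solve 2 (λ y s → y :* (s :- s) := con 0ℚ) refl (y (suc n)) (∑ (suc n) x)))
    (ℚ.+-identityʳ _)

  ∑-monoˡ : ∀ {f m n} → (∀ k → suc k ℕ.≤ n → 0ℚ ≤ f (suc k)) → m ℕ.≤ n → ∑ m f ≤ ∑ n f
  ∑-monoˡ {f} {zero}  {n}     h z≤n       = ℚ.≤-trans (ℚ.≤-reflexive (sym (∑-0 n))) (∑-mono n h)
  ∑-monoˡ {f} {suc m} {suc n} h (s≤s m≤n) = begin
    ∑ (suc m) f          ≡⟨ ∑-head f m ⟩
    f 1 + ∑ m (f ∘ suc)  ≤⟨ ℚ.+-monoʳ-≤ (f 1) (∑-monoˡ (λ k k<n → h (suc k) (s≤s k<n)) m≤n) ⟩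
    f 1 + ∑ n (f ∘ suc)  ≡⟨ ∑-head f n ⟨
    ∑ (suc n) f          ∎
    where open ℚ.≤-Reasoning

  ∑-split : ∀ f i j → ∑ (i ℕ.+ j) f ≡ ∑ i f + ∑ j (λ k → f (i ℕ.+ k))
  ∑-split f i zero    = trans (cong (λ k → ∑ k f) (ℕ.+-identityʳ i)) (sym (ℚ.+-identityʳ (∑ i f)))
  ∑-split f i (suc j) = begin
    ∑ (i ℕ.+ suc j) f
      ≡⟨ cong (λ k → ∑ k f) (ℕ.+-suc i j) ⟩
    ∑ (i ℕ.+ j) f + f (suc (i ℕ.+ j))
      ≡⟨ cong₂ _+_ (∑-split f i j) (cong f (sym (ℕ.+-suc i j))) ⟩
    (∑ i f + ∑ j (λ k → f (i ℕ.+ k))) + f (i ℕ.+ suc j)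
      ≡⟨ ℚ.+-assoc (∑ i f) (∑ j (λ k → f (i ℕ.+ k))) (f (i ℕ.+ suc j)) ⟩
    ∑ i f + (∑ j (λ k → f (i ℕ.+ k)) + f (i ℕ.+ suc j)) ∎
    where open ≡-Reasoning

  ι-+ : ∀ i j → ι (i ℕ.+ j) ≡ ι i + ι j
  ι-+ zero    j = sym (ℚ.+-identityˡ (ι j))
  ι-+ (suc i) j = begin
    ι (suc (i ℕ.+ j))  ≡⟨ trans (ι-suc (i ℕ.+ j)) (cong (_+ 1ℚ) (ι-+ i j)) ⟩
    (ι i + ι j) + 1ℚ   ≡⟨ solve 2 (λ x y → (x :+ y) :+ con 1ℚ := (x :+ con 1ℚ) :+ y) refl (ι i) (ι j) ⟩
    (ι i + 1ℚ) + ι j   ≡⟨ cong (_+ ι j) (ι-suc i) ⟨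
    ι (suc i) + ι j    ∎
    where open ≡-Reasoning

  ι-* : ∀ i j → ι (i ℕ.* j) ≡ ι i * ι j
  ι-* zero    j = sym (ℚ.*-zeroˡ (ι j))
  ι-* (suc i) j = begin
    ι (j ℕ.+ i ℕ.* j)  ≡⟨ trans (ι-+ j (i ℕ.* j)) (cong (_+_ (ι j)) (ι-* i j)) ⟩
    ι j + ι i * ι j    ≡⟨ solve 2 (λ x y → y :+ x :* y := (x :+ con 1ℚ) :* y) refl (ι i) (ι j) ⟩
    (ι i + 1ℚ) * ι j   ≡⟨ cong (_* ι j) (ι-suc i) ⟨
    ι (suc i) * ι j    ∎
    where open ≡-Reasoning

  ι-^ : ∀ i k → ι (i ℕ.^ k) ≡ ι i ^ k
  ι-^ i zero    = refl
  ι-^ i (suc k) = trans (ι-* i (i ℕ.^ k)) (cong (_*_ (ι i)) (ι-^ i k))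

  ι-nonNeg : ∀ k → 0ℚ ≤ ι k
  ι-nonNeg k = ℚ.nonNegative⁻¹ (ι k) {{ℚ.normalize-nonNeg k 1}}

  ι-mono : ∀ {m n} → m ℕ.≤ n → ι m ≤ ι n
  ι-mono {n = n} z≤n = ι-nonNeg n
  ι-mono {suc m} {suc n} (s≤s m≤n) rewrite ι-suc m | ι-suc n = ℚ.+-monoˡ-≤ 1ℚ (ι-mono m≤n)

  ι-pos : ∀ n → 0ℚ < ι (suc n)
  ι-pos n = ℚ.<-≤-trans (ℚ.positive⁻¹ 1ℚ) (ι-mono {1} {suc n} (s≤s z≤n))

  *-cancelˡ-≤ : ∀ {r p q} → 0ℚ < r → r * p ≤ r * q → p ≤ q
  *-cancelˡ-≤ {r} 0<r = ℚ.*-cancelˡ-≤-pos r {{positive 0<r}}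

  *-cancelˡ-≡ : ∀ {r p q} → 0ℚ < r → r * p ≡ r * q → p ≡ q
  *-cancelˡ-≡ 0<r eq = ℚ.≤-antisym (*-cancelˡ-≤ 0<r (ℚ.≤-reflexive eq)) (*-cancelˡ-≤ 0<r (ℚ.≤-reflexive (sym eq)))

  *-monoˡ : ∀ {r p q} → 0ℚ ≤ r → p ≤ q → r * p ≤ r * q
  *-monoˡ {r} 0≤r = ℚ.*-monoˡ-≤-nonNeg r {{nonNegative 0≤r}}

  *-monoʳ : ∀ {r p q} → 0ℚ ≤ r → p ≤ q → p * r ≤ q * r
  *-monoʳ {r} 0≤r = ℚ.*-monoʳ-≤-nonNeg r {{nonNegative 0≤r}}

  ∣+∣-≤ : ∀ {p q r s} → ∣ p ∣ ≤ r → ∣ q ∣ ≤ s → ∣ p + q ∣ ≤ r + s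
  ∣+∣-≤ {p} {q} p≤r q≤s = ℚ.≤-trans (ℚ.∣p+q∣≤∣p∣+∣q∣ p q) (ℚ.+-mono-≤ p≤r q≤s)

  ∣-∣-≤ : ∀ {p q r s} → ∣ p ∣ ≤ r → ∣ q ∣ ≤ s → ∣ p - q ∣ ≤ r + s
  ∣-∣-≤ {p} {q} p≤r q≤s = ∣+∣-≤ {p} {(- q)} p≤r (ℚ.≤-trans (ℚ.≤-reflexive (ℚ.∣-p∣≡∣p∣ q)) q≤s)

  ι-*≤⇒≤recip : ∀ n {p q} → ι (suc n) * p ≤ q → p ≤ q * recip (suc n)
  ι-*≤⇒≤recip n {p} {q} h = *-cancelˡ-≤ (ι-pos n) (ℚ.≤-trans h (ℚ.≤-reflexive (begin
    q                          ≡⟨ ℚ.*-identityʳ q ⟨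
    q * 1ℚ                     ≡⟨ cong (q *_) (recip-ι n) ⟨
    q * (recip (suc n) * ι (suc n))  ≡⟨ solve 3 (λ q r i → q :* (r :* i) := i :* (q :* r)) refl q (recip (suc n)) (ι (suc n)) ⟩
    ι (suc n) * (q * recip (suc n)) ∎)))
    where open ≡-Reasoning

  ^-* : ∀ x y a → (x * y) ^ a ≡ x ^ a * y ^ a
  ^-* x y zero    = refl
  ^-* x y (suc a) = trans (cong ((x * y) *_) (^-* x y a))
    (solve 4 (λ x y p q → (x :* y) :* (p :* q) := (x :* p) :* (y :* q)) refl x y (x ^ a) (y ^ a))

  ^-+ : ∀ x a b → x ^ (a ℕ.+ b) ≡ x ^ a * x ^ b
  ^-+ x zero    b = sym (ℚ.*-identityˡ (x ^ b))
  ^-+ x (suc a) b = trans (cong (x *_) (^-+ x a b)) (sym (ℚ.*-assoc x (x ^ a) (x ^ b)))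

  ^-nonNeg : ∀ {x} → 0ℚ ≤ x → ∀ a → 0ℚ ≤ x ^ a
  ^-nonNeg 0≤x zero    = 0≤1
  ^-nonNeg 0≤x (suc a) = 0≤* 0≤x (^-nonNeg 0≤x a)

  ^-pos : ∀ {x} → 0ℚ < x → ∀ a → 0ℚ < x ^ a
  ^-pos 0<x zero    = ℚ.positive⁻¹ 1ℚ
  ^-pos 0<x (suc a) = 0<* 0<x (^-pos 0<x a)

  Seq : Set
  Seq = ℕ → ℚ

  -- The weights (2n choose n) / 4ⁿ and the error terms

  absorption : ∀ n k → suc k ℕ.* (suc n C suc k) ≡ suc n ℕ.* (n C k)
  absorption zero    zero    = refl
  absorption zero    (suc k) = ℕ.*-zeroʳ k
  absorption (suc n) zero    = trans (ℕ.*-identityˡ _) (trans (nC1≡n (2 ℕ.+ n)) (sym (ℕ.*-identityʳ (2 ℕ.+ n))))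
  absorption (suc n) (suc k) = begin
    (2 ℕ.+ k) ℕ.* (suc (suc n) C suc (suc k))
      ≡⟨ cong ((2 ℕ.+ k) ℕ.*_) (nCk+nC[k+1]≡[n+1]C[k+1] (suc n) (suc k)) ⟨
    (2 ℕ.+ k) ℕ.* (a ℕ.+ b)
      ≡⟨ ℕ-Solver.solve 3 (λ k a b → (conℕ 2 :+ℕ k) :*ℕ (a :+ℕ b)
           :=ℕ (conℕ 1 :+ℕ k) :*ℕ a :+ℕ a :+ℕ (conℕ 2 :+ℕ k) :*ℕ b) refl k a b ⟩
    suc k ℕ.* a ℕ.+ a ℕ.+ (2 ℕ.+ k) ℕ.* b
      ≡⟨ cong₂ (λ s t → s ℕ.+ a ℕ.+ t) (absorption n k) (absorption n (suc k)) ⟩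
    suc n ℕ.* (n C k) ℕ.+ a ℕ.+ suc n ℕ.* (n C suc k)
      ≡⟨ ℕ-Solver.solve 4 (λ n p q a → (conℕ 1 :+ℕ n) :*ℕ p :+ℕ a :+ℕ (conℕ 1 :+ℕ n) :*ℕ q
           :=ℕ (conℕ 1 :+ℕ n) :*ℕ (p :+ℕ q) :+ℕ a) refl n (n C k) (n C suc k) a ⟩
    suc n ℕ.* (n C k ℕ.+ n C suc k) ℕ.+ a
      ≡⟨ cong (λ s → suc n ℕ.* s ℕ.+ a) (nCk+nC[k+1]≡[n+1]C[k+1] n k) ⟩
    suc n ℕ.* a ℕ.+ a
      ≡⟨ ℕ.+-comm (suc n ℕ.* a) a ⟩
    (2 ℕ.+ n) ℕ.* a ∎
    where
    open ≡-Reasoning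
    open ℕ-Solver using () renaming (con to conℕ; _:+_ to _:+ℕ_; _:*_ to _:*ℕ_; _:=_ to _:=ℕ_)
    a = suc n C suc k ; b = suc n C suc (suc k)

  central-rec : ∀ n → suc n ℕ.* ((2 ℕ.* suc n) C suc n) ≡ 2 ℕ.* (suc (2 ℕ.* n) ℕ.* ((2 ℕ.* n) C n))
  central-rec n = begin
    suc n ℕ.* ((2 ℕ.* suc n) C suc n)
      ≡⟨ cong (λ k → suc n ℕ.* (k C suc n)) (ℕ.*-suc 2 n) ⟩
    suc n ℕ.* (suc (suc (2 ℕ.* n)) C suc n)
      ≡⟨ cong (suc n ℕ.*_) (nCk+nC[k+1]≡[n+1]C[k+1] (suc (2 ℕ.* n)) n) ⟨
    suc n ℕ.* (suc (2 ℕ.* n) C n ℕ.+ a)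
      -- The two middle binomial coefficients of row 2n + 1 agree by symmetry.
      ≡⟨ cong (λ s → suc n ℕ.* (s ℕ.+ a)) (trans (nCk≡nC[n∸k] (ℕ.m≤n⇒m≤1+n (ℕ.m≤m+n n (n ℕ.+ 0))))
           (cong (suc (2 ℕ.* n) C_) (trans (cong (ℕ._∸ n) (trans (cong (λ k → suc (n ℕ.+ k)) (ℕ.+-identityʳ n)) (sym (ℕ.+-suc n n))))
             (ℕ.m+n∸m≡n n (suc n))))) ⟩
    suc n ℕ.* (a ℕ.+ a)
      ≡⟨ ℕ-Solver.solve 2 (λ n a → n :*ℕ (a :+ℕ a) :=ℕ conℕ 2 :*ℕ (n :*ℕ a)) refl (suc n) a ⟩
    2 ℕ.* (suc n ℕ.* a)
      ≡⟨ cong (2 ℕ.*_) (absorption (2 ℕ.* n) n) ⟩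
    2 ℕ.* (suc (2 ℕ.* n) ℕ.* ((2 ℕ.* n) C n)) ∎
    where
    open ≡-Reasoning
    open ℕ-Solver using () renaming (con to conℕ; _:+_ to _:+ℕ_; _:*_ to _:*ℕ_; _:=_ to _:=ℕ_)
    a = suc (2 ℕ.* n) C suc n

  c : Seq
  c = centralBinomial/4^

  /-ι : ∀ a d .{{_ : ℕ.NonZero d}} → (+ a / d) * ι d ≡ ι a
  /-ι a (suc d) = ℚ.toℚᵘ-injective (begin
    toℚᵘ ((+ a / suc d) * ι (suc d))
      ≈⟨ ℚ.toℚᵘ-homo-* (+ a / suc d) (ι (suc d)) ⟩
    toℚᵘ (+ a / suc d) ℚᵘ.* toℚᵘ (ι (suc d))
      ≈⟨ ℚᵘ.*-cong (ℚ.toℚᵘ-fromℚᵘ (ℚᵘ.mkℚᵘ (+ a) d)) (ℚ.toℚᵘ-fromℚᵘ (ℚᵘ.mkℚᵘ (+ suc d) 0)) ⟩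
    ℚᵘ.mkℚᵘ (+ a) d ℚᵘ.* ℚᵘ.mkℚᵘ (+ suc d) 0
      ≈⟨ ℚᵘ.*≡* (trans (ℤ.*-identityʳ (+ a ℤ.* + suc d)) (cong (λ k → + a ℤ.* + k) (sym (ℕ.*-identityʳ (suc d))))) ⟩
    ℚᵘ.mkℚᵘ (+ a) 0
      ≈⟨ ℚ.toℚᵘ-fromℚᵘ (ℚᵘ.mkℚᵘ (+ a) 0) ⟨
    toℚᵘ (ι a) ∎)
    where open ℚᵘ.≃-Reasoning

  c-ι : ∀ n → c n * ι (4 ℕ.^ n) ≡ ι ((2 ℕ.* n) C n)
  c-ι n = /-ι ((2 ℕ.* n) C n) (4 ℕ.^ n) {{ℕ.m^n≢0 4 n}}

  ι-^4-pos : ∀ n → 0ℚ < ι (4 ℕ.^ n)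
  ι-^4-pos n = subst (0ℚ <_) (sym (ι-^ 4 n)) (^-pos (ι-pos 3) n)

  -- The recursion of (-1)ⁿ (-1/2 choose n). With c 0 = 1 it is all that the Newton series needs to
  -- know about the weights.
  c-suc : ∀ n → ι (suc n) * c (suc n) ≡ (ι n + ½) * c n
  c-suc n = *-cancelˡ-≡ (ι-^4-pos (suc n)) (begin
    ι (4 ℕ.^ suc n) * (ι (suc n) * c (suc n))
      ≡⟨ solve 3 (λ f i c → f :* (i :* c) := i :* (c :* f)) refl (ι (4 ℕ.^ suc n)) (ι (suc n)) (c (suc n)) ⟩
    ι (suc n) * (c (suc n) * ι (4 ℕ.^ suc n))
      ≡⟨ cong (ι (suc n) *_) (c-ι (suc n)) ⟩
    ι (suc n) * ι ((2 ℕ.* suc n) C suc n)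
      ≡⟨ trans (sym (ι-* (suc n) ((2 ℕ.* suc n) C suc n))) (cong ι (central-rec n)) ⟩
    ι (2 ℕ.* (suc (2 ℕ.* n) ℕ.* b))
      ≡⟨ trans (ι-* 2 (suc (2 ℕ.* n) ℕ.* b)) (cong (ι 2 *_) (ι-* (suc (2 ℕ.* n)) b)) ⟩
    ι 2 * (ι (suc (2 ℕ.* n)) * ι b)
      ≡⟨ cong₂ (λ s t → ι 2 * (s * t)) (trans (ι-suc (2 ℕ.* n)) (cong (_+ 1ℚ) (ι-* 2 n))) (sym (c-ι n)) ⟩
    ι 2 * ((ι 2 * ι n + 1ℚ) * (c n * ι (4 ℕ.^ n)))
      ≡⟨ solve 3 (λ i c f → con (ι 2) :* ((con (ι 2) :* i :+ con 1ℚ) :* (c :* f)) := con (ι 4) :* f :* ((i :+ con ½) :* c)) refl (ι n) (c n) (ι (4 ℕ.^ n)) ⟩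
    ι 4 * ι (4 ℕ.^ n) * ((ι n + ½) * c n)
      ≡⟨ cong (_* ((ι n + ½) * c n)) (ι-* 4 (4 ℕ.^ n)) ⟨
    ι (4 ℕ.^ suc n) * ((ι n + ½) * c n) ∎)
    where open ≡-Reasoning
          b = (2 ℕ.* n) C n

  c-nonNeg : ∀ n → 0ℚ ≤ c n
  c-nonNeg n = *-cancelˡ-≤ (ι-^4-pos n) (begin
    ι (4 ℕ.^ n) * 0ℚ   ≡⟨ ℚ.*-zeroʳ (ι (4 ℕ.^ n)) ⟩
    0ℚ                 ≤⟨ ι-nonNeg ((2 ℕ.* n) C n) ⟩
    ι ((2 ℕ.* n) C n)  ≡⟨ c-ι n ⟨
    c n * ι (4 ℕ.^ n)  ≡⟨ ℚ.*-comm (c n) (ι (4 ℕ.^ n)) ⟩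
    ι (4 ℕ.^ n) * c n  ∎)
    where open ℚ.≤-Reasoning

  -- A form of c n ≤ (n + 1) ^ -1/2 without square roots. The induction rests on (n + 1)³ - (n +
  -- 2)(n + 1/2)² = 3n/4 + 1/2.
  c²-≤ : ∀ n → ι (suc n) * (c n * c n) ≤ 1ℚ
  c²-≤ zero    = ℚ.≤-refl
  c²-≤ (suc n) = *-cancelˡ-≤ (0<* (ι-pos n) (ι-pos n)) (begin
    ι (suc n) * ι (suc n) * (ι (2 ℕ.+ n) * (c (suc n) * c (suc n)))
      ≡⟨ solve 3 (λ i j c → i :* i :* (j :* (c :* c)) := j :* ((i :* c) :* (i :* c))) refl (ι (suc n)) (ι (2 ℕ.+ n)) (c (suc n)) ⟩
    ι (2 ℕ.+ n) * ((ι (suc n) * c (suc n)) * (ι (suc n) * c (suc n)))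
      ≡⟨ cong₂ (λ j s → j * (s * s)) (trans (ι-suc (suc n)) (cong (_+ 1ℚ) (ι-suc n))) (c-suc n) ⟩
    ((i + 1ℚ) + 1ℚ) * (((i + ½) * c n) * ((i + ½) * c n))
      ≤⟨ ≤-by (solve 2 (λ i c → (i :+ con 1ℚ) :* (i :+ con 1ℚ) :* ((i :+ con 1ℚ) :* (c :* c))
                   :- ((i :+ con 1ℚ) :+ con 1ℚ) :* (((i :+ con ½) :* c) :* ((i :+ con ½) :* c))
                   := (con (½ + ½ * ½) :* i :+ con ½) :* (c :* c)) refl i (c n))
           (0≤* (0≤+ (0≤* (ℚ.nonNegative⁻¹ (½ + ½ * ½)) (ι-nonNeg n)) (ℚ.<⇒≤ 0<½)) (0≤* (c-nonNeg n) (c-nonNeg n))) ⟩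
    (i + 1ℚ) * (i + 1ℚ) * ((i + 1ℚ) * (c n * c n))
      ≡⟨ cong (λ j → j * j * (j * (c n * c n))) (ι-suc n) ⟨
    ι (suc n) * ι (suc n) * (ι (suc n) * (c n * c n))
      ≤⟨ *-monoˡ (0≤* (ι-nonNeg (suc n)) (ι-nonNeg (suc n))) (c²-≤ n) ⟩
    ι (suc n) * ι (suc n) * 1ℚ ∎)
    where open ℚ.≤-Reasoning
          i = ι n

  Null-≤ : ∀ {A B} → (∀ n → A (suc n) ≤ B (suc n)) → Null B → Null A
  Null-≤ le null ε 0<ε = let K , h = null ε 0<ε in suc K , λ where
    (suc n) (s≤s K≤n) → ℚ.≤-trans (le n) (h (suc n) (ℕ.m≤n⇒m≤1+n K≤n))

  -- Allows the error terms to be estimated through their squares, where `c²-≤` applies and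
  -- everything stays rational.
  Null-√ : ∀ {A} → Null (λ n → A n * A n) → Null A
  Null-√ {A} null ε 0<ε = let K , h = null (ε * ε) (0<* 0<ε 0<ε) in K , λ n K≤n → go n (h n K≤n)
    where
    go : ∀ n → A n * A n ≤ ε * ε → A n ≤ ε
    go n A²≤ε² with ℚ.≤-total (A n) ε
    ... | inj₁ A≤ε = A≤ε
    ... | inj₂ ε≤A = *-cancelˡ-≤ (ℚ.<-≤-trans 0<ε ε≤A) (ℚ.≤-trans A²≤ε² (*-monoʳ (ℚ.<⇒≤ 0<ε) ε≤A))

  -- The mean value estimate for t ^ (e + 1) on the interval from a to a + r, with the derivative
  -- taken at the right end.
  ^-suc-≤ : ∀ {a r} → 0ℚ ≤ a → 0ℚ ≤ r → ∀ e → (a + r) ^ suc e ≤ a ^ suc e + ι (suc e) * (r * (a + r) ^ e)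
  ^-suc-≤ {a} {r} 0≤a 0≤r zero = ℚ.≤-reflexive
    (solve 2 (λ a r → (a :+ r) :* con 1ℚ := a :* con 1ℚ :+ con 1ℚ :* (r :* con 1ℚ)) refl a r)
  ^-suc-≤ {a} {r} 0≤a 0≤r (suc e) = begin
    (a + r) * p
      ≡⟨ ℚ.*-distribʳ-+ p a r ⟩
    a * p + r * p
      ≤⟨ ℚ.+-monoˡ-≤ (r * p) (*-monoˡ 0≤a (^-suc-≤ 0≤a 0≤r e)) ⟩
    a * (a ^ suc e + k * (r * q)) + r * p
      ≤⟨ ≤-by (solve 5 (λ a r k q s → (a :* s :+ (k :+ con 1ℚ) :* (r :* ((a :+ r) :* q)))
                    :- (a :* (s :+ k :* (r :* q)) :+ r :* ((a :+ r) :* q)) := k :* (r :* (r :* q))) refl a r k q (a ^ suc e))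
           (0≤* (ι-nonNeg (suc e)) (0≤* 0≤r (0≤* 0≤r (^-nonNeg (0≤+ 0≤a 0≤r) e)))) ⟩
    a ^ (2 ℕ.+ e) + (k + 1ℚ) * (r * p)
      ≡⟨ cong (λ s → a ^ (2 ℕ.+ e) + s * (r * p)) (ι-suc (suc e)) ⟨
    a ^ (2 ℕ.+ e) + ι (2 ℕ.+ e) * (r * p) ∎
    where
    open ℚ.≤-Reasoning
    p = (a + r) ^ suc e ; q = (a + r) ^ e ; k = ι (suc e)

  fact : ℕ → ℚ
  fact zero    = 1ℚ
  fact (suc e) = ι (suc e) * fact e

  fact-nonNeg : ∀ e → 0ℚ ≤ fact e
  fact-nonNeg zero    = 0≤1
  fact-nonNeg (suc e) = 0≤* (ι-nonNeg (suc e)) (fact-nonNeg e)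

  -- `M e n` sums 1 / (k₁ ⋯ k_e) over n ≥ k₁ ≥ ⋯ ≥ k_e, and a product in the expanded power has at
  -- most e! orderings. This reduces powers of logarithms to the sequences known to be null by
  -- `M/n-null`.
  harmonic^-≤ : ∀ e n → ∑ n recip ^ e ≤ fact e * M e n
  harmonic^-≤ zero    n       = ℚ.≤-refl
  harmonic^-≤ (suc e) zero    = ℚ.≤-reflexive (trans (ℚ.*-zeroˡ (0ℚ ^ e)) (sym (ℚ.*-zeroʳ (fact (suc e)))))
  harmonic^-≤ (suc e) (suc n) = begin
    (∑ n recip + r) ^ suc e
      ≤⟨ ^-suc-≤ (∑-nonNeg n recip-nonNeg) (recip-nonNeg (suc n)) e ⟩
    ∑ n recip ^ suc e + ι (suc e) * (r * ∑ (suc n) recip ^ e)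
      ≤⟨ ℚ.+-mono-≤ (harmonic^-≤ (suc e) n)
           (*-monoˡ (ι-nonNeg (suc e)) (*-monoˡ (recip-nonNeg (suc n)) (harmonic^-≤ e (suc n)))) ⟩
    fact (suc e) * M (suc e) n + ι (suc e) * (r * (fact e * M e (suc n)))
      ≡⟨ solve 5 (λ i f m r m′ → i :* f :* m :+ i :* (r :* (f :* m′)) := i :* f :* (m :+ m′ :* r)) refl
           (ι (suc e)) (fact e) (M (suc e) n) r (M e (suc n)) ⟩
    fact (suc e) * M (suc e) (suc n) ∎
    where open ℚ.≤-Reasoning
          r = recip (suc n)

  -- At n = N this is `κ ^ d * β` of the module `Approximation`, where the constants 4 and 3
  -- originate.
  error-term : ℕ → Seq
  error-term d n = (ι 4 * ∑ n recip) ^ d * (ι 3 * c (pred n))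

  error-term-nonNeg : ∀ d n → 0ℚ ≤ error-term d n
  error-term-nonNeg d n = 0≤* (^-nonNeg (0≤* (ι-nonNeg 4) (∑-nonNeg n recip-nonNeg)) d) (0≤* (ι-nonNeg 3) (c-nonNeg (pred n)))

  -- The square is at most a constant times M (2d) n / n.
  error-null : ∀ d → Null (error-term d)
  error-null d = Null-√ (Null-≤ le (Null-scale C′ (0≤* (ι-nonNeg 9) (0≤* (^-nonNeg (ι-nonNeg 4) e) (fact-nonNeg e)))
      (λ n → 0≤* (M-nonNeg e n) (recip-nonNeg n)) (M/n-null e)))
    where
    open ℚ.≤-Reasoning
    e = d ℕ.+ d
    C′ = ι 9 * (ι 4 ^ e * fact e)
    le : ∀ n → (ι 4 * ∑ (suc n) recip) ^ d * (ι 3 * c n) * ((ι 4 * ∑ (suc n) recip) ^ d * (ι 3 * c n))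
             ≤ C′ * (M e (suc n) * recip (suc n))
    le n = begin
      X * (ι 3 * c n) * (X * (ι 3 * c n))
        ≡⟨ solve 2 (λ x c → x :* (con (ι 3) :* c) :* (x :* (con (ι 3) :* c)) := con (ι 9) :* (x :* x) :* (c :* c)) refl X (c n) ⟩
      ι 9 * (X * X) * (c n * c n)
        ≡⟨ cong (λ s → ι 9 * s * (c n * c n)) (trans (sym (^-+ (ι 4 * H) d d)) (^-* (ι 4) H e)) ⟩
      ι 9 * (ι 4 ^ e * H ^ e) * (c n * c n)
        ≤⟨ *-mono-≤ (0≤* (ι-nonNeg 9) (0≤* (^-nonNeg (ι-nonNeg 4) e) (0≤* (fact-nonNeg e) (M-nonNeg e (suc n)))))
             (0≤* (c-nonNeg n) (c-nonNeg n))
             (*-monoˡ (ι-nonNeg 9) (*-monoˡ (^-nonNeg (ι-nonNeg 4) e) (harmonic^-≤ e (suc n))))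
             (ι-*≤⇒≤recip n (c²-≤ n)) ⟩
      ι 9 * (ι 4 ^ e * (fact e * M e (suc n))) * (1ℚ * recip (suc n))
        ≡⟨ solve 4 (λ a f m r → con (ι 9) :* (a :* (f :* m)) :* (con 1ℚ :* r) := con (ι 9) :* (a :* f) :* (m :* r)) refl
             (ι 4 ^ e) (fact e) (M e (suc n)) (recip (suc n)) ⟩
      C′ * (M e (suc n) * recip (suc n)) ∎
      where H = ∑ (suc n) recip
            X = (ι 4 * H) ^ d

  ι+½≤ι-suc : ∀ n → ι n + ½ ≤ ι (suc n)
  ι+½≤ι-suc n = ≤-by {ι n + ½} {ι (suc n)} (trans (cong (_- (ι n + ½)) (ι-suc n))
    (solve 1 (λ k → (k :+ con 1ℚ) :- (k :+ con ½) := con ½) refl (ι n))) (ℚ.<⇒≤ 0<½)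

  -- By `c-suc`, c k = 2(k + 1) c (k + 1) - 2k c k, which telescopes. The reversed index is the one
  -- in which local errors occur in `loc`.
  ∑c : ∀ n → ∑ n (λ k → c (n ℕ.∸ k)) ≡ ι 2 * (ι n * c n)
  ∑c zero    = sym (trans (cong (ι 2 *_) (ℚ.*-zeroˡ (c 0))) (ℚ.*-zeroʳ (ι 2)))
  ∑c (suc n) = begin
    ∑ (suc n) (λ k → c (suc n ℕ.∸ k))   ≡⟨ ∑-head (λ k → c (suc n ℕ.∸ k)) n ⟩
    c n + ∑ n (λ k → c (n ℕ.∸ k))       ≡⟨ cong (_+_ (c n)) (∑c n) ⟩
    c n + ι 2 * (ι n * c n)             ≡⟨ solve 2 (λ c i → c :+ con (ι 2) :* (i :* c) := con (ι 2) :* ((i :+ con ½) :* c)) refl (c n) (ι n) ⟩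
    ι 2 * ((ι n + ½) * c n)             ≡⟨ cong (ι 2 *_) (c-suc n) ⟨
    ι 2 * (ι (suc n) * c (suc n))       ∎
    where open ≡-Reasoning

  -- Newton series

  -- Δ x M n = ∑_{j ≤ n} (-1)ʲ (n choose j) x (M + j)
  Δ : Seq → ℕ → ℕ → ℚ
  Δ x M zero    = x M
  Δ x M (suc n) = Δ x M n - Δ x (suc M) n

  div : Seq → Seq → Seq
  div ρ x M = ρ M * x M

  -- ∑_{M < k ≤ N} x k, for M ≤ N
  tail : ℕ → Seq → Seq
  tail N x M = ∑ N x - ∑ M x

  module _ (N : ℕ) (y : Seq) where

    tail-step : ∀ M → tail N y M ≡ tail N y (suc M) + y (suc M)
    tail-step M = solve 3 (λ s t u → s :- t := (s :- (t :+ u)) :+ u) refl (∑ N y) (∑ M y) (y (suc M))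

    tail-end : tail N y N ≡ 0ℚ
    tail-end = ℚ.+-inverseʳ (∑ N y)

    Δ-tail : ∀ M n → Δ (tail N y) M (suc n) ≡ Δ y (suc M) n
    Δ-tail M zero    = trans (cong (_- tail N y (suc M)) (tail-step M))
      (solve 2 (λ s u → (s :+ u) :- s := u) refl (tail N y (suc M)) (y (suc M)))
    Δ-tail M (suc n) = cong₂ _-_ (Δ-tail M n) (Δ-tail (suc M) n)

  -- Leibniz rule for y = M · (y / M).
  Δ-div : ∀ y M n → (ι (suc M) + ι (suc n)) * Δ (div recip y) (suc M) (suc n)
                  ≡ Δ y (suc M) (suc n) + ι (suc n) * Δ (div recip y) (suc M) n
  Δ-div y M zero = begin
    (m + 1ℚ) * (a * u - b * v)
      ≡⟨ solve 5 (λ m a u b v → (m :+ con 1ℚ) :* (a :* u :- b :* v)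
                   := ((a :* m) :* u :- (b :* (m :+ con 1ℚ)) :* v) :+ con 1ℚ :* (a :* u)) refl m a u b v ⟩
    ((a * m) * u - (b * (m + 1ℚ)) * v) + 1ℚ * (a * u)
      ≡⟨ cong₂ (λ s t → (s * u - (b * t) * v) + 1ℚ * (a * u)) (recip-ι M) (sym (ι-suc (suc M))) ⟩
    (1ℚ * u - (b * ι (suc (suc M))) * v) + 1ℚ * (a * u)
      ≡⟨ cong₂ (λ s t → (s - t * v) + 1ℚ * (a * u)) (ℚ.*-identityˡ u) (recip-ι (suc M)) ⟩
    (u - 1ℚ * v) + 1ℚ * (a * u)
      ≡⟨ cong (λ t → (u - t) + 1ℚ * (a * u)) (ℚ.*-identityˡ v) ⟩
    (u - v) + 1ℚ * (a * u) ∎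
    where
    open ≡-Reasoning
    m = ι (suc M) ; a = recip (suc M) ; b = recip (suc (suc M)) ; u = y (suc M) ; v = y (suc (suc M))
  Δ-div y M (suc n) = begin
    (m + ι (2 ℕ.+ n)) * (p - q)
      ≡⟨ cong (λ k → (m + k) * (p - q)) (ι-suc (suc n)) ⟩
    (m + (k + 1ℚ)) * (p - q)
      ≡⟨ solve 4 (λ m k p q → (m :+ (k :+ con 1ℚ)) :* (p :- q)
                   := ((m :+ k) :* p :- ((m :+ con 1ℚ) :+ k) :* q) :+ p) refl m k p q ⟩
    ((m + k) * p - ((m + 1ℚ) + k) * q) + p
      ≡⟨ cong₂ (λ s t → (s - t) + p) (Δ-div y M n)
           (trans (cong (λ m → (m + k) * q) (sym (ι-suc (suc M)))) (Δ-div y (suc M) n)) ⟩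
    ((s + k * p′) - (t + k * q′)) + ((p′ - q′))
      ≡⟨ solve 5 (λ s t k p q → ((s :+ k :* p) :- (t :+ k :* q)) :+ (p :- q)
                    := (s :- t) :+ (k :+ con 1ℚ) :* (p :- q)) refl s t k p′ q′ ⟩
    (s - t) + (k + 1ℚ) * (p′ - q′)
      ≡⟨ cong (λ k → (s - t) + k * (p′ - q′)) (ι-suc (suc n)) ⟨
    (s - t) + ι (2 ℕ.+ n) * (p′ - q′) ∎
    where
    open ≡-Reasoning
    m = ι (suc M) ; k = ι (suc n)
    p = Δ (div recip y) (suc M) (suc n) ; q = Δ (div recip y) (suc (suc M)) (suc n)
    p′ = Δ (div recip y) (suc M) n ; q′ = Δ (div recip y) (suc (suc M)) n
    s = Δ y (suc M) (suc n) ; t = Δ y (suc (suc M)) (suc n)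

  Δ-1 : ∀ M n → Δ (λ _ → 1ℚ) M (suc n) ≡ 0ℚ
  Δ-1 M zero    = refl
  Δ-1 M (suc n) = trans (cong₂ _-_ (Δ-1 M n) (Δ-1 (suc M) n)) refl

  -- Telescoping: an entry at M + 1 is the difference of two consecutive entries at M.
  ∑Δ-row : ∀ x M n → ∑ (suc n) (λ j → Δ x (suc M) (pred j)) ≡ x M - Δ x M (suc n)
  ∑Δ-row x M zero    = solve 2 (λ a b → con 0ℚ :+ b := a :- (a :- b)) refl (x M) (x (suc M))
  ∑Δ-row x M (suc n) = trans (cong (_+ Δ x (suc M) (suc n)) (∑Δ-row x M n))
    (solve 3 (λ a b c → (a :- b) :+ c := a :- (b :- c)) refl (x M) (Δ x M (suc n)) (Δ x (suc M) (suc n)))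

  -- Summation by parts of the same telescoping.
  ∑Δ-row₂ : ∀ x M n → ∑ (suc n) (λ j → ι j * Δ x (suc M) (pred j))
                    ≡ ∑ (suc n) (λ j → Δ x M (pred j)) - ι (suc n) * Δ x M (suc n)
  ∑Δ-row₂ x M zero    = solve 2 (λ a b → con 0ℚ :+ con 1ℚ :* b := (con 0ℚ :+ a) :- con 1ℚ :* (a :- b)) refl (x M) (x (suc M))
  ∑Δ-row₂ x M (suc n) = begin
    ∑ (suc n) (λ j → ι j * Δ x (suc M) (pred j)) + ι (2 ℕ.+ n) * d
      ≡⟨ cong₂ (λ s t → s + t * d) (∑Δ-row₂ x M n) (ι-suc (suc n)) ⟩
    (S - k * b) + (k + 1ℚ) * d
      ≡⟨ solve 4 (λ s k b c → (s :- k :* b) :+ (k :+ con 1ℚ) :* c := (s :+ b) :- (k :+ con 1ℚ) :* (b :- c)) refl S k b d ⟩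
    (S + b) - (k + 1ℚ) * (b - d)
      ≡⟨ cong (λ t → (S + b) - t * (b - d)) (ι-suc (suc n)) ⟨
    (S + b) - ι (2 ℕ.+ n) * (b - d) ∎
    where
    open ≡-Reasoning
    S = ∑ (suc n) (λ j → Δ x M (pred j))
    k = ι (suc n) ; b = Δ x M (suc n) ; d = Δ x (suc M) (suc n)

  -- At argument 1 the Leibniz rule says that (n + 1) Δ (y / M) 1 n grows by exactly Δ y 1 (n + 1)
  -- from n to n + 1. This is the source of the averages, hence of the ζ⋆-sums.
  div-col₁ : ∀ y n → ι (suc n) * Δ (div recip y) 1 n ≡ ∑ (suc n) (λ j → Δ y 1 (pred j))
  div-col₁ y zero    = solve 1 (λ y → con 1ℚ :* (con 1ℚ :* y) := con 0ℚ :+ y) refl (y 1)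
  div-col₁ y (suc n) = begin
    ι (2 ℕ.+ n) * Δ x 1 (suc n)                  ≡⟨ cong (_* Δ x 1 (suc n)) (ι-+ 1 (suc n)) ⟩
    (ι 1 + ι (suc n)) * Δ x 1 (suc n)            ≡⟨ Δ-div y 0 n ⟩
    Δ y 1 (suc n) + ι (suc n) * Δ x 1 n          ≡⟨ ℚ.+-comm (Δ y 1 (suc n)) _ ⟩
    ι (suc n) * Δ x 1 n + Δ y 1 (suc n)          ≡⟨ cong (_+ Δ y 1 (suc n)) (div-col₁ y n) ⟩
    ∑ (2 ℕ.+ n) (λ j → Δ y 1 (pred j))           ∎
    where open ≡-Reasoning
          x = div recip y

  -- Since c n = (-1)ⁿ (-1/2 choose n), this is the truncated Newton series of x at M - 1/2.
  Φ : Seq → ℕ → ℕ → ℚ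
  Φ x M zero    = c 0 * x M
  Φ x M (suc K) = Φ x M K + c (suc K) * Δ x M (suc K)

  -- The finite form of: dividing by the argument and then moving to M + 1/2 is moving there and
  -- then dividing by M + 1/2. Weighted by c, the Leibniz rule telescopes because of `c-suc` and
  -- leaves one boundary term.
  Φ-div : ∀ y M K → (ι (suc M) - ½) * Φ (div recip y) (suc M) K
                  ≡ Φ y (suc M) K - (ι K + ½) * c K * Δ (div recip y) (suc M) K
  Φ-div y M zero = begin
    (m - ½) * (1ℚ * (a * u))
      ≡⟨ solve 3 (λ m a u → (m :- con ½) :* (con 1ℚ :* (a :* u))
                   := (a :* m) :* u :- (con 0ℚ :+ con ½) :* con 1ℚ :* (a :* u)) refl m a u ⟩
    (a * m) * u - (0ℚ + ½) * 1ℚ * (a * u)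
      ≡⟨ cong (λ t → t * u - (0ℚ + ½) * 1ℚ * (a * u)) (recip-ι M) ⟩
    1ℚ * u - (0ℚ + ½) * 1ℚ * (a * u) ∎
    where
    open ≡-Reasoning
    m = ι (suc M) ; a = recip (suc M) ; u = y (suc M)
  Φ-div y M (suc K) = begin
    (m - ½) * (Φ (div recip y) (suc M) K + c₁ * p)
      ≡⟨ ℚ.*-distribˡ-+ (m - ½) (Φ (div recip y) (suc M) K) (c₁ * p) ⟩
    (m - ½) * Φ (div recip y) (suc M) K + (m - ½) * (c₁ * p)
      ≡⟨ cong₂ _+_ (trans (Φ-div y M K) (cong (λ t → Φ y (suc M) K - t * p′) (sym (c-suc K))))
           (solve 4 (λ m k c p → (m :- con ½) :* (c :* p) := c :* ((m :+ k) :* p) :- (k :+ con ½) :* c :* p) refl m k c₁ p) ⟩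
    (Φ y (suc M) K - k * c₁ * p′) + (c₁ * ((m + k) * p) - (k + ½) * c₁ * p)
      ≡⟨ cong (λ t → (Φ y (suc M) K - k * c₁ * p′) + (c₁ * t - (k + ½) * c₁ * p)) (Δ-div y M K) ⟩
    (Φ y (suc M) K - k * c₁ * p′) + (c₁ * (s + k * p′) - (k + ½) * c₁ * p)
      ≡⟨ solve 6 (λ f k c q s p → (f :- k :* c :* q) :+ (c :* (s :+ k :* q) :- (k :+ con ½) :* c :* p)
                     := (f :+ c :* s) :- (k :+ con ½) :* c :* p) refl (Φ y (suc M) K) k c₁ p′ s p ⟩
    (Φ y (suc M) K + c₁ * s) - (k + ½) * c₁ * p ∎
    where
    open ≡-Reasoning
    m = ι (suc M) ; k = ι (suc K) ; c₁ = c (suc K)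
    p = Δ (div recip y) (suc M) (suc K) ; p′ = Δ (div recip y) (suc M) K
    s = Δ y (suc M) (suc K)

  -- The finite form of: the tail at M - 1/2 is the tail at M + 1/2 plus the term at M + 1/2. All
  -- lengths are chosen on one antidiagonal, which leaves the last summand as boundary term.
  Φ-tail : ∀ N y M K → Φ (tail N y) M (suc K)
         ≡ (Φ (tail N y) (suc M) K + Φ y (suc M) K) + c (suc K) * Δ y (suc M) K
  Φ-tail N y M zero = begin
    c 0 * x₀ + c 1 * (x₀ - x₁)
      ≡⟨ cong₂ (λ s t → c 0 * s + c 1 * t) (tail-step N y M) (Δ-tail N y M 0) ⟩
    c 0 * (x₁ + u) + c 1 * u
      ≡⟨ cong (_+ c 1 * u) (ℚ.*-distribˡ-+ (c 0) x₁ u) ⟩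
    (c 0 * x₁ + c 0 * u) + c 1 * u ∎
    where
    open ≡-Reasoning
    x₀ = tail N y M ; x₁ = tail N y (suc M) ; u = y (suc M)
  Φ-tail N y M (suc K) = begin
    Φ x M (suc K) + c₂ * (Δ x M (suc K) - Δ x (suc M) (suc K))
      ≡⟨ cong₂ (λ s t → s + c₂ * t) (Φ-tail N y M K) (Δ-tail N y M (suc K)) ⟩
    ((F + F′) + c₁ * Δ y (suc M) K) + c₂ * d′
      ≡⟨ cong (λ t → ((F + F′) + c₁ * t) + c₂ * d′)
           (trans (solve 2 (λ a b → a := b :+ (a :- b)) refl (Δ y (suc M) K) (Δ y (suc (suc M)) K))
             (cong (_+ d′) (sym (Δ-tail N y (suc M) K)))) ⟩
    ((F + F′) + c₁ * (d + d′)) + c₂ * d′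
      ≡⟨ solve 6 (λ f g c d e b → ((f :+ g) :+ c :* (d :+ e)) :+ b :* e
                   := ((f :+ c :* d) :+ (g :+ c :* e)) :+ b :* e) refl F F′ c₁ d d′ c₂ ⟩
    ((F + c₁ * d) + (F′ + c₁ * d′)) + c₂ * d′ ∎
    where
    open ≡-Reasoning
    x = tail N y
    F = Φ x (suc M) K ; F′ = Φ y (suc M) K
    c₁ = c (suc K) ; c₂ = c (suc (suc K))
    d = Δ x (suc M) (suc K) ; d′ = Δ y (suc M) (suc K)

  -- 1 / (k - 1/2)
  shifted : Seq
  shifted k = (1ℚ + 1ℚ) * recip (pred (k ℕ.+ k))

  shifted-inv : ∀ M → shifted (suc M) * (ι (suc M) - ½) ≡ 1ℚ
  shifted-inv M = begin
    (1ℚ + 1ℚ) * recip (M ℕ.+ suc M) * (ι (suc M) - ½)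
      ≡⟨ cong₂ (λ k i → (1ℚ + 1ℚ) * recip k * (i - ½)) (ℕ.+-suc M M) (ι-suc M) ⟩
    (1ℚ + 1ℚ) * r * ((ι M + 1ℚ) - ½)
      ≡⟨ solve 2 (λ r i → (con 1ℚ :+ con 1ℚ) :* r :* ((i :+ con 1ℚ) :- con ½) := r :* ((i :+ i) :+ con 1ℚ)) refl r (ι M) ⟩
    r * ((ι M + ι M) + 1ℚ)
      ≡⟨ cong (r *_) (trans (cong (_+ 1ℚ) (sym (ι-+ M M))) (sym (ι-suc (M ℕ.+ M)))) ⟩
    r * ι (suc (M ℕ.+ M))
      ≡⟨ recip-ι (M ℕ.+ M) ⟩
    1ℚ ∎
    where open ≡-Reasoning
          r = recip (suc (M ℕ.+ M))

  shifted-nonNeg : ∀ M → 0ℚ ≤ shifted M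
  shifted-nonNeg M = 0≤* (0≤+ 0≤1 0≤1) (recip-nonNeg (pred (M ℕ.+ M)))

  shifted-≤ : ∀ M → shifted (suc M) ≤ (1ℚ + 1ℚ) * recip (suc M)
  shifted-≤ M = *-monoˡ (0≤+ 0≤1 0≤1) (subst (λ k → recip k ≤ recip (suc M)) (sym (ℕ.+-suc M M)) (recip-antitone M M))

  -- Decay of differences

  module Bounds (N : ℕ) where

    h : ℚ
    h = ∑ N recip

    -- Complete monotonicity restricted to differences that involve arguments 1, ..., N only.
    NonNeg-Δ : Seq → Set
    NonNeg-Δ y = ∀ M n → suc M ℕ.+ n ℕ.≤ N → 0ℚ ≤ Δ y (suc M) n

    -- Both row sums are at most y 0 if all Δ y M n with M + n ≤ N are non-negative.
    record Tame (Q : ℚ) (y : Seq) : Set where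
      field
        0≤Q  : 0ℚ ≤ Q
        Δ≥0  : NonNeg-Δ y
        row₁ : ∀ n → 1 ℕ.+ n ℕ.≤ N → ∑ (suc n) (λ j → Δ y 1 (pred j)) ≤ Q
        row₂ : ∀ n → 2 ℕ.+ n ℕ.≤ N → ∑ (suc n) (λ j → ι j * Δ y 2 (pred j)) ≤ Q

    -- The bounds hold with Q = 1 for x M = 1 / M, where Δ x M n = n! (M - 1)! / (M + n)!.
    record Decay (Q : ℚ) (x : Seq) : Set where
      field
        0≤Q  : 0ℚ ≤ Q
        Δ≥0  : NonNeg-Δ x
        col₁ : ∀ n → 1 ℕ.+ n ℕ.≤ N → ι (suc n) * Δ x 1 n ≤ Q
        col₂ : ∀ M n → 2 ℕ.+ M ℕ.+ n ℕ.≤ N → ι (suc n) * (ι (2 ℕ.+ M ℕ.+ n) * Δ x (2 ℕ.+ M) n) ≤ Q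

    module _ {y : Seq} (Δ≥0 : NonNeg-Δ y) where

      private x = div recip y

      Δ-antitone : ∀ M n → 2 ℕ.+ M ℕ.+ n ℕ.≤ N → Δ y (2 ℕ.+ M) n ≤ Δ y 2 n
      Δ-antitone zero    n le = ℚ.≤-refl
      Δ-antitone (suc M) n le = ℚ.≤-trans
        (≤-by refl
          (Δ≥0 (suc M) (suc n) (subst (ℕ._≤ N) (sym (ℕ.+-suc (2 ℕ.+ M) n)) le)))
        (Δ-antitone M n (ℕ.≤-trans (ℕ.n≤1+n _) le))

      -- Read as a recurrence in n, the Leibniz rule has only non-negative terms on its right side.
      div-pos : NonNeg-Δ x
      div-pos M zero    le = 0≤* (recip-nonNeg (suc M)) (Δ≥0 M 0 le)
      div-pos M (suc n) le = *-cancelˡ-≤ (ι-pos (M ℕ.+ suc n)) (begin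
        ι (suc M ℕ.+ suc n) * 0ℚ   ≡⟨ ℚ.*-zeroʳ (ι (suc M ℕ.+ suc n)) ⟩
        0ℚ                         ≤⟨ 0≤+ (Δ≥0 M (suc n) le) (0≤* (ι-nonNeg (suc n))
                                        (div-pos M n (ℕ.≤-trans (ℕ.+-monoʳ-≤ (suc M) (ℕ.n≤1+n n)) le))) ⟩
        Δ y (suc M) (suc n) + ι (suc n) * Δ x (suc M) n  ≡⟨ Δ-div y M n ⟨
        (ι (suc M) + ι (suc n)) * Δ x (suc M) (suc n)    ≡⟨ cong (_* Δ x (suc M) (suc n)) (ι-+ (suc M) (suc n)) ⟨
        ι (suc M ℕ.+ suc n) * Δ x (suc M) (suc n) ∎)
        where open ℚ.≤-Reasoning

      -- Induction on n by the Leibniz rule. The factor n + 2 that appears must be at most M + n +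
      -- 2, so that the induction hypothesis absorbs it; at argument 1 the comparison would be with
      -- n + 1 and fail, which is why that column has its own bound.
      div-col₂ : ∀ M n → 2 ℕ.+ M ℕ.+ n ℕ.≤ N →
        ι (suc n) * (ι (2 ℕ.+ M ℕ.+ n) * Δ x (2 ℕ.+ M) n) ≤ ∑ (suc n) (λ j → ι j * Δ y 2 (pred j))
      div-col₂ M zero le = begin
        1ℚ * (ι (2 ℕ.+ M ℕ.+ 0) * (r * y (2 ℕ.+ M)))  ≡⟨ cong (λ k → 1ℚ * (ι k * (r * y (2 ℕ.+ M)))) (ℕ.+-identityʳ (2 ℕ.+ M)) ⟩
        1ℚ * (ι (2 ℕ.+ M) * (r * y (2 ℕ.+ M)))        ≡⟨ solve 3 (λ i r y → con 1ℚ :* (i :* (r :* y)) := (r :* i) :* y) refl (ι (2 ℕ.+ M)) r (y (2 ℕ.+ M)) ⟩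
        (r * ι (2 ℕ.+ M)) * y (2 ℕ.+ M)               ≡⟨ cong (_* y (2 ℕ.+ M)) (recip-ι (suc M)) ⟩
        1ℚ * y (2 ℕ.+ M)                              ≤⟨ *-monoˡ 0≤1 (Δ-antitone M 0 le) ⟩
        1ℚ * y 2                                      ≡⟨ ℚ.+-identityˡ _ ⟨
        0ℚ + 1ℚ * y 2                                 ∎
        where open ℚ.≤-Reasoning
              r = recip (2 ℕ.+ M)
      div-col₂ M (suc n) le = begin
        ι (2 ℕ.+ n) * (ι (2 ℕ.+ M ℕ.+ suc n) * x′)
          ≡⟨ cong (ι (2 ℕ.+ n) *_) (trans (cong (_* x′) (ι-+ (2 ℕ.+ M) (suc n))) (Δ-div y (suc M) n)) ⟩
        ι (2 ℕ.+ n) * (Δ y (2 ℕ.+ M) (suc n) + ι (suc n) * x₀)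
          ≡⟨ solve 4 (λ i k y x → i :* (y :+ k :* x) := k :* (i :* x) :+ i :* y) refl (ι (2 ℕ.+ n)) (ι (suc n)) (Δ y (2 ℕ.+ M) (suc n)) x₀ ⟩
        ι (suc n) * (ι (2 ℕ.+ n) * x₀) + ι (2 ℕ.+ n) * Δ y (2 ℕ.+ M) (suc n)
          ≤⟨ ℚ.+-mono-≤
               (ℚ.≤-trans (*-monoˡ (ι-nonNeg (suc n)) (*-monoʳ (div-pos (suc M) n le′) (ι-mono (ℕ.+-monoʳ-≤ 2 (ℕ.m≤n+m n M)))))
                 (div-col₂ M n le′))
               (*-monoˡ (ι-nonNeg (2 ℕ.+ n)) (Δ-antitone M (suc n) le)) ⟩
        ∑ (2 ℕ.+ n) (λ j → ι j * Δ y 2 (pred j)) ∎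
        where
        open ℚ.≤-Reasoning
        x′ = Δ x (2 ℕ.+ M) (suc n) ; x₀ = Δ x (2 ℕ.+ M) n
        le′ : 2 ℕ.+ M ℕ.+ n ℕ.≤ N
        le′ = ℕ.≤-trans (ℕ.+-monoʳ-≤ (2 ℕ.+ M) (ℕ.n≤1+n n)) le

    div-decay : ∀ {Q y} → Tame Q y → Decay Q (div recip y)
    div-decay t = record
      { 0≤Q  = 0≤Q
      ; Δ≥0  = div-pos Δ≥0
      ; col₁ = λ n le → ℚ.≤-trans (ℚ.≤-reflexive (div-col₁ _ n)) (row₁ n le)
      ; col₂ = λ M n le → ℚ.≤-trans (div-col₂ Δ≥0 M n le)
                 (row₂ n (ℕ.≤-trans (ℕ.+-monoʳ-≤ 2 (ℕ.m≤n+m n M)) le))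
      }
      where open Tame t

    ∑-recip-≤ : ∀ {Q f} n → 0ℚ ≤ Q → n ℕ.≤ N →
      (∀ k → suc k ℕ.≤ n → f (suc k) ≤ Q * recip (suc k)) → ∑ n f ≤ Q * h
    ∑-recip-≤ {Q} {f} n 0≤Q n≤N le = begin
      ∑ n f                    ≤⟨ ∑-mono n le ⟩
      ∑ n (λ k → Q * recip k)  ≡⟨ ∑-*ˡ Q recip n ⟩
      Q * ∑ n recip            ≤⟨ *-monoˡ 0≤Q (∑-monoˡ (λ k _ → recip-nonNeg (suc k)) n≤N) ⟩
      Q * h                    ∎
      where open ℚ.≤-Reasoning

    0≤h : 0ℚ ≤ h
    0≤h = ∑-nonNeg N recip-nonNeg

    -- Both column bounds leave summands of at most Q / k in the row sums, so passing from columns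
    -- to rows costs one harmonic sum.
    decay-tame : ∀ {Q x} → Decay Q x → Tame (Q * h) x
    decay-tame {Q} {x} d = record
      { 0≤Q  = 0≤* 0≤Q 0≤h
      ; Δ≥0  = Δ≥0
      ; row₁ = λ n le → ∑-recip-≤ (suc n) 0≤Q le λ k k<n →
                 ι-*≤⇒≤recip k (col₁ k (ℕ.≤-trans k<n le))
      ; row₂ = λ n le → ∑-recip-≤ (suc n) 0≤Q (ℕ.≤-trans (ℕ.n≤1+n _) le) λ k k<n →
                 ℚ.≤-trans (ι-*≤⇒≤recip (suc k) (ℚ.≤-trans (ℚ.≤-reflexive
                     (solve 3 (λ a b c → b :* (a :* c) := a :* (b :* c)) refl (ι (suc k)) (ι (2 ℕ.+ k)) (Δ x 2 k)))
                   (col₂ 0 k (ℕ.≤-trans (s≤s k<n) le))))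
                 (*-monoˡ 0≤Q (recip-suc-≤ k))
      }
      where open Decay d

    decay-value : ∀ {Q x} → Decay Q x → ∀ k → suc k ℕ.≤ N → x (suc k) ≤ Q * recip (suc k)
    decay-value d zero    le = ι-*≤⇒≤recip 0 (Decay.col₁ d 0 le)
    decay-value {Q} {x} d (suc k) le = ι-*≤⇒≤recip (suc k) (ℚ.≤-trans (ℚ.≤-reflexive
        (trans (cong (λ j → ι j * x (2 ℕ.+ k)) (sym (ℕ.+-identityʳ (2 ℕ.+ k)))) (sym (ℚ.*-identityˡ _))))
      (Decay.col₂ d k 0 (subst (ℕ._≤ N) (sym (ℕ.+-identityʳ (2 ℕ.+ k))) le)))

    value-nonNeg : ∀ {y} → NonNeg-Δ y → ∀ k → suc k ℕ.≤ N → 0ℚ ≤ y (suc k)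
    value-nonNeg Δ≥0 k le = Δ≥0 k 0 (subst (ℕ._≤ N) (sym (ℕ.+-identityʳ (suc k))) le)

    tail-pos : ∀ {y} → NonNeg-Δ y → ∀ M n → M ℕ.+ n ℕ.≤ N → 0ℚ ≤ Δ (tail N y) M n
    tail-pos {y} Δ≥0 M zero    le = p≤q⇒0≤q-p (∑-monoˡ (value-nonNeg Δ≥0) (subst (ℕ._≤ N) (ℕ.+-identityʳ M) le))
    tail-pos {y} Δ≥0 M (suc n) le = subst (0ℚ ≤_) (sym (Δ-tail N y M n)) (Δ≥0 M n (subst (ℕ._≤ N) (ℕ.+-suc M n) le))

    monotone-tame : ∀ {Q y} → (∀ M n → M ℕ.+ n ℕ.≤ N → 0ℚ ≤ Δ y M n) → y 0 ≤ Q → Tame Q y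
    monotone-tame {Q} {y} Δ≥0 y₀≤Q = record
      { 0≤Q  = ℚ.≤-trans (Δ≥0 0 0 z≤n) y₀≤Q
      ; Δ≥0  = λ M → Δ≥0 (suc M)
      ; row₁ = row₁
      ; row₂ = λ n le → ℚ.≤-trans (≤-by
          (trans (cong (λ s → ∑ (suc n) (λ j → Δ y 1 (pred j)) - s) (∑Δ-row₂ y 1 n))
            (solve 2 (λ a b → a :- (a :- b) := b) refl (∑ (suc n) (λ j → Δ y 1 (pred j))) (ι (suc n) * Δ y 1 (suc n))))
          (0≤* (ι-nonNeg (suc n)) (Δ≥0 1 (suc n) le)))
          (row₁ n (ℕ.≤-trans (ℕ.n≤1+n _) le))
      }
      where
      row₁ : ∀ n → suc n ℕ.≤ N → ∑ (suc n) (λ j → Δ y 1 (pred j)) ≤ Q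
      row₁ n le = ℚ.≤-trans (≤-by
        (trans (cong (λ s → y 0 - s) (∑Δ-row y 0 n)) (solve 2 (λ a b → a :- (a :- b) := b) refl (y 0) (Δ y 0 (suc n))))
        (Δ≥0 0 (suc n) le)) y₀≤Q

    tail-tame : ∀ {Q x} → Decay Q x → Tame (Q * h) (tail N x)
    tail-tame {Q} {x} d = monotone-tame (tail-pos Δ≥0)
      (ℚ.≤-trans (ℚ.≤-reflexive (solve 1 (λ s → s :- con 0ℚ := s) refl (∑ N x)))
        (∑-recip-≤ N 0≤Q ℕ.≤-refl (decay-value d)))
      where open Decay d

    1-tame : Tame 1ℚ (λ _ → 1ℚ)
    1-tame = monotone-tame Δ≥0 ℚ.≤-refl
      where
      Δ≥0 : ∀ M n → M ℕ.+ n ℕ.≤ N → 0ℚ ≤ Δ (λ _ → 1ℚ) M n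
      Δ≥0 M zero    _ = 0≤1
      Δ≥0 M (suc n) _ = ℚ.≤-reflexive (sym (Δ-1 M n))

    tame-mono : ∀ {Q Q′ y} → Q ≤ Q′ → Tame Q y → Tame Q′ y
    tame-mono le t = record
      { 0≤Q  = ℚ.≤-trans 0≤Q le
      ; Δ≥0  = Δ≥0
      ; row₁ = λ n b → ℚ.≤-trans (row₁ n b) le
      ; row₂ = λ n b → ℚ.≤-trans (row₂ n b) le
      }
      where open Tame t

    decay-mono : ∀ {Q Q′ y} → Q ≤ Q′ → Decay Q y → Decay Q′ y
    decay-mono le d = record
      { 0≤Q  = ℚ.≤-trans 0≤Q le
      ; Δ≥0  = Δ≥0
      ; col₁ = λ n b → ℚ.≤-trans (col₁ n b) le
      ; col₂ = λ M n b → ℚ.≤-trans (col₂ M n b) le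
      }
      where open Decay d

  -- Hoffman duality

  -- ∑ over N ≥ n₁ > ⋯ > n_q ≥ 1 of ∏ (ρ nᵢ) ^ aᵢ
  nested : ∀ {q} → Seq → Vec ℕ q → ℕ → ℚ
  nested ρ []       N = 1ℚ
  nested ρ (a ∷ as) N = ∑ N λ n → ρ n ^ a * nested ρ as (pred n)

  ζ-sum-nested : ∀ {q} (v : Vec ℕ q) N → ζ-sum v N ≡ nested recip v N
  ζ-sum-nested []       N = refl
  ζ-sum-nested (a ∷ as) N = ∑-cong N λ k _ → cong (recip (suc k) ^ a *_) (ζ-sum-nested as k)

  divs : Seq → ℕ → Seq → Seq
  divs ρ zero    x = x
  divs ρ (suc a) x = div ρ (divs ρ a x)

  divs-^ : ∀ ρ a x k → divs ρ a x k ≡ ρ k ^ a * x k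
  divs-^ ρ zero    x k = sym (ℚ.*-identityˡ (x k))
  divs-^ ρ (suc a) x k = trans (cong (ρ k *_) (divs-^ ρ a x k)) (sym (ℚ.*-assoc (ρ k) (ρ k ^ a) (x k)))

  module Words (N : ℕ) (ρ : Seq) where

    -- The first exponent belongs to the largest variable, whose tail is formed first. `inner` is
    -- the same composite, unfolded from the smallest variable, as differences at 0 require.
    outer : ∀ {q} → Vec ℕ q → Seq → Seq
    outer []       x = x
    outer (a ∷ as) x = outer as (tail N (divs ρ a x))

    -- f 0 is the exponent, less one, of the innermost variable.
    inner : (ℕ → ℕ) → ℕ → Seq → Seq
    inner f zero    x = x
    inner f (suc k) x = tail N (divs ρ (suc (f 0)) (inner (f ∘ suc) k x))

    outer-nested : ∀ {q} a (as : Vec ℕ q) x →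
      outer (a ∷ as) x 0 ≡ ∑ N (λ n → ρ n ^ a * x n * nested ρ as (pred n))
    outer-nested a []       x = trans (solve 1 (λ s → s :- con 0ℚ := s) refl (∑ N (divs ρ a x)))
      (∑-cong N λ k _ → trans (divs-^ ρ a x (suc k)) (sym (ℚ.*-identityʳ (ρ (suc k) ^ a * x (suc k)))))
    outer-nested a (b ∷ as) x = begin
      outer (b ∷ as) (tail N X) 0
        ≡⟨ outer-nested b as (tail N X) ⟩
      ∑ N (λ n → ρ n ^ b * tail N X n * nested ρ as (pred n))
        ≡⟨ ∑-cong N (λ k _ → solve 3 (λ r t s → r :* t :* s := r :* s :* t) refl
             (ρ (suc k) ^ b) (tail N X (suc k)) (nested ρ as k)) ⟩
      ∑ N (λ n → Y n * tail N X n)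
        ≡⟨ ∑-triangle X Y N ⟩
      ∑ N (λ n → X n * ∑ (pred n) Y)
        ≡⟨ ∑-cong N (λ k _ → cong (_* ∑ k Y) (divs-^ ρ a x (suc k))) ⟩
      ∑ N (λ n → ρ n ^ a * x n * nested ρ (b ∷ as) (pred n)) ∎
      where
      open ≡-Reasoning
      X = divs ρ a x
      Y : Seq
      Y n = ρ n ^ b * nested ρ as (pred n)

    outer-1 : ∀ {q} (v : Vec ℕ q) → outer v (λ _ → 1ℚ) 0 ≡ nested ρ v N
    outer-1 []       = refl
    outer-1 (a ∷ as) = trans (outer-nested a as (λ _ → 1ℚ))
      (∑-cong N λ k _ → cong (_* nested ρ as k) (ℚ.*-identityʳ (ρ (suc k) ^ a)))

    inner-suc : ∀ f k x → inner f (suc k) x ≡ inner f k (tail N (divs ρ (suc (f k)) x))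
    inner-suc f zero    x = refl
    inner-suc f (suc k) x = cong (λ y → tail N (divs ρ (suc (f 0)) y)) (inner-suc (f ∘ suc) k x)

    outer-++ : ∀ {q q′} (v : Vec ℕ q) (w : Vec ℕ q′) x → outer (v Vec.++ w) x ≡ outer w (outer v x)
    outer-++ []      w x = refl
    outer-++ (a ∷ v) w x = outer-++ v w (tail N (divs ρ a x))

    outer-∷ʳ : ∀ {q} (v : Vec ℕ q) a x → outer (v Vec.∷ʳ a) x ≡ tail N (divs ρ a (outer v x))
    outer-∷ʳ []      a x = refl
    outer-∷ʳ (b ∷ v) a x = outer-∷ʳ v a (tail N (divs ρ b x))

    outer-ones : ∀ r x → outer (ones r) x ≡ inner (λ _ → 0) r x
    outer-ones zero    x = refl
    outer-ones (suc r) x = trans (outer-ones r (tail N (divs ρ 1 x))) (sym (inner-suc (λ _ → 0) r x))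

    outer-descending : ∀ m {p} j k x → p ≡ j ℕ.+ k →
      outer (descending m p k) x ≡ inner (λ i → m (suc (j ℕ.+ i))) k x
    outer-descending m j zero    x eq = refl
    outer-descending m j (suc k) x eq with refl ← trans eq (ℕ.+-suc j k) =
      trans (outer-descending m j k (tail N (divs ρ (suc (m (suc (j ℕ.+ k)))) x)) refl)
        (sym (inner-suc (λ i → m (suc (j ℕ.+ i))) k x))

  avg : Seq → Seq
  avg y n = recip n * ∑ n y

  avgs : ℕ → Seq → Seq
  avgs zero    y = y
  avgs (suc a) y = avg (avgs a y)

  avgs-cong : ∀ {y z} a → (∀ n → y (suc n) ≡ z (suc n)) → ∀ n → avgs a y (suc n) ≡ avgs a z (suc n)
  avgs-cong zero    eq n = eq n
  avgs-cong (suc a) eq n = cong (recip (suc n) *_) (∑-cong (suc n) λ k _ → avgs-cong a eq k)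

  avgs-∑ : ∀ (w : Seq) (u : ℕ → Seq) k a n →
    avgs a (λ n → ∑ k (λ j → w j * u j n)) (suc n) ≡ ∑ k (λ j → w j * avgs a (u j) (suc n))
  avgs-∑ w u k zero    n = refl
  avgs-∑ w u k (suc a) n = begin
    r * ∑ (suc n) (avgs a (λ n → ∑ k (λ j → w j * u j n)))
      ≡⟨ cong (r *_) (∑-cong (suc n) λ i _ → avgs-∑ w u k a i) ⟩
    r * ∑ (suc n) (λ i → ∑ k (λ j → w j * avgs a (u j) i))
      ≡⟨ cong (r *_) (∑-swap (λ i j → w j * avgs a (u j) i) (suc n) k) ⟩
    r * ∑ k (λ j → ∑ (suc n) (λ i → w j * avgs a (u j) i))
      ≡⟨ ∑-*ˡ r (λ j → ∑ (suc n) (λ i → w j * avgs a (u j) i)) k ⟨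
    ∑ k (λ j → r * ∑ (suc n) (λ i → w j * avgs a (u j) i))
      ≡⟨ ∑-cong k (λ j _ → trans (cong (r *_) (∑-*ˡ (w (suc j)) (avgs a (u (suc j))) (suc n)))
           (solve 3 (λ r w s → r :* (w :* s) := w :* (r :* s)) refl r (w (suc j)) (∑ (suc n) (avgs a (u (suc j)))))) ⟩
    ∑ k (λ j → w j * avgs (suc a) (u j) (suc n)) ∎
    where open ≡-Reasoning
          r = recip (suc n)

  Δ-div-1 : ∀ y n → Δ (div recip y) 1 n ≡ recip (suc n) * ∑ (suc n) (λ j → Δ y 1 (pred j))
  Δ-div-1 y n = *-cancelˡ-≡ (ι-pos n) (begin
    ι (suc n) * Δ (div recip y) 1 n
      ≡⟨ div-col₁ y n ⟩
    S
      ≡⟨ ℚ.*-identityˡ S ⟨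
    1ℚ * S
      ≡⟨ cong (_* S) (trans (sym (recip-ι n)) (ℚ.*-comm (recip (suc n)) (ι (suc n)))) ⟩
    ι (suc n) * recip (suc n) * S
      ≡⟨ ℚ.*-assoc (ι (suc n)) (recip (suc n)) S ⟩
    ι (suc n) * (recip (suc n) * S) ∎)
    where open ≡-Reasoning
          S = ∑ (suc n) (λ j → Δ y 1 (pred j))

  -- The first division averages the differences at 1, and their sum telescopes to y 0 - Δ y 0 n;
  -- each further division averages once more.
  Δ-divs-1 : ∀ y a n → Δ (divs recip (suc a) y) 1 n ≡ avgs a (λ n → recip n * (y 0 - Δ y 0 n)) (suc n)
  Δ-divs-1 y zero    n = trans (Δ-div-1 y n) (cong (recip (suc n) *_) (∑Δ-row y 0 n))
  Δ-divs-1 y (suc a) n = trans (Δ-div-1 (divs recip (suc a) y) n)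
    (cong (recip (suc n) *_) (∑-cong (suc n) λ k _ → Δ-divs-1 y a k))

  -- For j ≥ 1, dual f j n is the summand with n₁ = n of the ζ⋆-sum of (f 0 + 1, …, f (j-1) + 1)^∨.
  dual : (ℕ → ℕ) → ℕ → Seq
  dual f zero    n = 1ℚ
  dual f (suc j) = avgs (f 0) (λ n → recip n * dual (f ∘ suc) j n)

  module Duality (N : ℕ) where

    open Words N recip

    value : (ℕ → ℕ) → ℕ → ℚ
    value f k = inner f k (λ _ → 1ℚ) 0

    -- In y 0 - Δ y 0 n the value y 0 is the truncated nested sum without its smallest variable and
    -- gives the term j = 1. The subtracted difference is expanded recursively, which moves j by one
    -- and flips the sign.
    Δ-inner : ∀ f k n → Δ (inner f k (λ _ → 1ℚ)) 0 (suc n)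
      ≡ ∑ k (λ j → (- 1ℚ) ^ (j ℕ.∸ 1) * value (λ i → f (j ℕ.+ i)) (k ℕ.∸ j) * dual f j (suc n))
    Δ-inner f zero    n = Δ-1 0 n
    Δ-inner f (suc k) n = begin
      Δ (tail N (divs recip (suc (f 0)) y)) 0 (suc n)
        ≡⟨ trans (Δ-tail N (divs recip (suc (f 0)) y) 0 n) (Δ-divs-1 y (f 0) n) ⟩
      avgs (f 0) (λ n → recip n * (y 0 - Δ y 0 n)) (suc n)
        ≡⟨ avgs-cong (f 0) expand n ⟩
      avgs (f 0) (λ n → ∑ (suc k) (λ j → w j * u j n)) (suc n)
        ≡⟨ avgs-∑ w u (suc k) (f 0) n ⟩
      ∑ (suc k) (λ j → w j * avgs (f 0) (u j) (suc n))
        ≡⟨ ∑-cong (suc k) (λ j _ → refl) ⟩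
      ∑ (suc k) (λ j → w j * dual f j (suc n)) ∎
      where
      open ≡-Reasoning
      y = inner (f ∘ suc) k (λ _ → 1ℚ)
      w : Seq
      w j = (- 1ℚ) ^ (j ℕ.∸ 1) * value (λ i → f (j ℕ.+ i)) (suc k ℕ.∸ j)
      u : ℕ → Seq
      u j n = recip n * dual (f ∘ suc) (pred j) n
      expand : ∀ n → recip (suc n) * (y 0 - Δ y 0 (suc n)) ≡ ∑ (suc k) (λ j → w j * u j (suc n))
      expand n = begin
        r * (y 0 - Δ y 0 (suc n))
          ≡⟨ cong (λ s → r * (y 0 - s)) (Δ-inner (f ∘ suc) k n) ⟩
        r * (y 0 - ∑ k F)
          ≡⟨ solve 3 (λ r y s → r :* (y :- s) := con 1ℚ :* y :* (r :* con 1ℚ) :+ (:- r) :* s) refl r (y 0) (∑ k F) ⟩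
        1ℚ * y 0 * (r * 1ℚ) + (- r) * ∑ k F
          ≡⟨ cong (_+_ (1ℚ * y 0 * (r * 1ℚ))) (trans (sym (∑-*ˡ (- r) F k)) (∑-cong k λ j _ →
               solve 4 (λ r s v d → (:- r) :* (s :* v :* d) := (:- con 1ℚ) :* s :* v :* (r :* d)) refl
                 r ((- 1ℚ) ^ j) (value (λ i → f (2 ℕ.+ j ℕ.+ i)) (k ℕ.∸ suc j)) (dual (f ∘ suc) (suc j) (suc n)))) ⟩
        w 1 * u 1 (suc n) + ∑ k (λ j → w (suc j) * u (suc j) (suc n))
          ≡⟨ ∑-head (λ j → w j * u j (suc n)) k ⟨
        ∑ (suc k) (λ j → w j * u j (suc n)) ∎
        where
        r = recip (suc n)
        F : Seq
        F j = (- 1ℚ) ^ (j ℕ.∸ 1) * value (λ i → f (suc (j ℕ.+ i))) (k ℕ.∸ j) * dual (f ∘ suc) j (suc n)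

  -- u is the summand of the ζ⋆-sum of L for a fixed largest variable. Keeping the head apart lets a
  -- factor 1 / n raise it.
  Leading : Seq → List ℕ → Set
  Leading u L = ∃[ d ] ∃[ ds ] (L ≡ d ∷ ds × (∀ n → u (suc n) ≡ recip (suc n) ^ d * ζ⋆-sum ds (suc n)))

  leading-∑ : ∀ {u L} → Leading u L → ∀ n → ∑ n u ≡ ζ⋆-sum L n
  leading-∑ (d , ds , refl , eq) n = ∑-cong n λ k _ → eq k

  leading-avgs : ∀ {u L} a → Leading u L → Leading (avgs a u) (List.replicate a 1 List.++ L)
  leading-avgs zero    l = l
  leading-avgs (suc a) l = 1 , _ , refl , λ n → cong₂ _*_
    (sym (ℚ.*-identityʳ (recip (suc n)))) (leading-∑ (leading-avgs a l) (suc n))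

  replicate-∷ʳ : ∀ a → List.replicate a 1 List.++ 1 ∷ [] ≡ List.replicate (suc a) 1
  replicate-∷ʳ zero    = refl
  replicate-∷ʳ (suc a) = cong (1 ∷_) (replicate-∷ʳ a)

  -- An average puts a 1 in front of the index, and a factor 1 / n increments its head. These are
  -- the two operations in the recursion of `_^∨`.
  leading-dual : ∀ f j → Leading (dual f (suc j)) (List.applyUpTo (suc ∘ f) (suc j) ^∨)
  leading-dual f zero = subst (Leading (dual f 1)) (replicate-∷ʳ (f 0))
    (leading-avgs (f 0) (1 , [] , refl , λ n → solve 1 (λ r → r :* con 1ℚ := r :* con 1ℚ :* con 1ℚ) refl (recip (suc n))))
  leading-dual f (suc j) with d , ds , L≡ , eq ← leading-dual (f ∘ suc) j =
    leading-avgs (f 0) (suc d , ds , cong incrementHead L≡ , λ n →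
      trans (cong (recip (suc n) *_) (eq n)) (sym (ℚ.*-assoc (recip (suc n)) (recip (suc n) ^ d) (ζ⋆-sum ds (suc n)))))

  -- The smallest variable has exponent m₁ + 1, whereas the index to be dualised starts with m₁. As
  -- m₁ ≥ 1, the dual of (m₁ + 1, ...) is that of (m₁, ...) with a 1 in front, so the outermost
  -- average is 1 / n times a complete ζ⋆-sum.
  dual-prefix : ∀ m j → 1 ℕ.≤ m 1 → ∀ n →
    dual (m ∘ suc) (suc j) (suc n) ≡ recip (suc n) * ζ⋆-sum (prefix m (suc j) ^∨) (suc n)
  dual-prefix m j 1≤m₁ n with m 1 | 1≤m₁
  ... | suc a | _ = cong (recip (suc n) *_) (leading-∑ (leading-dual f j) (suc n))
    where
    f : ℕ → ℕ
    f zero    = a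
    f (suc i) = m (2 ℕ.+ i)

  -- Sums over signs

  -- Recursive rather than n + n, so that sums up to an even bound release two terms at a time by
  -- computation.
  double : ℕ → ℕ
  double zero    = zero
  double (suc n) = suc (suc (double n))

  double-+ : ∀ n → double n ≡ n ℕ.+ n
  double-+ zero    = refl
  double-+ (suc n) = cong suc (trans (cong suc (double-+ n)) (sym (ℕ.+-suc n n)))

  ∑-double : ∀ f n → ∑ (double n) f ≡ ∑ n (λ k → f (pred (double k)) + f (double k))
  ∑-double f zero    = refl
  ∑-double f (suc n) = trans (cong (λ s → s + f (suc (double n)) + f (double (suc n))) (∑-double f n))
    (ℚ.+-assoc (∑ n (λ k → f (pred (double k)) + f (double k))) (f (suc (double n))) (f (double (suc n))))

  sgn^double : ∀ τ n → sgn τ ^ double n ≡ 1ℚ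
  sgn^double τ      zero    = refl
  sgn^double Sign.+ (suc n) = cong (λ s → 1ℚ * (1ℚ * s)) (sgn^double Sign.+ n)
  sgn^double Sign.- (suc n) = cong (λ s → (- 1ℚ) * ((- 1ℚ) * s)) (sgn^double Sign.- n)

  sgn^odd : ∀ τ n → sgn τ ^ suc (double n) ≡ sgn τ
  sgn^odd τ n = trans (cong (sgn τ *_) (sgn^double τ n)) (ℚ.*-identityʳ (sgn τ))

  ∑±ℚ : ∀ n → (Vec Sign n → ℚ) → ℚ
  ∑±ℚ zero    f = f []
  ∑±ℚ (suc n) f = ∑±ℚ n (λ σ → f (Sign.+ ∷ σ)) + ∑±ℚ n (λ σ → f (Sign.- ∷ σ))

  seq-∑± : ∀ n f k → seq (∑± n f) k ≡ ∑±ℚ n (λ σ → seq (f σ) k)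
  seq-∑± zero    f k = refl
  seq-∑± (suc n) f k = cong₂ _+_ (seq-∑± n (λ σ → f (Sign.+ ∷ σ)) k) (seq-∑± n (λ σ → f (Sign.- ∷ σ)) k)

  ∑±ℚ-0 : ∀ n → ∑±ℚ n (λ _ → 0ℚ) ≡ 0ℚ
  ∑±ℚ-0 zero    = refl
  ∑±ℚ-0 (suc n) = cong₂ _+_ (∑±ℚ-0 n) (∑±ℚ-0 n)

  ∑±ℚ-+ : ∀ n f g → ∑±ℚ n (λ σ → f σ + g σ) ≡ ∑±ℚ n f + ∑±ℚ n g
  ∑±ℚ-+ zero    f g = refl
  ∑±ℚ-+ (suc n) f g = trans
    (cong₂ _+_ (∑±ℚ-+ n (f ∘ (Sign.+ ∷_)) (g ∘ (Sign.+ ∷_))) (∑±ℚ-+ n (f ∘ (Sign.- ∷_)) (g ∘ (Sign.- ∷_))))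
    (solve 4 (λ a b c d → (a :+ b) :+ (c :+ d) := (a :+ c) :+ (b :+ d)) refl
      (∑±ℚ n (f ∘ (Sign.+ ∷_))) (∑±ℚ n (g ∘ (Sign.+ ∷_))) (∑±ℚ n (f ∘ (Sign.- ∷_))) (∑±ℚ n (g ∘ (Sign.- ∷_))))

  ∑±ℚ-* : ∀ n x f → ∑±ℚ n (λ σ → x * f σ) ≡ x * ∑±ℚ n f
  ∑±ℚ-* zero    x f = refl
  ∑±ℚ-* (suc n) x f = trans (cong₂ _+_ (∑±ℚ-* n x (f ∘ (Sign.+ ∷_))) (∑±ℚ-* n x (f ∘ (Sign.- ∷_))))
    (sym (ℚ.*-distribˡ-+ x (∑±ℚ n (f ∘ (Sign.+ ∷_))) (∑±ℚ n (f ∘ (Sign.- ∷_)))))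

  ∑±ℚ-∑ : ∀ n N (w : Seq) (F : Vec Sign n → Seq) →
    ∑±ℚ n (λ σ → ∑ N (λ k → w k * F σ k)) ≡ ∑ N (λ k → w k * ∑±ℚ n (λ σ → F σ k))
  ∑±ℚ-∑ n zero    w F = ∑±ℚ-0 n
  ∑±ℚ-∑ n (suc N) w F = trans
    (∑±ℚ-+ n (λ σ → ∑ N (λ k → w k * F σ k)) (λ σ → w (suc N) * F σ (suc N)))
    (cong₂ _+_ (∑±ℚ-∑ n N w F) (∑±ℚ-* n (w (suc N)) (λ σ → F σ (suc N))))

  evens odds : Seq
  evens k = recip (double k)
  odds  k = recip (pred (double k))

  -- Summing over s = ±1 the terms (τ s)ⁿ W s (n - 1), where W s = U - s V, leaves
  -- only U for even n and only V for odd n.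
  record Parity (W : Sign → Seq) (U V : Seq) : Set where
    field
      at-even : ∀ τ k → W τ (double k) ≡ U k - sgn τ * V k
      at-odd  : ∀ τ k → W τ (suc (double k)) ≡ U k - sgn τ * V (suc k)

  weighted : Seq → ℕ → Seq → Seq
  weighted ρ a U N = ∑ N λ k → ρ k ^ a * ((1ℚ + 1ℚ) * U (pred k))

  module _ {W U V} (P : Parity W U V) (a : ℕ) where
    open Parity P

    both : Sign → Seq
    both τ n = sgn (τ Sign.* Sign.+) ^ n * recip n ^ a * W Sign.+ (pred n)
             + sgn (τ Sign.* Sign.-) ^ n * recip n ^ a * W Sign.- (pred n)

    -- Even powers erase the signs, and W + and W - add up to 2 U.
    both-even : ∀ τ k → both τ (double (suc k)) ≡ evens (suc k) ^ a * ((1ℚ + 1ℚ) * U k)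
    both-even τ k = trans
      (cong₂ _+_
        (cong₂ (λ s w → s * r * w) (sgn^double (τ Sign.* Sign.+) (suc k)) (at-odd Sign.+ k))
        (cong₂ (λ s w → s * r * w) (sgn^double (τ Sign.* Sign.-) (suc k)) (at-odd Sign.- k)))
      (solve 3 (λ r u v → con 1ℚ :* r :* (u :- con 1ℚ :* v) :+ con 1ℚ :* r :* (u :- con (- 1ℚ) :* v)
                  := r :* ((con 1ℚ :+ con 1ℚ) :* u)) refl r (U k) (V (suc k)))
      where r = recip (double (suc k)) ^ a

    -- Odd powers keep the signs, so the two terms give τ (W + - W -) = -2 τ V.
    both-odd : ∀ τ k → both τ (suc (double k)) ≡ - sgn τ * (odds (suc k) ^ a * ((1ℚ + 1ℚ) * V k))
    both-odd τ k = trans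
      (cong₂ _+_
        (cong₂ (λ s w → s * r * w) (sgn^odd (τ Sign.* Sign.+) k) (at-even Sign.+ k))
        (cong₂ (λ s w → s * r * w) (sgn^odd (τ Sign.* Sign.-) k) (at-even Sign.- k)))
      (signs τ)
      where
      r = recip (suc (double k)) ^ a
      signs : ∀ τ → sgn (τ Sign.* Sign.+) * r * (U k - 1ℚ * V k) + sgn (τ Sign.* Sign.-) * r * (U k - (- 1ℚ) * V k)
                  ≡ - sgn τ * (r * ((1ℚ + 1ℚ) * V k))
      signs Sign.+ = solve 3 (λ r u v → con 1ℚ :* r :* (u :- con 1ℚ :* v) :+ con (- 1ℚ) :* r :* (u :- con (- 1ℚ) :* v)
                  := (:- con 1ℚ) :* (r :* ((con 1ℚ :+ con 1ℚ) :* v))) refl r (U k) (V k)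
      signs Sign.- = solve 3 (λ r u v → con (- 1ℚ) :* r :* (u :- con 1ℚ :* v) :+ con 1ℚ :* r :* (u :- con (- 1ℚ) :* v)
                  := (:- con (- 1ℚ)) :* (r :* ((con 1ℚ :+ con 1ℚ) :* v))) refl r (U k) (V k)

    -- The shape U - τ V survives a further summation. An odd bound 2k + 1 admits k even but k + 1
    -- odd values, hence the shifted argument of V in `at-odd`.
    parity-step : Parity (λ τ N → ∑ N (both τ)) (weighted evens a U) (weighted odds a V)
    parity-step = record { at-even = even ; at-odd = odd }
      where
      even : ∀ τ N → ∑ (double N) (both τ) ≡ weighted evens a U N - sgn τ * weighted odds a V N
      even τ N = begin
        ∑ (double N) (both τ)
          ≡⟨ ∑-double (both τ) N ⟩
        ∑ N (λ k → both τ (pred (double k)) + both τ (double k))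
          ≡⟨ ∑-cong N (λ k _ → cong₂ _+_ (both-odd τ k) (both-even τ k)) ⟩
        ∑ N (λ k → - sgn τ * O k + E k)
          ≡⟨ trans (∑-+ (λ k → - sgn τ * O k) E N) (cong (_+ ∑ N E) (∑-*ˡ (- sgn τ) O N)) ⟩
        - sgn τ * ∑ N O + ∑ N E
          ≡⟨ solve 3 (λ s o e → (:- s) :* o :+ e := e :- s :* o) refl (sgn τ) (∑ N O) (∑ N E) ⟩
        ∑ N E - sgn τ * ∑ N O ∎
        where
        open ≡-Reasoning
        E O : Seq
        E k = evens k ^ a * ((1ℚ + 1ℚ) * U (pred k))
        O k = odds k ^ a * ((1ℚ + 1ℚ) * V (pred k))
      odd : ∀ τ N → ∑ (suc (double N)) (both τ) ≡ weighted evens a U N - sgn τ * weighted odds a V (suc N)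
      odd τ N = trans (cong₂ _+_ (even τ N) (both-odd τ N))
        (solve 4 (λ e s o t → (e :- s :* o) :+ (:- s) :* t := e :- s :* (o :+ t)) refl
          (weighted evens a U N) (sgn τ) (weighted odds a V N) (odds (suc N) ^ a * ((1ℚ + 1ℚ) * V N)))

  parity-cong : ∀ {W W′ U U′ V V′} → (∀ τ n → W′ τ n ≡ W τ n) → (∀ n → U n ≡ U′ n) → (∀ n → V n ≡ V′ n) →
    Parity W U V → Parity W′ U′ V′
  parity-cong w u v P = record
    { at-even = λ τ k → trans (w τ (double k)) (trans (at-even τ k) (cong₂ (λ x y → x - sgn τ * y) (u k) (v k)))
    ; at-odd  = λ τ k → trans (w τ (suc (double k))) (trans (at-odd τ k) (cong₂ (λ x y → x - sgn τ * y) (u k) (v (suc k))))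
    }
    where open Parity P

  weighted-nested : ∀ {q} ρ a e (as : Vec ℕ q) N →
    weighted ρ a (λ k → (1ℚ + 1ℚ) ^ e * nested ρ as k) N ≡ (1ℚ + 1ℚ) ^ suc e * nested ρ (a ∷ as) N
  weighted-nested ρ a e as N = trans
    (∑-cong N λ k _ → solve 3 (λ p t s → p :* ((con 1ℚ :+ con 1ℚ) :* (t :* s)) := (con 1ℚ :+ con 1ℚ) :* t :* (p :* s)) refl
      (ρ (suc k) ^ a) ((1ℚ + 1ℚ) ^ e) (nested ρ as k))
    (∑-*ˡ ((1ℚ + 1ℚ) ^ suc e) (λ n → ρ n ^ a * nested ρ as (pred n)) N)

  weighted-0 : ∀ ρ a N → weighted ρ a (λ _ → 0ℚ) N ≡ 0ℚ
  weighted-0 ρ a N = trans (∑-cong N λ k _ → ℚ.*-zeroʳ (ρ (suc k) ^ a)) (∑-0 N)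

  -- (τ σ₁, σ₁ σ₂, σ₂ σ₃, …)
  products : ∀ {q} → Sign → Vec Sign q → Vec Sign q
  products τ σ = Vec.tail (consecutive (τ ∷ σ))

  Li-step : ∀ {q t} a (as : Vec ℕ t) (x : Sign → Vec Sign q → Vec Sign t) τ N →
    ∑±ℚ q (λ σ → Li-sum (a ∷ as) ((τ Sign.* Sign.+) ∷ x Sign.+ σ) N)
      + ∑±ℚ q (λ σ → Li-sum (a ∷ as) ((τ Sign.* Sign.-) ∷ x Sign.- σ) N)
    ≡ ∑ N (λ n → sgn (τ Sign.* Sign.+) ^ n * recip n ^ a * ∑±ℚ q (λ σ → Li-sum as (x Sign.+ σ) (pred n))
               + sgn (τ Sign.* Sign.-) ^ n * recip n ^ a * ∑±ℚ q (λ σ → Li-sum as (x Sign.- σ) (pred n)))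
  Li-step {q} a as x τ N = trans
    (cong₂ _+_
      (∑±ℚ-∑ q N (λ n → sgn (τ Sign.* Sign.+) ^ n * recip n ^ a) (λ σ n → Li-sum as (x Sign.+ σ) (pred n)))
      (∑±ℚ-∑ q N (λ n → sgn (τ Sign.* Sign.-) ^ n * recip n ^ a) (λ σ n → Li-sum as (x Sign.- σ) (pred n))))
    (sym (∑-+ (λ n → sgn (τ Sign.* Sign.+) ^ n * recip n ^ a * ∑±ℚ q (λ σ → Li-sum as (x Sign.+ σ) (pred n)))
              (λ n → sgn (τ Sign.* Sign.-) ^ n * recip n ^ a * ∑±ℚ q (λ σ → Li-sum as (x Sign.- σ) (pred n))) N))

  -- The empty sum does not depend on τ, so V starts at 0 and remains 0: only terms with all
  -- variables even survive.
  Li-parity : ∀ {q} (as : Vec ℕ q) → Parity (λ τ N → ∑±ℚ q (λ σ → Li-sum as (products τ σ) N))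
    (λ N → (1ℚ + 1ℚ) ^ q * nested evens as N) (λ _ → 0ℚ)
  Li-parity []       = record { at-even = λ τ _ → one τ ; at-odd = λ τ _ → one τ }
    where
    one : ∀ τ → 1ℚ ≡ 1ℚ * 1ℚ - sgn τ * 0ℚ
    one Sign.+ = refl
    one Sign.- = refl
  Li-parity {suc q} (a ∷ as) = parity-cong
    (λ τ N → Li-step a as products τ N) (weighted-nested evens a q as) (weighted-0 odds a)
    (parity-step (Li-parity as) a)

  -- The last entry carries the sign -τ, which is 1 at even and -τ at odd powers. Both parities
  -- therefore start, and each is passed on separately.
  Li-parity-∷ʳ : ∀ {q} (as : Vec ℕ q) b →
    Parity (λ τ N → ∑±ℚ q (λ σ → Li-sum (as Vec.∷ʳ b) (products τ (σ Vec.∷ʳ Sign.-)) N))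
      (λ N → (1ℚ + 1ℚ) ^ q * nested evens (as Vec.∷ʳ b) N) (λ N → (1ℚ + 1ℚ) ^ q * nested odds (as Vec.∷ʳ b) N)
  Li-parity-∷ʳ []       b = record { at-even = even ; at-odd = odd }
    where
    F : Sign → Seq
    F τ n = sgn (τ Sign.* Sign.-) ^ n * recip n ^ b * 1ℚ
    E O : Seq
    E n = evens n ^ b * 1ℚ
    O n = odds n ^ b * 1ℚ
    sgn-neg : ∀ τ → sgn (τ Sign.* Sign.-) ≡ - sgn τ
    sgn-neg Sign.+ = refl
    sgn-neg Sign.- = refl
    F-odd : ∀ τ k → F τ (suc (double k)) ≡ - sgn τ * O (suc k)
    F-odd τ k = trans (cong (λ s → s * recip (suc (double k)) ^ b * 1ℚ) (trans (sgn^odd (τ Sign.* Sign.-) k) (sgn-neg τ)))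
      (ℚ.*-assoc (- sgn τ) (recip (suc (double k)) ^ b) 1ℚ)
    F-even : ∀ τ k → F τ (double (suc k)) ≡ E (suc k)
    F-even τ k = cong (_* 1ℚ) (trans (cong (_* recip (double (suc k)) ^ b) (sgn^double (τ Sign.* Sign.-) (suc k)))
      (ℚ.*-identityˡ (recip (double (suc k)) ^ b)))
    even : ∀ τ N → ∑ (double N) (F τ) ≡ 1ℚ * ∑ N E - sgn τ * (1ℚ * ∑ N O)
    even τ N = begin
      ∑ (double N) (F τ)
        ≡⟨ trans (∑-double (F τ) N) (∑-cong N λ k _ → cong₂ _+_ (F-odd τ k) (F-even τ k)) ⟩
      ∑ N (λ k → - sgn τ * O k + E k)
        ≡⟨ trans (∑-+ (λ k → - sgn τ * O k) E N) (cong (_+ ∑ N E) (∑-*ˡ (- sgn τ) O N)) ⟩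
      - sgn τ * ∑ N O + ∑ N E
        ≡⟨ solve 3 (λ s o e → (:- s) :* o :+ e := con 1ℚ :* e :- s :* (con 1ℚ :* o)) refl (sgn τ) (∑ N O) (∑ N E) ⟩
      1ℚ * ∑ N E - sgn τ * (1ℚ * ∑ N O) ∎
      where open ≡-Reasoning
    odd : ∀ τ N → ∑ (suc (double N)) (F τ) ≡ 1ℚ * ∑ N E - sgn τ * (1ℚ * ∑ (suc N) O)
    odd τ N = trans (cong₂ _+_ (even τ N) (F-odd τ N))
      (solve 4 (λ e s o t → (con 1ℚ :* e :- s :* (con 1ℚ :* o)) :+ (:- s) :* t := con 1ℚ :* e :- s :* (con 1ℚ :* (o :+ t))) refl
        (∑ N E) (sgn τ) (∑ N O) (O (suc N)))
  Li-parity-∷ʳ {suc q} (a ∷ as) b = parity-cong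
    (λ τ N → Li-step a (as Vec.∷ʳ b) (λ s σ → products s (σ Vec.∷ʳ Sign.-)) τ N)
    (weighted-nested evens a q (as Vec.∷ʳ b)) (weighted-nested odds a q (as Vec.∷ʳ b))
    (parity-step (Li-parity-∷ʳ as b) a)

  nested-scale : ∀ {q} ρ ρ′ x → (∀ k → ρ′ (suc k) ≡ x * ρ (suc k)) → (v : Vec ℕ q) → ∀ N →
    nested ρ′ v N ≡ x ^ Vec.sum v * nested ρ v N
  nested-scale ρ ρ′ x eq []       N = refl
  nested-scale ρ ρ′ x eq (a ∷ as) N = trans
    (∑-cong N λ k _ → begin
      ρ′ (suc k) ^ a * nested ρ′ as k
        ≡⟨ cong₂ _*_ (trans (cong (_^ a) (eq k)) (^-* x (ρ (suc k)) a)) (nested-scale ρ ρ′ x eq as k) ⟩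
      x ^ a * ρ (suc k) ^ a * (x ^ Vec.sum as * nested ρ as k)
        ≡⟨ solve 4 (λ p r q s → p :* r :* (q :* s) := p :* q :* (r :* s)) refl
             (x ^ a) (ρ (suc k) ^ a) (x ^ Vec.sum as) (nested ρ as k) ⟩
      x ^ a * x ^ Vec.sum as * (ρ (suc k) ^ a * nested ρ as k)
        ≡⟨ cong (_* (ρ (suc k) ^ a * nested ρ as k)) (^-+ x a (Vec.sum as)) ⟨
      x ^ (a ℕ.+ Vec.sum as) * (ρ (suc k) ^ a * nested ρ as k) ∎)
    (∑-*ˡ (x ^ (a ℕ.+ Vec.sum as)) (λ n → ρ n ^ a * nested ρ as (pred n)) N)
    where open ≡-Reasoning

  evens-½ : ∀ k → evens (suc k) ≡ ½ * recip (suc k)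
  evens-½ k = *-cancelˡ-≡ {ι (double (suc k))} (ι-pos (suc (double k))) (begin
    ι (double (suc k)) * recip (double (suc k))
      ≡⟨ trans (ℚ.*-comm (ι (double (suc k))) (recip (double (suc k)))) (recip-ι (suc (double k))) ⟩
    1ℚ
      ≡⟨ recip-ι k ⟨
    recip (suc k) * ι (suc k)
      ≡⟨ solve 2 (λ r i → r :* i := (i :+ i) :* (con ½ :* r)) refl (recip (suc k)) (ι (suc k)) ⟩
    (ι (suc k) + ι (suc k)) * (½ * recip (suc k))
      ≡⟨ cong (_* (½ * recip (suc k))) (trans (sym (ι-+ (suc k) (suc k))) (cong ι (sym (double-+ (suc k))))) ⟩
    ι (double (suc k)) * (½ * recip (suc k)) ∎)
    where open ≡-Reasoning

  odds-½ : ∀ k → odds (suc k) ≡ ½ * shifted (suc k)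
  odds-½ k = trans (cong (λ j → recip (pred j)) (double-+ (suc k)))
    (solve 1 (λ r → r := con ½ :* ((con 1ℚ :+ con 1ℚ) :* r)) refl (recip (k ℕ.+ suc k)))

  -- Both sides are twice the difference of the harmonic sums up to 2n and up to n: the left side is
  -- 2 (∑ odds - ∑ evens), and 2 ∑ evens is the harmonic sum up to n.
  log2-shifted : ∀ n → ∑ n shifted - ∑ n recip ≡ (1ℚ + 1ℚ) * log2-sum n
  log2-shifted n = begin
    ∑ n shifted - ∑ n recip
      ≡⟨ cong₂ _-_ (trans (∑-cong n (λ k _ → trans
             (solve 1 (λ s → s := (con 1ℚ :+ con 1ℚ) :* (con ½ :* s)) refl (shifted (suc k)))
             (cong ((1ℚ + 1ℚ) *_) (sym (odds-½ k))))) (∑-*ˡ (1ℚ + 1ℚ) odds n))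
           (sym double-evens) ⟩
    (1ℚ + 1ℚ) * ∑ n odds - (1ℚ + 1ℚ) * ∑ n evens
      ≡⟨ solve 2 (λ o e → (con 1ℚ :+ con 1ℚ) :* o :- (con 1ℚ :+ con 1ℚ) :* e
                    := (con 1ℚ :+ con 1ℚ) :* ((o :+ e) :- (con 1ℚ :+ con 1ℚ) :* e)) refl (∑ n odds) (∑ n evens) ⟩
    (1ℚ + 1ℚ) * ((∑ n odds + ∑ n evens) - (1ℚ + 1ℚ) * ∑ n evens)
      ≡⟨ cong₂ (λ s t → (1ℚ + 1ℚ) * (s - t)) (trans (sym (∑-+ odds evens n)) (sym (∑-double recip n))) double-evens ⟩
    (1ℚ + 1ℚ) * (∑ (double n) recip - ∑ n recip)
      ≡⟨ cong (λ s → (1ℚ + 1ℚ) * (s - ∑ n recip)) (trans (cong (λ k → ∑ k recip) (double-+ n)) (∑-split recip n n)) ⟩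
    (1ℚ + 1ℚ) * ((∑ n recip + log2-sum n) - ∑ n recip)
      ≡⟨ cong ((1ℚ + 1ℚ) *_) (solve 2 (λ h l → (h :+ l) :- h := l) refl (∑ n recip) (log2-sum n)) ⟩
    (1ℚ + 1ℚ) * log2-sum n ∎
    where
    open ≡-Reasoning
    double-evens : (1ℚ + 1ℚ) * ∑ n evens ≡ ∑ n recip
    double-evens = trans (sym (∑-*ˡ (1ℚ + 1ℚ) evens n)) (∑-cong n λ k _ → trans (cong ((1ℚ + 1ℚ) *_) (evens-½ k))
      (solve 1 (λ s → (con 1ℚ :+ con 1ℚ) :* (con ½ :* s) := s) refl (recip (suc k))))

  -- Truncation errors

  -- Counts powers of `κ`: one for each division and one for each return from a sharp to a plain
  -- estimate in between. `degree` adds one for each tail.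
  div-degree : ℕ → ℕ → ℕ
  div-degree zero    d = suc d
  div-degree (suc a) d = suc (suc (div-degree a d))

  degree : (ℕ → ℕ) → ℕ → ℕ → ℕ
  degree f zero    d = d
  degree f (suc k) d = suc (div-degree (f 0) (degree (f ∘ suc) k d))

  𝟏 : Seq
  𝟏 _ = 1ℚ

  log2-degree : ℕ
  log2-degree = degree (λ _ → 0) 1 0

  full-degree : ℕ → ℕ → (ℕ → ℕ) → ℕ
  full-degree p r m = degree (λ _ → 0) (suc r) (degree (m ∘ suc) p 0)

  module Approximation (ν : ℕ) where

    N : ℕ
    N = suc ν

    open Bounds N

    -- Bounds the sum of all local errors; 3 = 1 + 2 by `∑loc`.
    β : ℚ
    β = ι 3 * c ν

    -- A common price for every operation: 4 is what a division costs, and h pays for sums of 1 / k.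
    κ : ℚ
    κ = ι 4 * h

    -- Bounds the error arising at k, up to the constant Q.
    loc : Seq
    loc zero          = 0ℚ
    loc (suc zero)    = c ν
    loc (suc (suc M)) = recip N * c (N ℕ.∸ (2 ℕ.+ M))

    loc-nonNeg : ∀ k → 0ℚ ≤ loc k
    loc-nonNeg zero          = ℚ.≤-refl
    loc-nonNeg (suc zero)    = c-nonNeg ν
    loc-nonNeg (suc (suc M)) = 0≤* (recip-nonNeg N) (c-nonNeg (N ℕ.∸ (2 ℕ.+ M)))

    recip-*ι≤ : recip N * ι ν ≤ 1ℚ
    recip-*ι≤ = ℚ.≤-trans (*-monoˡ (recip-nonNeg N) (ι-mono (ℕ.n≤1+n ν))) (ℚ.≤-reflexive (recip-ι ν))

    -- The first column contributes c ν. The others contribute at most 2 c ν together, since `∑c`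
    -- gives 2 ν c ν and they carry the factor 1 / N.
    ∑loc : ∑ N loc ≤ β
    ∑loc = begin
      ∑ N loc
        ≡⟨ ∑-head loc ν ⟩
      c ν + ∑ ν (loc ∘ suc)
        ≡⟨ cong (_+_ (c ν)) (trans (∑-cong ν λ k _ → refl) (∑-*ˡ (recip N) (λ k → c (ν ℕ.∸ k)) ν)) ⟩
      c ν + recip N * ∑ ν (λ k → c (ν ℕ.∸ k))
        ≡⟨ cong (λ s → c ν + recip N * s) (∑c ν) ⟩
      c ν + recip N * (ι 2 * (ι ν * c ν))
        ≡⟨ solve 3 (λ c r i → c :+ r :* (con (ι 2) :* (i :* c)) := c :+ (con (ι 2) :* c) :* (r :* i)) refl (c ν) (recip N) (ι ν) ⟩
      c ν + (ι 2 * c ν) * (recip N * ι ν)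
        ≤⟨ ℚ.+-monoʳ-≤ (c ν) (*-monoˡ (0≤* (ι-nonNeg 2) (c-nonNeg ν)) recip-*ι≤) ⟩
      c ν + (ι 2 * c ν) * 1ℚ
        ≡⟨ solve 1 (λ c → c :+ (con (ι 2) :* c) :* con 1ℚ := con (ι 3) :* c) refl (c ν) ⟩
      β ∎
      where open ℚ.≤-Reasoning

    0≤β : 0ℚ ≤ β
    0≤β = 0≤* (ι-nonNeg 3) (c-nonNeg ν)

    1≤h : 1ℚ ≤ h
    1≤h = ≤-by (trans (cong (_- 1ℚ) (∑-head recip ν)) (solve 1 (λ s → (con 1ℚ :+ s) :- con 1ℚ := s) refl (∑ ν (recip ∘ suc))))
      (∑-nonNeg ν (λ k → recip-nonNeg (suc k)))

    ι4≤κ : ι 4 ≤ κ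
    ι4≤κ = ℚ.≤-trans (ℚ.≤-reflexive (sym (ℚ.*-identityʳ (ι 4)))) (*-monoˡ (ι-nonNeg 4) 1≤h)

    h≤κ : h ≤ κ
    h≤κ = ≤-by (solve 1 (λ h → con (ι 4) :* h :- h := con (ι 3) :* h) refl h) (0≤* (ι-nonNeg 3) 0≤h)

    -- Error terms enter through differences on the antidiagonal M + K = N.
    decay-loc : ∀ {Q x} → Decay Q x → ∀ M K → suc M ℕ.+ K ≡ N →
      ι (suc K) * (c K * Δ x (suc M) K) ≤ Q * loc (suc M)
    decay-loc {Q} {x} d zero K refl = begin
      ι (suc K) * (c K * Δ x 1 K)   ≡⟨ solve 3 (λ i c x → i :* (c :* x) := (i :* x) :* c) refl (ι (suc K)) (c K) (Δ x 1 K) ⟩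
      (ι (suc K) * Δ x 1 K) * c K   ≤⟨ *-monoʳ (c-nonNeg K) (Decay.col₁ d K ℕ.≤-refl) ⟩
      Q * c K                       ∎
      where open ℚ.≤-Reasoning
    decay-loc {Q} {x} d (suc M) K refl = begin
      ι (suc K) * (c K * Δ x (2 ℕ.+ M) K)   ≡⟨ solve 3 (λ i c x → i :* (c :* x) := (i :* x) :* c) refl (ι (suc K)) (c K) (Δ x (2 ℕ.+ M) K) ⟩
      (ι (suc K) * Δ x (2 ℕ.+ M) K) * c K   ≤⟨ *-monoʳ (c-nonNeg K) (ι-*≤⇒≤recip ν (ℚ.≤-trans (ℚ.≤-reflexive
                                                (solve 3 (λ n k x → n :* (k :* x) := k :* (n :* x)) refl (ι N) (ι (suc K)) (Δ x (2 ℕ.+ M) K)))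
                                                (Decay.col₂ d M K ℕ.≤-refl))) ⟩
      (Q * recip N) * c K                   ≡⟨ ℚ.*-assoc Q (recip N) (c K) ⟩
      Q * (recip N * c K)                   ≡⟨ cong (λ j → Q * (recip N * c j)) (ℕ.m+n∸m≡n (2 ℕ.+ M) K) ⟨
      Q * (recip N * c (2 ℕ.+ M ℕ.+ K ℕ.∸ (2 ℕ.+ M))) ∎
      where open ℚ.≤-Reasoning

    record Approximates (Q : ℚ) (y τ : Seq) : Set where
      field
        tame  : Tame Q y
        error : ∀ M K → suc M ℕ.+ K ≡ N → ∣ Φ y (suc M) K - τ (suc M) ∣ ≤ Q * (loc (suc M) + β)

    -- The factor 1 / M at `β` keeps the sum over M at `β * h`. The estimate of `Approximates`,
    -- summed over M, would give N β, which grows like N ^ 1/2.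
    record SharplyApproximates (Q : ℚ) (x τ : Seq) : Set where
      field
        decay : Decay Q x
        error : ∀ M K → suc M ℕ.+ K ≡ N → ∣ Φ x (suc M) K - τ (suc M) ∣ ≤ Q * (loc (suc M) + β * recip (suc M))

    -- By `Φ-div` the new error is the old one plus a boundary term of size Q loc, all divided by M
    -- - 1/2; this division yields the factor 1 / M.
    approx-div : ∀ {Q y τ} → Approximates Q y τ → SharplyApproximates (κ * Q) (div recip y) (div shifted τ)
    approx-div {Q} {y} {τ} g = record
      { decay = decay-mono (≤-by (solve 2 (λ k q → k :* q :- q := (k :- con 1ℚ) :* q) refl κ Q)
                  (0≤* (p≤q⇒0≤q-p (ℚ.≤-trans (ι-mono {1} {4} (s≤s z≤n)) ι4≤κ)) 0≤Q)) d
      ; error = err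
      }
      where
      open Approximates g
      open Tame tame
      open ℚ.≤-Reasoning
      d = div-decay tame
      x = div recip y
      err : ∀ M K → suc M ℕ.+ K ≡ N → ∣ Φ x (suc M) K - div shifted τ (suc M) ∣ ≤ κ * Q * (loc (suc M) + β * recip (suc M))
      err M K eq = begin
        ∣ Φ x (suc M) K - s * t ∣
          ≡⟨ cong ∣_∣ (begin-equality
               Φ x (suc M) K - s * t
                 ≡⟨ cong (_- s * t) (trans (sym (ℚ.*-identityˡ (Φ x (suc M) K))) (cong (_* Φ x (suc M) K) (sym (shifted-inv M)))) ⟩
               s * (ι (suc M) - ½) * Φ x (suc M) K - s * t
                 ≡⟨ solve 4 (λ s m f t → s :* m :* f :- s :* t := s :* (m :* f :- t)) refl s (ι (suc M) - ½) (Φ x (suc M) K) t ⟩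
               s * ((ι (suc M) - ½) * Φ x (suc M) K - t)
                 ≡⟨ cong (λ u → s * (u - t)) (Φ-div y M K) ⟩
               s * ((Φ y (suc M) K - e) - t)
                 ≡⟨ cong (s *_) (solve 3 (λ f e t → (f :- e) :- t := (f :- t) :- e) refl (Φ y (suc M) K) e t) ⟩
               s * ((Φ y (suc M) K - t) - e) ∎) ⟩
        ∣ s * ((Φ y (suc M) K - t) - e) ∣
          ≤⟨ ∣*∣-≤ (ℚ.≤-trans (ℚ.≤-reflexive (ℚ.0≤p⇒∣p∣≡p (shifted-nonNeg (suc M)))) (shifted-≤ M))
               (∣-∣-≤ {Φ y (suc M) K - t} {e} (error M K eq) e≤) ⟩
        (1ℚ + 1ℚ) * r * (Q * (l + β) + Q * l)
          -- The 4 is 2 from 1 / (M - 1/2) ≤ 2 / M, times 2 for the two occurrences of `loc`, whose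
          -- factor 1 / M is given away.
          ≤⟨ ≤-by (solve 4 (λ r q l b → con (ι 4) :* q :* (l :+ b :* r) :- (con 1ℚ :+ con 1ℚ) :* r :* (q :* (l :+ b) :+ q :* l)
                       := con (ι 4) :* (q :* (l :* (con 1ℚ :- r))) :+ con (ι 2) :* (q :* (b :* r))) refl r Q l β)
               (0≤+ (0≤* (ι-nonNeg 4) (0≤* 0≤Q (0≤* (loc-nonNeg (suc M)) (p≤q⇒0≤q-p (recip-≤1 (suc M))))))
                    (0≤* (ι-nonNeg 2) (0≤* 0≤Q (0≤* 0≤β (recip-nonNeg (suc M)))))) ⟩
        ι 4 * Q * (l + β * r)
          ≤⟨ *-monoʳ (0≤+ (loc-nonNeg (suc M)) (0≤* 0≤β (recip-nonNeg (suc M)))) (*-monoʳ 0≤Q ι4≤κ) ⟩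
        κ * Q * (l + β * r) ∎
        where
        s = shifted (suc M) ; t = τ (suc M) ; r = recip (suc M) ; l = loc (suc M)
        e = (ι K + ½) * c K * Δ x (suc M) K
        cΔ≥0 : 0ℚ ≤ c K * Δ x (suc M) K
        cΔ≥0 = 0≤* (c-nonNeg K) (Decay.Δ≥0 d M K (ℕ.≤-reflexive eq))
        e≤ : ∣ e ∣ ≤ Q * l
        e≤ = begin
          ∣ e ∣                                    ≡⟨ cong ∣_∣ (ℚ.*-assoc (ι K + ½) (c K) (Δ x (suc M) K)) ⟩
          ∣ (ι K + ½) * (c K * Δ x (suc M) K) ∣    ≡⟨ ℚ.0≤p⇒∣p∣≡p (0≤* (0≤+ (ι-nonNeg K) (ℚ.<⇒≤ 0<½)) cΔ≥0) ⟩
          (ι K + ½) * (c K * Δ x (suc M) K)        ≤⟨ *-monoʳ {p = ι K + ½} {ι (suc K)} cΔ≥0 (ι+½≤ι-suc K) ⟩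
          ι (suc K) * (c K * Δ x (suc M) K)        ≤⟨ decay-loc d M K eq ⟩
          Q * l                                    ∎

    sharp⇒approx : ∀ {Q y τ} → SharplyApproximates Q y τ → Approximates (κ * Q) y τ
    sharp⇒approx {Q} {y} {τ} g = record
      { tame  = tame-mono (ℚ.≤-trans (ℚ.≤-reflexive (ℚ.*-comm Q h)) (*-monoʳ 0≤Q h≤κ)) (decay-tame decay)
      ; error = λ M K eq → ℚ.≤-trans (error M K eq) (*-mono-≤ (0≤* 0≤κ 0≤Q)
          (0≤+ (loc-nonNeg (suc M)) (0≤* 0≤β (recip-nonNeg (suc M))))
          (≤-by (solve 2 (λ k q → k :* q :- q := (k :- con 1ℚ) :* q) refl κ Q) (0≤* (p≤q⇒0≤q-p 1≤κ) 0≤Q))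
          (ℚ.+-monoʳ-≤ (loc (suc M)) (ℚ.≤-trans (*-monoˡ 0≤β (recip-≤1 (suc M))) (ℚ.≤-reflexive (ℚ.*-identityʳ β)))))
      }
      where
      open SharplyApproximates g
      open Decay decay
      1≤κ : 1ℚ ≤ κ
      1≤κ = ℚ.≤-trans (ι-mono {1} {4} (s≤s z≤n)) ι4≤κ
      0≤κ : 0ℚ ≤ κ
      0≤κ = ℚ.≤-trans 0≤1 1≤κ

    module _ {Q x τ} (g : SharplyApproximates Q x τ) where
      open SharplyApproximates g
      open Decay decay

      step-error : Seq
      step-error k = Q * (loc k + β * recip k) + Q * loc k

      -- Descends from M = N, where both tails vanish. By `Φ-tail` each step adds the error of x at
      -- M + 1 and one boundary term, which together make `step-error`.
      tail-error : ∀ K M → M ℕ.+ K ≡ N →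
        ∣ Φ (tail N x) M K - tail N τ M ∣ ≤ tail N step-error M
      tail-error zero M eq rewrite trans (sym (ℕ.+-identityʳ M)) eq = ℚ.≤-reflexive (begin
        ∣ c 0 * tail N x N - tail N τ N ∣
          ≡⟨ cong ∣_∣ (cong₂ (λ s t → c 0 * s - t) (tail-end N x) (tail-end N τ)) ⟩
        ∣ c 0 * 0ℚ - 0ℚ ∣
          ≡⟨ cong ∣_∣ (solve 1 (λ c → c :* con 0ℚ :- con 0ℚ := con 0ℚ) refl (c 0)) ⟩
        0ℚ
          ≡⟨ tail-end N step-error ⟨
        tail N step-error N ∎)
        where open ≡-Reasoning
      tail-error (suc K) M eq = begin
        ∣ Φ (tail N x) M (suc K) - tail N τ M ∣
          ≡⟨ cong ∣_∣ (cong₂ _-_ (Φ-tail N x M K) (tail-step N τ M)) ⟩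
        ∣ ((F + F′) + e) - (t + t′) ∣
          ≡⟨ cong ∣_∣ (solve 5 (λ f g e t u → ((f :+ g) :+ e) :- (t :+ u) := (f :- t) :+ ((g :- u) :+ e)) refl F F′ e t t′) ⟩
        ∣ (F - t) + ((F′ - t′) + e) ∣
          ≤⟨ ∣+∣-≤ {F - t} (tail-error K (suc M) eq′) (∣+∣-≤ {F′ - t′} (error M K eq′) e≤) ⟩
        tail N step-error (suc M) + step-error (suc M)
          ≡⟨ tail-step N step-error M ⟨
        tail N step-error M ∎
        where
        open ℚ.≤-Reasoning
        eq′ = trans (sym (ℕ.+-suc M K)) eq
        F = Φ (tail N x) (suc M) K ; F′ = Φ x (suc M) K ; t = tail N τ (suc M) ; t′ = τ (suc M)
        e = c (suc K) * Δ x (suc M) K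
        Δ≥ : 0ℚ ≤ Δ x (suc M) K
        Δ≥ = Δ≥0 M K (ℕ.≤-reflexive eq′)
        e≤ : ∣ e ∣ ≤ Q * loc (suc M)
        e≤ = begin
          ∣ e ∣                                       ≡⟨ ℚ.0≤p⇒∣p∣≡p (0≤* (c-nonNeg (suc K)) Δ≥) ⟩
          c (suc K) * Δ x (suc M) K                   ≡⟨ ℚ.*-identityˡ _ ⟨
          1ℚ * (c (suc K) * Δ x (suc M) K)            ≤⟨ *-monoʳ (0≤* (c-nonNeg (suc K)) Δ≥) (ι-mono {1} {suc K} (s≤s z≤n)) ⟩
          ι (suc K) * (c (suc K) * Δ x (suc M) K)     ≡⟨ trans (sym (ℚ.*-assoc (ι (suc K)) (c (suc K)) _))
                                                           (trans (cong (_* Δ x (suc M) K) (c-suc K)) (ℚ.*-assoc (ι K + ½) (c K) _)) ⟩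
          (ι K + ½) * (c K * Δ x (suc M) K)           ≤⟨ *-monoʳ {p = ι K + ½} {ι (suc K)} (0≤* (c-nonNeg K) Δ≥) (ι+½≤ι-suc K) ⟩
          ι (suc K) * (c K * Δ x (suc M) K)           ≤⟨ decay-loc decay M K eq′ ⟩
          Q * loc (suc M)                             ∎

      tail-error-≤ : ∀ M K → M ℕ.+ K ≡ N → ∣ Φ (tail N x) M K - tail N τ M ∣ ≤ κ * Q * β
      tail-error-≤ M K eq = begin
        ∣ Φ (tail N x) M K - tail N τ M ∣
          ≤⟨ tail-error K M eq ⟩
        ∑ N step-error - ∑ M step-error
          ≤⟨ ≤-by (solve 2 (λ a b → a :- (a :- b) := b) refl (∑ N step-error) (∑ M step-error)) (∑-nonNeg M step-error≥0) ⟩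
        ∑ N step-error
          ≡⟨ trans (∑-+ (λ k → Q * (loc k + β * recip k)) (λ k → Q * loc k) N)
               (cong₂ _+_ (trans (∑-*ˡ Q (λ k → loc k + β * recip k) N) (cong (Q *_)
                   (trans (∑-+ loc (λ k → β * recip k) N) (cong (_+_ (∑ N loc)) (∑-*ˡ β recip N)))))
                 (∑-*ˡ Q loc N)) ⟩
        Q * (∑ N loc + β * h) + Q * ∑ N loc
          ≤⟨ ℚ.+-mono-≤ (*-monoˡ 0≤Q (ℚ.+-monoˡ-≤ (β * h) ∑loc)) (*-monoˡ 0≤Q ∑loc) ⟩
        Q * (β + β * h) + Q * β
          -- It remains that 2 + h ≤ 4 h, which holds because h ≥ 1.
          ≤⟨ ≤-by (solve 3 (λ q b h → con (ι 4) :* h :* q :* b :- (q :* (b :+ b :* h) :+ q :* b)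
                      := q :* b :* (con (ι 2) :* (h :- con 1ℚ) :+ h)) refl Q β h)
               (0≤* (0≤* 0≤Q 0≤β) (0≤+ (0≤* (ι-nonNeg 2) (p≤q⇒0≤q-p 1≤h)) 0≤h)) ⟩
        κ * Q * β ∎
        where
        open ℚ.≤-Reasoning
        step-error≥0 : ∀ k → 0ℚ ≤ step-error k
        step-error≥0 k = 0≤+ (0≤* 0≤Q (0≤+ (loc-nonNeg k) (0≤* 0≤β (recip-nonNeg k)))) (0≤* 0≤Q (loc-nonNeg k))

      approx-tail : Approximates (κ * Q) (tail N x) (tail N τ)
      approx-tail = record
        { tame  = tame-mono (ℚ.≤-trans (ℚ.≤-reflexive (ℚ.*-comm Q h)) (*-monoʳ 0≤Q h≤κ)) (tail-tame decay)
        ; error = λ M K eq → ℚ.≤-trans (tail-error-≤ (suc M) K eq)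
            (*-monoˡ (0≤* (ℚ.≤-trans (ι-nonNeg 4) ι4≤κ) 0≤Q)
              (≤-by (solve 2 (λ l b → (l :+ b) :- b := l) refl (loc (suc M)) β) (loc-nonNeg (suc M))))
        }

    open Words N

    approx-1 : Approximates (κ ^ 0) 𝟏 𝟏
    approx-1 = record
      { tame  = 1-tame
      ; error = λ M K _ → ℚ.≤-trans (ℚ.≤-reflexive (cong (λ s → ∣ s - 1ℚ ∣) (Φ-1 (suc M) K)))
          (0≤* 0≤1 (0≤+ (loc-nonNeg (suc M)) 0≤β))
      }
      where
      Φ-1 : ∀ M K → Φ 𝟏 M K ≡ 1ℚ
      Φ-1 M zero    = refl
      Φ-1 M (suc K) = trans (cong₂ (λ s t → s + c (suc K) * t) (Φ-1 M K) (Δ-1 M K))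
        (trans (cong (_+_ 1ℚ) (ℚ.*-zeroʳ (c (suc K)))) (ℚ.+-identityʳ 1ℚ))

    approx-divs : ∀ a {d y τ} → Approximates (κ ^ d) y τ →
      SharplyApproximates (κ ^ div-degree a d) (divs recip (suc a) y) (divs shifted (suc a) τ)
    approx-divs zero    g = approx-div g
    approx-divs (suc a) g = approx-div (sharp⇒approx (approx-divs a g))

    approx-inner : ∀ f k {d y τ} → Approximates (κ ^ d) y τ →
      Approximates (κ ^ degree f k d) (inner recip f k y) (inner shifted f k τ)
    approx-inner f zero    g = g
    approx-inner f (suc k) g = approx-tail (approx-divs (f 0) (approx-inner (f ∘ suc) k g))

    -- `Approximates` says nothing at M = 0 because of the divisions by M. The last operation is a
    -- tail, however, and its estimate does reach M = 0.
    inner-error : ∀ f k {d y τ} → Approximates (κ ^ d) y τ →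
      ∣ Φ (inner recip f (suc k) y) 0 N - inner shifted f (suc k) τ 0 ∣ ≤ κ ^ degree f (suc k) d * β
    inner-error f k g = tail-error-≤ (approx-divs (f 0) (approx-inner (f ∘ suc) k g)) 0 N refl

    Φ-∑ : ∀ y K → Φ y 0 K ≡ y 0 + ∑ K (λ n → Δ y 0 n * c n)
    Φ-∑ y zero    = trans (ℚ.*-identityˡ (y 0)) (sym (ℚ.+-identityʳ (y 0)))
    Φ-∑ y (suc K) = trans (cong₂ _+_ (Φ-∑ y K) (ℚ.*-comm (c (suc K)) (Δ y 0 (suc K))))
      (ℚ.+-assoc (y 0) (∑ K (λ n → Δ y 0 n * c n)) (Δ y 0 (suc K) * c (suc K)))

    private module W = Words N recip
    private module W′ = Words N shifted

    -- The Newton series for l = (1): its constant term is the harmonic sum, its differences at 0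
    -- are 1 / n, and its target is `∑ N shifted`. Neither sum converges, but `log2-shifted`
    -- identifies their difference.
    ζB-1-error : ∣ ζB⋆-sum 1 [] N - (1ℚ + 1ℚ) * log2-sum N ∣ ≤ κ ^ log2-degree * β
    ζB-1-error = ℚ.≤-trans (ℚ.≤-reflexive (cong ∣_∣ (sym (begin
        Φ y 0 N - W′.inner (λ _ → 0) 1 𝟏 0
          ≡⟨ cong₂ _-_ (Φ-∑ y N) (outer₁ shifted) ⟩
        (y 0 + ∑ N (λ n → Δ y 0 n * c n)) - ∑ N shifted
          ≡⟨ cong₂ (λ s t → (s + t) - ∑ N shifted) (outer₁ recip) (∑-cong N λ k _ → cong (_* c (suc k)) (Δy k)) ⟩
        (∑ N recip + B) - ∑ N shifted
          ≡⟨ solve 3 (λ h b t → (h :+ b) :- t := b :- (t :- h)) refl (∑ N recip) B (∑ N shifted) ⟩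
        B - (∑ N shifted - ∑ N recip)
          ≡⟨ cong (λ s → B - s) (log2-shifted N) ⟩
        B - (1ℚ + 1ℚ) * log2-sum N ∎))))
      (inner-error (λ _ → 0) 0 {0} approx-1)
      where
      open ≡-Reasoning
      y = W.inner (λ _ → 0) 1 𝟏
      B = ζB⋆-sum 1 [] N
      outer₁ : ∀ ρ → Words.inner N ρ (λ _ → 0) 1 𝟏 0 ≡ ∑ N ρ
      outer₁ ρ = trans (solve 1 (λ s → s :- con 0ℚ := s) refl (∑ N (λ k → ρ k * 1ℚ)))
        (∑-cong N λ k _ → ℚ.*-identityʳ (ρ (suc k)))
      Δy : ∀ n → Δ y 0 (suc n) ≡ recip (suc n) ^ 1 * 1ℚ
      Δy n = begin
        Δ y 0 (suc n)
          ≡⟨ trans (Δ-tail N (divs recip 1 𝟏) 0 n) (Δ-divs-1 𝟏 0 n) ⟩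
        recip (suc n) * (1ℚ - Δ 𝟏 0 (suc n))
          ≡⟨ cong (λ s → recip (suc n) * (1ℚ - s)) (Δ-1 0 n) ⟩
        recip (suc n) * 1ℚ
          ≡⟨ ℚ.*-identityʳ (recip (suc n) ^ 1) ⟨
        recip (suc n) ^ 1 * 1ℚ ∎

    module _ (y : Seq) where

      Y : ℕ → Seq
      Y i = W.inner (λ _ → 0) i y

      Δ-ones : ∀ i n → Δ (Y (suc i)) 0 (suc n) ≡ recip (suc n) * (Y i 0 - Δ (Y i) 0 (suc n))
      Δ-ones i n = trans (Δ-tail N (divs recip 1 (Y i)) 0 n) (Δ-divs-1 (Y i) 0 n)

      -- `Δ-ones` solved for R Δ (Y i) and iterated. Each factor R trades a difference for a value
      -- minus the difference with one more trailing 1, which accounts for the alternating signs.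
      peel-ones : ∀ r n → let R = recip (suc n) in
        R ^ suc r * Δ y 0 (suc n)
        ≡ ∑ r (λ j → (- 1ℚ) ^ (r ℕ.∸ j) * Y (r ℕ.∸ j) 0 * R ^ suc j)
          + (- 1ℚ) ^ r * (R * Y r 0) - (- 1ℚ) ^ r * Δ (Y (suc r)) 0 (suc n)
      peel-ones zero n = begin
        R * 1ℚ * d
          ≡⟨ solve 3 (λ r d y → r :* con 1ℚ :* d := con 0ℚ :+ con 1ℚ :* (r :* y) :- con 1ℚ :* (r :* (y :- d))) refl R d (y 0) ⟩
        0ℚ + 1ℚ * (R * y 0) - 1ℚ * (R * (y 0 - d))
          ≡⟨ cong (λ s → 0ℚ + 1ℚ * (R * y 0) - 1ℚ * s) (Δ-ones 0 n) ⟨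
        0ℚ + 1ℚ * (R * y 0) - 1ℚ * Δ (Y 1) 0 (suc n) ∎
        where open ≡-Reasoning
              R = recip (suc n) ; d = Δ y 0 (suc n)
      peel-ones (suc r) n = begin
        R * R ^ suc r * Δ y 0 (suc n)
          ≡⟨ ℚ.*-assoc R (R ^ suc r) (Δ y 0 (suc n)) ⟩
        R * (R ^ suc r * Δ y 0 (suc n))
          ≡⟨ cong (R *_) (peel-ones r n) ⟩
        R * (∑ r F + s * (R * a) - s * d)
          ≡⟨ solve 6 (λ r f s a d b → r :* (f :+ s :* (r :* a) :- s :* d)
                := (s :* a :* (r :* (r :* con 1ℚ)) :+ r :* f) :+ (:- con 1ℚ) :* s :* (r :* b)
                    :- (:- con 1ℚ) :* s :* (r :* (b :- d))) refl R (∑ r F) s a d b ⟩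
        (s * a * (R * (R * 1ℚ)) + R * ∑ r F) + - 1ℚ * s * (R * b) - - 1ℚ * s * (R * (b - d))
          ≡⟨ cong₂ (λ x z → (s * a * (R * (R * 1ℚ)) + x) + - 1ℚ * s * (R * b) - - 1ℚ * s * z)
               (trans (sym (∑-*ˡ R F r)) (∑-cong r λ j _ →
                 solve 3 (λ r w q → r :* (w :* q) := w :* (r :* q)) refl R
                   ((- 1ℚ) ^ (r ℕ.∸ suc j) * Y (r ℕ.∸ suc j) 0) (R ^ suc (suc j))))
               (sym (Δ-ones (suc r) n)) ⟩
        (F′ 1 + ∑ r (F′ ∘ suc)) + - 1ℚ * s * (R * b) - - 1ℚ * s * Δ (Y (2 ℕ.+ r)) 0 (suc n)
          ≡⟨ cong (λ x → x + - 1ℚ * s * (R * b) - - 1ℚ * s * Δ (Y (2 ℕ.+ r)) 0 (suc n)) (∑-head F′ r) ⟨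
        ∑ (suc r) F′ + - 1ℚ * s * (R * b) - - 1ℚ * s * Δ (Y (2 ℕ.+ r)) 0 (suc n) ∎
        where
        open ≡-Reasoning
        R = recip (suc n) ; s = (- 1ℚ) ^ r ; a = Y r 0 ; b = Y (suc r) 0 ; d = Δ (Y (suc r)) 0 (suc n)
        F F′ : Seq
        F j = (- 1ℚ) ^ (r ℕ.∸ j) * Y (r ℕ.∸ j) 0 * R ^ suc j
        F′ j = (- 1ℚ) ^ (suc r ℕ.∸ j) * Y (suc r ℕ.∸ j) 0 * R ^ suc j

      -- The term with exponent 1 is kept apart: its factor ζ_B⋆(1) is what becomes 2 log 2.
      peel-ones-∑ : ∀ r →
        ∑ N (λ n → recip n ^ suc r * Δ y 0 n * c n)
        ≡ ∑ r (λ j → (- 1ℚ) ^ (r ℕ.∸ j) * Y (r ℕ.∸ j) 0 * ζB⋆-sum (suc j) [] N)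
          + (- 1ℚ) ^ r * (Y r 0 * ζB⋆-sum 1 [] N) - (- 1ℚ) ^ r * ∑ N (λ n → Δ (Y (suc r)) 0 n * c n)
      peel-ones-∑ r = begin
        ∑ N (λ n → recip n ^ suc r * Δ y 0 n * c n)
          ≡⟨ ∑-cong N (λ n _ → trans (cong (_* c (suc n)) (peel-ones r n)) (expand n)) ⟩
        ∑ N (λ n → (P n + Q n) + T n)
          ≡⟨ trans (∑-+ (λ n → P n + Q n) T N) (cong₂ _+_ (∑-+ P Q N) (∑-*ˡ (- s) D N)) ⟩
        (∑ N P + ∑ N Q) + - s * ∑ N D
          ≡⟨ cong₂ (λ x z → (x + z) + - s * ∑ N D)
               (trans (∑-swap (λ n j → w j * b j n) N r) (∑-cong r λ j _ → ∑-*ˡ (w (suc j)) (b (suc j)) N))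
               (∑-*ˡ (s * Y r 0) (b 0) N) ⟩
        (∑ r (λ j → w j * ∑ N (b j)) + s * Y r 0 * ∑ N (b 0)) + - s * ∑ N D
          ≡⟨ solve 5 (λ x s a z d → (x :+ s :* a :* z) :+ (:- s) :* d := x :+ s :* (a :* z) :- s :* d) refl
               (∑ r (λ j → w j * ∑ N (b j))) s (Y r 0) (∑ N (b 0)) (∑ N D) ⟩
        ∑ r (λ j → w j * ∑ N (b j)) + s * (Y r 0 * ∑ N (b 0)) - s * ∑ N D ∎
        where
        open ≡-Reasoning
        s = (- 1ℚ) ^ r
        w : Seq
        w j = (- 1ℚ) ^ (r ℕ.∸ j) * Y (r ℕ.∸ j) 0
        b : ℕ → Seq
        b j n = recip n ^ suc j * 1ℚ * c n
        P Q T D : Seq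
        P n = ∑ r (λ j → w j * b j n)
        Q n = s * Y r 0 * b 0 n
        D n = Δ (Y (suc r)) 0 n * c n
        T n = - s * D n
        expand : ∀ n → (∑ r (λ j → w j * recip (suc n) ^ suc j) + s * (recip (suc n) * Y r 0) - s * Δ (Y (suc r)) 0 (suc n)) * c (suc n)
                     ≡ (P (suc n) + Q (suc n)) + T (suc n)
        expand n = trans
          (solve 6 (λ x s r a d c → (x :+ s :* (r :* a) :- s :* d) :* c
                      := (x :* c :+ s :* a :* (r :* con 1ℚ :* con 1ℚ :* c)) :+ (:- s) :* (d :* c)) refl
            (∑ r (λ j → w j * recip (suc n) ^ suc j)) s (recip (suc n)) (Y r 0) (Δ (Y (suc r)) 0 (suc n)) (c (suc n)))
          (cong (λ x → (x + Q (suc n)) + T (suc n))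
            (trans (sym (∑-*ʳ (c (suc n)) (λ j → w j * recip (suc n) ^ suc j) r))
              (∑-cong r λ j _ → solve 3 (λ w q c → w :* q :* c := w :* (q :* con 1ℚ :* c)) refl
                (w (suc j)) (recip (suc n) ^ suc (suc j)) (c (suc n)))))

  -- The truncated identity

  1^ : ∀ a → 1ℚ ^ a ≡ 1ℚ
  1^ zero    = refl
  1^ (suc a) = trans (ℚ.*-identityˡ (1ℚ ^ a)) (1^ a)

  2^*½^ : ∀ a → (1ℚ + 1ℚ) ^ a * ½ ^ a ≡ 1ℚ
  2^*½^ a = trans (sym (^-* (1ℚ + 1ℚ) ½ a)) (1^ a)

  sum-ones : ∀ {q} (v : Vec ℕ q) r → Vec.sum (v Vec.++ ones r) ≡ Vec.sum v ℕ.+ r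
  sum-ones []      zero    = refl
  sum-ones []      (suc r) = cong suc (sum-ones [] r)
  sum-ones (a ∷ v) r       = trans (cong (a ℕ.+_) (sum-ones v r)) (sym (ℕ.+-assoc a (Vec.sum v) r))

  sum-∷ʳ : ∀ {q} (v : Vec ℕ q) a → Vec.sum (v Vec.∷ʳ a) ≡ Vec.sum v ℕ.+ a
  sum-∷ʳ []      a = ℕ.+-identityʳ a
  sum-∷ʳ (b ∷ v) a = trans (cong (b ℕ.+_) (sum-∷ʳ v a)) (sym (ℕ.+-assoc b (Vec.sum v) a))

  sum-descending : ∀ m p → Vec.sum (descending m p p) ≡ ∑ℕ p m ℕ.+ p
  sum-descending m zero    = refl
  sum-descending m (suc p) = begin
    suc (m (suc p)) ℕ.+ Vec.sum (descending m p p)   ≡⟨ cong (suc (m (suc p)) ℕ.+_) (sum-descending m p) ⟩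
    suc (m (suc p) ℕ.+ (∑ℕ p m ℕ.+ p))              ≡⟨ cong suc (ℕ.+-assoc (m (suc p)) (∑ℕ p m) p) ⟨
    suc ((m (suc p) ℕ.+ ∑ℕ p m) ℕ.+ p)              ≡⟨ cong (λ s → suc (s ℕ.+ p)) (ℕ.+-comm (m (suc p)) (∑ℕ p m)) ⟩
    suc ((∑ℕ p m ℕ.+ m (suc p)) ℕ.+ p)              ≡⟨ ℕ.+-suc (∑ℕ p m ℕ.+ m (suc p)) p ⟨
    ∑ℕ p m ℕ.+ m (suc p) ℕ.+ suc p                  ∎
    where open ≡-Reasoning

  seq-∑ᴿ : ∀ p F N (g : Seq) → (∀ j 1≤j → j ℕ.≤ p → seq (F j 1≤j) N ≡ g j) → seq (∑ᴿ p F) N ≡ ∑ p g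
  seq-∑ᴿ zero    F N g eq = refl
  seq-∑ᴿ (suc p) F N g eq = cong₂ _+_
    (seq-∑ᴿ p F N g λ j 1≤j j≤p → eq j 1≤j (ℕ.m≤n⇒m≤1+n j≤p)) (eq (suc p) (s≤s z≤n) ℕ.≤-refl)

  module Truncated (p r : ℕ) (m : ℕ → ℕ) (1≤m₁ : 1 ℕ.≤ m 1) (ν : ℕ) where

    open Approximation ν

    v : Vec ℕ (p ℕ.+ r)
    v = descending m p p Vec.++ ones r

    S : ℚ
    S = ι (2 ℕ.^ (∑ℕ p m ℕ.+ 1))

    y : Seq
    y = Words.inner N recip (m ∘ suc) p 𝟏

    outer-v : ∀ r ρ → Words.outer N ρ (descending m p p Vec.++ ones r) 𝟏
                    ≡ Words.inner N ρ (λ _ → 0) r (Words.inner N ρ (m ∘ suc) p 𝟏)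
    outer-v r ρ = trans (outer-++ (descending m p p) (ones r) 𝟏)
      (trans (outer-ones r (outer (descending m p p) 𝟏)) (cong (inner (λ _ → 0) r) (outer-descending m 0 p 𝟏 refl)))
      where open Words N ρ

    Y-ζ : ∀ i → Y y i 0 ≡ ζ-sum (descending m p p Vec.++ ones i) N
    Y-ζ i = trans (cong (λ x → x 0) (sym (outer-v i recip)))
      (trans (Words.outer-1 N recip (descending m p p Vec.++ ones i)) (sym (ζ-sum-nested (descending m p p Vec.++ ones i) N)))

    full : ∀ ρ → Words.inner N ρ (λ _ → 0) (suc r) (Words.inner N ρ (m ∘ suc) p 𝟏) 0 ≡ nested ρ (v Vec.∷ʳ 1) N
    full ρ = trans (cong (λ x → tail N (divs ρ 1 x) 0) (sym (outer-v r ρ)))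
      (trans (cong (λ x → x 0) (sym (outer-∷ʳ v 1 𝟏))) (outer-1 (v Vec.∷ʳ 1)))
      where open Words N ρ

    value-ζ : ∀ j → j ℕ.≤ p → Duality.value N (λ i → m (suc (j ℕ.+ i))) (p ℕ.∸ j) ≡ ζ-sum (descending m p (p ℕ.∸ j)) N
    value-ζ j j≤p = trans (cong (λ x → x 0) (sym (outer-descending m j (p ℕ.∸ j) 𝟏 (sym (ℕ.m+[n∸m]≡n j≤p)))))
      (trans (outer-1 (descending m p (p ℕ.∸ j))) (sym (ζ-sum-nested (descending m p (p ℕ.∸ j)) N)))
      where open Words N recip

    -- The exponent r + 2 is r + 1 from the explicit power and 1 from the factor split off in
    -- `dual-prefix`.
    dual-side : ∑ p (λ j → (- 1ℚ) ^ (j ℕ.∸ 1) * ζ-sum (descending m p (p ℕ.∸ j)) N * ζB⋆-sum (r ℕ.+ 2) (prefix m j ^∨) N)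
              ≡ ∑ N (λ n → recip n ^ suc r * Δ y 0 n * c n)
    dual-side = sym (begin
      ∑ N (λ n → recip n ^ suc r * Δ y 0 n * c n)
        ≡⟨ ∑-cong N (λ n _ → expand n) ⟩
      ∑ N (λ n → ∑ p (λ j → w j * b j n))
        ≡⟨ ∑-swap (λ n j → w j * b j n) N p ⟩
      ∑ p (λ j → ∑ N (λ n → w j * b j n))
        ≡⟨ ∑-cong p (λ j _ → ∑-*ˡ (w (suc j)) (b (suc j)) N) ⟩
      ∑ p (λ j → w j * ∑ N (b j)) ∎)
      where
      open ≡-Reasoning
      w : Seq
      w j = (- 1ℚ) ^ (j ℕ.∸ 1) * ζ-sum (descending m p (p ℕ.∸ j)) N
      b : ℕ → Seq
      b j n = recip n ^ (r ℕ.+ 2) * ζ⋆-sum (prefix m j ^∨) n * c n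
      C′ : Seq
      C′ j = (- 1ℚ) ^ (j ℕ.∸ 1) * Duality.value N (λ i → m (suc (j ℕ.+ i))) (p ℕ.∸ j)
      expand : ∀ n → recip (suc n) ^ suc r * Δ y 0 (suc n) * c (suc n) ≡ ∑ p (λ j → w j * b j (suc n))
      expand n = begin
        R ^ suc r * Δ y 0 (suc n) * c (suc n)
          ≡⟨ cong (λ s → R ^ suc r * s * c (suc n)) (Duality.Δ-inner N (m ∘ suc) p n) ⟩
        R ^ suc r * ∑ p F * c (suc n)
          ≡⟨ solve 3 (λ a s c → a :* s :* c := (a :* c) :* s) refl (R ^ suc r) (∑ p F) (c (suc n)) ⟩
        R ^ suc r * c (suc n) * ∑ p F
          ≡⟨ ∑-*ˡ (R ^ suc r * c (suc n)) F p ⟨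
        ∑ p (λ j → R ^ suc r * c (suc n) * F j)
          ≡⟨ ∑-cong p (λ j j<p → begin
               R ^ suc r * c (suc n) * (C′ (suc j) * dual (m ∘ suc) (suc j) (suc n))
                 ≡⟨ cong₂ (λ s t → R ^ suc r * c (suc n) * ((- 1ℚ) ^ j * s * t)) (value-ζ (suc j) j<p) (dual-prefix m j 1≤m₁ n) ⟩
               R ^ suc r * c (suc n) * (w (suc j) * (R * z j))
                 ≡⟨ solve 5 (λ q r c w z → (r :* q) :* c :* (w :* (r :* z)) := w :* ((q :* (r :* (r :* con 1ℚ))) :* z :* c)) refl
                      (R ^ r) R (c (suc n)) (w (suc j)) (z j) ⟩
               w (suc j) * ((R ^ r * R ^ 2) * z j * c (suc n))
                 ≡⟨ cong (λ s → w (suc j) * (s * z j * c (suc n))) (^-+ R r 2) ⟨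
               w (suc j) * b (suc j) (suc n) ∎) ⟩
        ∑ p (λ j → w j * b j (suc n)) ∎
        where
        R = recip (suc n)
        z : ℕ → ℚ
        z j = ζ⋆-sum (prefix m (suc j) ^∨) (suc n)
        F : Seq
        F j = C′ j * dual (m ∘ suc) j (suc n)

    S≡ : S ≡ (1ℚ + 1ℚ) ^ suc (∑ℕ p m)
    S≡ = trans (cong (λ k → ι (2 ℕ.^ k)) (ℕ.+-comm (∑ℕ p m) 1)) (ι-^ 2 (suc (∑ℕ p m)))

    sum-v : Vec.sum v ≡ ∑ℕ p m ℕ.+ (p ℕ.+ r)
    sum-v = trans (sum-ones (descending m p p) r) (trans (cong (ℕ._+ r) (sum-descending m p)) (ℕ.+-assoc (∑ℕ p m) p r))

    -- Summing over p + r signs gives 2 ^ (p + r), and halving all variables gives 2 to the power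
    -- -(|m| + p + r); `S` leaves a single factor 2.
    scale : S * ((1ℚ + 1ℚ) ^ (p ℕ.+ r) * ½ ^ Vec.sum v) ≡ 1ℚ + 1ℚ
    scale = begin
      S * (T * ½ ^ Vec.sum v)
        ≡⟨ cong₂ (λ s k → s * (T * ½ ^ k)) S≡ sum-v ⟩
      (1ℚ + 1ℚ) * (1ℚ + 1ℚ) ^ a * (T * ½ ^ (a ℕ.+ (p ℕ.+ r)))
        ≡⟨ solve 3 (λ s t h → (con 1ℚ :+ con 1ℚ) :* s :* (t :* h) := (con 1ℚ :+ con 1ℚ) :* (s :* t :* h)) refl
             ((1ℚ + 1ℚ) ^ a) T (½ ^ (a ℕ.+ (p ℕ.+ r))) ⟩
      (1ℚ + 1ℚ) * ((1ℚ + 1ℚ) ^ a * T * ½ ^ (a ℕ.+ (p ℕ.+ r)))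
        ≡⟨ cong (λ s → (1ℚ + 1ℚ) * (s * ½ ^ (a ℕ.+ (p ℕ.+ r)))) (^-+ (1ℚ + 1ℚ) a (p ℕ.+ r)) ⟨
      (1ℚ + 1ℚ) * ((1ℚ + 1ℚ) ^ (a ℕ.+ (p ℕ.+ r)) * ½ ^ (a ℕ.+ (p ℕ.+ r)))
        ≡⟨ cong ((1ℚ + 1ℚ) *_) (2^*½^ (a ℕ.+ (p ℕ.+ r))) ⟩
      (1ℚ + 1ℚ) * 1ℚ
        ≡⟨ ℚ.*-identityʳ (1ℚ + 1ℚ) ⟩
      1ℚ + 1ℚ ∎
      where open ≡-Reasoning
            T = (1ℚ + 1ℚ) ^ (p ℕ.+ r) ; a = ∑ℕ p m

    Z : ℚ
    Z = ζ-sum v N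

    Li-v : S * ∑±ℚ (p ℕ.+ r) (λ σ → Li-sum v (consecutive σ) (double N)) ≡ (1ℚ + 1ℚ) * Z
    Li-v = begin
      S * ∑±ℚ (p ℕ.+ r) (λ σ → Li-sum v (consecutive σ) (double N))
        -- `consecutive σ` is `products Sign.+ σ` by computation.
        ≡⟨ cong (S *_) (Parity.at-even (Li-parity v) Sign.+ N) ⟩
      S * (T * nested evens v N - 1ℚ * 0ℚ)
        ≡⟨ cong (λ s → S * (T * s - 1ℚ * 0ℚ)) (nested-scale recip evens ½ evens-½ v N) ⟩
      S * (T * (h * nested recip v N) - 1ℚ * 0ℚ)
        ≡⟨ solve 4 (λ s t h z → s :* (t :* (h :* z) :- con 1ℚ :* con 0ℚ) := s :* (t :* h) :* z) refl S T h (nested recip v N) ⟩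
      S * (T * h) * nested recip v N
        ≡⟨ cong₂ _*_ scale (sym (ζ-sum-nested v N)) ⟩
      (1ℚ + 1ℚ) * Z ∎
      where open ≡-Reasoning
            T = (1ℚ + 1ℚ) ^ (p ℕ.+ r) ; h = ½ ^ Vec.sum v

    -- The further exponent 1 brings a factor 1/2 but no further sign to sum over, so the 2 of
    -- `scale` cancels. The constant terms of the Newton series and its target remain.
    Li-v∷ʳ1 : S * ∑±ℚ (p ℕ.+ r) (λ σ → Li-sum (v Vec.∷ʳ 1) (consecutive (σ Vec.∷ʳ Sign.-)) (double N))
            ≡ nested recip (v Vec.∷ʳ 1) N - nested shifted (v Vec.∷ʳ 1) N
    Li-v∷ʳ1 = begin
      S * ∑±ℚ (p ℕ.+ r) (λ σ → Li-sum (v Vec.∷ʳ 1) (consecutive (σ Vec.∷ʳ Sign.-)) (double N))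
        ≡⟨ cong (S *_) (Parity.at-even (Li-parity-∷ʳ v 1) Sign.+ N) ⟩
      S * (T * nested evens u N - 1ℚ * (T * nested odds u N))
        ≡⟨ cong₂ (λ s t → S * (T * s - 1ℚ * (T * t)))
             (nested-scale recip evens ½ evens-½ u N) (nested-scale shifted odds ½ odds-½ u N) ⟩
      S * (T * (½ ^ Vec.sum u * E) - 1ℚ * (T * (½ ^ Vec.sum u * O)))
        ≡⟨ cong (λ k → S * (T * (k * E) - 1ℚ * (T * (k * O))))
             (cong (½ ^_) (trans (sum-∷ʳ v 1) (ℕ.+-comm (Vec.sum v) 1))) ⟩
      S * (T * (½ * h * E) - 1ℚ * (T * (½ * h * O)))
        ≡⟨ solve 5 (λ s t h e o → s :* (t :* (con ½ :* h :* e) :- con 1ℚ :* (t :* (con ½ :* h :* o)))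
                      := s :* (t :* h) :* con ½ :* (e :- o)) refl S T h E O ⟩
      S * (T * h) * ½ * (E - O)
        ≡⟨ cong (λ s → s * ½ * (E - O)) scale ⟩
      1ℚ * (E - O)
        ≡⟨ ℚ.*-identityˡ (E - O) ⟩
      E - O ∎
      where open ≡-Reasoning
            u = v Vec.∷ʳ 1
            T = (1ℚ + 1ℚ) ^ (p ℕ.+ r) ; h = ½ ^ Vec.sum v
            E = nested recip u N ; O = nested shifted u N

    lhs rhs : ℚ
    lhs = ∑ p (λ j → (- 1ℚ) ^ (j ℕ.∸ 1) * ζ-sum (descending m p (p ℕ.∸ j)) N * ζB⋆-sum (r ℕ.+ 2) (prefix m j ^∨) N)
    rhs = ∑ r (λ j → (- 1ℚ) ^ (r ℕ.∸ j) * ζ-sum (descending m p p Vec.++ ones (r ℕ.∸ j)) N * ζB⋆-sum (j ℕ.+ 1) [] N)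
      + (- 1ℚ) ^ r * S * log2-sum N * ∑±ℚ (p ℕ.+ r) (λ σ → Li-sum v (consecutive σ) (double N))
      + (- 1ℚ) ^ r * S * ∑±ℚ (p ℕ.+ r) (λ σ → Li-sum (v Vec.∷ʳ 1) (consecutive (σ Vec.∷ʳ Sign.-)) (double N))

    ∣-1^∣-≤1 : ∀ k → ∣ (- 1ℚ) ^ k ∣ ≤ 1ℚ
    ∣-1^∣-≤1 = ∣^∣-≤1 ℚ.≤-refl

    -- All main terms cancel exactly. What is left is the Newton error for l and the one for (1),
    -- the latter multiplied by `Z`, the coefficient of ζ_B⋆(1).
    truncated-error : ∣ lhs - rhs ∣ ≤ ∣ Z ∣ * (κ ^ log2-degree * β) + κ ^ full-degree p r m * β
    truncated-error = begin
      ∣ lhs - rhs ∣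
        ≡⟨ cong ∣_∣ difference ⟩
      ∣ s * (Z * e₂ - e₁) ∣
        ≤⟨ ∣*∣-≤ (∣-1^∣-≤1 r) (∣-∣-≤ {Z * e₂} {e₁} (∣*∣-≤ {Z} ℚ.≤-refl ζB-1-error) (inner-error (λ _ → 0) r (approx-inner (m ∘ suc) p {0} approx-1))) ⟩
      1ℚ * (∣ Z ∣ * (κ ^ log2-degree * β) + κ ^ full-degree p r m * β)
        ≡⟨ ℚ.*-identityˡ _ ⟩
      ∣ Z ∣ * (κ ^ log2-degree * β) + κ ^ full-degree p r m * β ∎
      where
      open ℚ.≤-Reasoning
      s = (- 1ℚ) ^ r
      L = log2-sum N
      B₁ = ζB⋆-sum 1 [] N
      e₂ = B₁ - (1ℚ + 1ℚ) * L
      X = Y y (suc r)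
      W = Words.inner N shifted (λ _ → 0) (suc r) (Words.inner N shifted (m ∘ suc) p 𝟏) 0
      e₁ = Φ X 0 N - W
      A = ∑ r (λ j → (- 1ℚ) ^ (r ℕ.∸ j) * Y y (r ℕ.∸ j) 0 * ζB⋆-sum (suc j) [] N)
      A′ = ∑ r (λ j → (- 1ℚ) ^ (r ℕ.∸ j) * ζ-sum (descending m p p Vec.++ ones (r ℕ.∸ j)) N * ζB⋆-sum (j ℕ.+ 1) [] N)
      Q = ∑ N (λ n → Δ X 0 n * c n)
      L₁ = ∑±ℚ (p ℕ.+ r) (λ σ → Li-sum v (consecutive σ) (double N))
      L₂ = ∑±ℚ (p ℕ.+ r) (λ σ → Li-sum (v Vec.∷ʳ 1) (consecutive (σ Vec.∷ʳ Sign.-)) (double N))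
      A≡ : A ≡ A′
      A≡ = ∑-cong r λ j _ → cong₂ (λ z k → (- 1ℚ) ^ (r ℕ.∸ suc j) * z * ζB⋆-sum k [] N) (Y-ζ (r ℕ.∸ suc j)) (ℕ.+-comm 1 (suc j))
      difference : lhs - rhs ≡ s * (Z * e₂ - e₁)
      difference = begin-equality
        lhs - rhs
          ≡⟨ cong₂ _-_ (trans dual-side (peel-ones-∑ y r))
               (solve 6 (λ a s t l u w → a :+ s :* t :* l :* u :+ s :* t :* w := a :+ s :* l :* (t :* u) :+ s :* (t :* w)) refl A′ s S L L₁ L₂) ⟩
        (A + s * (Y y r 0 * B₁) - s * Q) - (A′ + s * L * (S * L₁) + s * (S * L₂))
          ≡⟨ cong₂ (λ a b → a - b)
               (cong₂ (λ a z → a + s * (z * B₁) - s * Q) A≡ (Y-ζ r))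
               (cong₂ (λ t u → A′ + s * L * t + s * u) Li-v
                 (trans Li-v∷ʳ1 (cong₂ _-_ (sym (full recip)) (sym (full shifted))))) ⟩
        (A′ + s * (Z * B₁) - s * Q) - (A′ + s * L * ((1ℚ + 1ℚ) * Z) + s * (X 0 - W))
          ≡⟨ solve 8 (λ a s z b q l x w →
               (a :+ s :* (z :* b) :- s :* q) :- (a :+ s :* l :* ((con 1ℚ :+ con 1ℚ) :* z) :+ s :* (x :- w))
               := s :* (z :* (b :- (con 1ℚ :+ con 1ℚ) :* l) :- ((x :+ q) :- w))) refl A′ s Z B₁ Q L (X 0) W ⟩
        s * (Z * e₂ - ((X 0 + Q) - W))
          ≡⟨ cong (λ t → s * (Z * e₂ - (t - W))) (Φ-∑ X N) ⟨
        s * (Z * e₂ - e₁) ∎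

  -- Passage to the limit

  Null⇒≃ : ∀ {x y E} → (∀ n → ∣ seq x (suc n) - seq y (suc n) ∣ ≤ E (suc n)) → Null E → x ≃ y
  Null⇒≃ le null = Null-≤ le null

  ≃-trans : ∀ {x y z} → x ≃ y → y ≃ z → x ≃ z
  ≃-trans {x} {y} {z} x≃y y≃z = Null-≤ {B = λ n → ∣ seq x n - seq y n ∣ + ∣ seq y n - seq z n ∣}
    (λ n → ℚ.≤-trans
      (ℚ.≤-reflexive (cong ∣_∣ (solve 3 (λ a b c → a :- c := (a :- b) :+ (b :- c)) refl (seq x (suc n)) (seq y (suc n)) (seq z (suc n)))))
      (ℚ.∣p+q∣≤∣p∣+∣q∣ (seq x (suc n) - seq y (suc n)) (seq y (suc n) - seq z (suc n))))
    (Null-+ {λ n → ∣ seq x n - seq y n ∣} {λ n → ∣ seq y n - seq z n ∣} x≃y y≃z)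

  +ᴿ-cong : ∀ {x x′ y y′} → x ≃ x′ → y ≃ y′ → x +ᴿ y ≃ x′ +ᴿ y′
  +ᴿ-cong {x} {x′} {y} {y′} x≃ y≃ = Null-≤ {B = λ n → ∣ seq x n - seq x′ n ∣ + ∣ seq y n - seq y′ n ∣}
    (λ n → ℚ.≤-trans
      (ℚ.≤-reflexive (cong ∣_∣ (solve 4 (λ a b c d → (a :+ c) :- (b :+ d) := (a :- b) :+ (c :- d)) refl
        (seq x (suc n)) (seq x′ (suc n)) (seq y (suc n)) (seq y′ (suc n)))))
      (ℚ.∣p+q∣≤∣p∣+∣q∣ (seq x (suc n) - seq x′ (suc n)) (seq y (suc n) - seq y′ (suc n))))
    (Null-+ {λ n → ∣ seq x n - seq x′ n ∣} {λ n → ∣ seq y n - seq y′ n ∣} x≃ y≃)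

  ≃-refl : ∀ {x} → x ≃ x
  ≃-refl {x} ε 0<ε = 0 , λ n _ → ℚ.≤-trans (ℚ.≤-reflexive (cong ∣_∣ (ℚ.+-inverseʳ (seq x n)))) (ℚ.<⇒≤ 0<ε)

  Null-*ᴿ : ∀ x {E} → (∀ n → 0ℚ ≤ E n) → Null E → Null (λ n → ∣ seq x n ∣ * E n)
  Null-*ᴿ x {E} 0≤E null ε 0<ε =
    let N₁ , B , 0<B , bound = eventually-bounded x
        N₂ , small = Null-scale B (ℚ.<⇒≤ 0<B) 0≤E null ε 0<ε
    in N₁ ℕ.⊔ N₂ , λ n N≤n → ℚ.≤-trans
      (*-monoʳ (0≤E n) (bound n (ℕ.m⊔n≤o⇒m≤o N₁ N₂ N≤n)))
      (small n (ℕ.m⊔n≤o⇒n≤o N₁ N₂ N≤n))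

  *ᴿ-congˡ : ∀ x {y y′} → y ≃ y′ → x *ᴿ y ≃ x *ᴿ y′
  *ᴿ-congˡ x {y} {y′} y≃y′ = Null-≤ {B = λ n → ∣ seq x n ∣ * ∣ seq y n - seq y′ n ∣}
    (λ n → ℚ.≤-reflexive (trans
      (cong ∣_∣ (solve 3 (λ a b c → a :* b :- a :* c := a :* (b :- c)) refl (seq x (suc n)) (seq y (suc n)) (seq y′ (suc n))))
      (ℚ.∣p*q∣≡∣p∣*∣q∣ (seq x (suc n)) (seq y (suc n) - seq y′ (suc n)))))
    (Null-*ᴿ x {λ n → ∣ seq y n - seq y′ n ∣} (λ n → ℚ.0≤∣p∣ (seq y n - seq y′ n)) y≃y′)

  n≤double : ∀ n → n ℕ.≤ double n
  n≤double zero    = z≤n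
  n≤double (suc n) = s≤s (ℕ.m≤n⇒m≤1+n (n≤double n))

  -- Even variables up to 2N correspond to all variables up to N, so the sign sums must be truncated
  -- at 2N where the ζ-sums stop at N.
  at-doubles : ℝ → ℝ
  at-doubles x = lim (λ n → seq x (double n)) λ ε 0<ε →
    let N , h = cauchy x ε 0<ε
    in N , λ i j N≤i N≤j → h (double i) (double j) (ℕ.≤-trans N≤i (n≤double i)) (ℕ.≤-trans N≤j (n≤double j))

  at-doubles-≃ : ∀ x → at-doubles x ≃ x
  at-doubles-≃ x ε 0<ε =
    let N , h = cauchy x ε 0<ε
    in N , λ n N≤n → h (double n) n (ℕ.≤-trans N≤n (n≤double n)) N≤n

  module _ (p r : ℕ) (m : ℕ → ℕ) (1≤p : 1 ℕ.≤ p) (1≤m₁ : 1 ℕ.≤ m 1) (1≤mₚ : 1 ℕ.≤ m p) where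

    left-terms : ∀ j → 1 ℕ.≤ j → ℝ
    left-terms j _ =
      [-1]^ (j ℕ.∸ 1)
        *ᴿ ζ (descending m p (p ℕ.∸ j)) (descending-admissible m p (p ℕ.∸ j) 1≤mₚ)
        *ᴿ ζB⋆ (r ℕ.+ 2) (prefix m j ^∨) (ℕ.m≤n+m 2 r)
             (indices≥1 (^∨-isHoffmanDual (prefix m j) (prefix-positive m j 1≤m₁)))

    right-terms : ∀ j → 1 ℕ.≤ j → ℝ
    right-terms j 1≤j =
      [-1]^ (r ℕ.∸ j)
        *ᴿ ζ (descending m p p Vec.++ ones (r ℕ.∸ j)) (descending++ones-admissible m p (r ℕ.∸ j) 1≤p 1≤mₚ)
        *ᴿ ζB⋆ (j ℕ.+ 1) [] (ℕ.+-monoˡ-≤ 1 1≤j) []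

    Li₁ Li₂ : Vec Sign (p ℕ.+ r) → ℝ
    Li₁ σ = Li (descending m p p Vec.++ ones r) (consecutive σ) (descending++ones-admissible m p r 1≤p 1≤mₚ)
    Li₂ σ = Li ((descending m p p Vec.++ ones r) Vec.∷ʳ 1) (consecutive (σ Vec.∷ʳ Sign.-))
               (descending++ones∷ʳ1-admissible m p r 1≤p 1≤mₚ)

    right-side : (ℝ → ℝ) → ℝ
    right-side f = ∑ᴿ r right-terms
      +ᴿ [-1]^ r *ᴿ fromℕ (2 ℕ.^ (∑ℕ p m ℕ.+ 1)) *ᴿ log2 *ᴿ f (∑± (p ℕ.+ r) Li₁)
      +ᴿ [-1]^ r *ᴿ fromℕ (2 ℕ.^ (∑ℕ p m ℕ.+ 1)) *ᴿ f (∑± (p ℕ.+ r) Li₂)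

    -- The truncated identity bounds the distance to the right side with its sign sums taken along
    -- even truncations; replacing those by the full sequences does not change the limits.
    identity : ∑ᴿ p left-terms ≃ right-side (λ x → x)
    identity = ≃-trans {∑ᴿ p left-terms} {right-side at-doubles} {right-side (λ x → x)}
      (Null⇒≃ {∑ᴿ p left-terms} {right-side at-doubles} {E} bound
        (Null-+ {λ n → ∣ seq Z n ∣ * error-term log2-degree n} {error-term (full-degree p r m)}
          (Null-*ᴿ Z (error-term-nonNeg log2-degree) (error-null log2-degree)) (error-null (full-degree p r m))))
      (+ᴿ-cong {∑ᴿ r right-terms +ᴿ s *ᴿ log2 *ᴿ at-doubles L₁} {∑ᴿ r right-terms +ᴿ s *ᴿ log2 *ᴿ L₁}
          {s *ᴿ at-doubles L₂} {s *ᴿ L₂}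
        (+ᴿ-cong {∑ᴿ r right-terms} {∑ᴿ r right-terms} {s *ᴿ log2 *ᴿ at-doubles L₁} {s *ᴿ log2 *ᴿ L₁}
          (≃-refl {∑ᴿ r right-terms}) (*ᴿ-congˡ (s *ᴿ log2) {at-doubles L₁} {L₁} (at-doubles-≃ L₁)))
        (*ᴿ-congˡ s {at-doubles L₂} {L₂} (at-doubles-≃ L₂)))
      where
      s L₁ L₂ Z : ℝ
      s  = [-1]^ r *ᴿ fromℕ (2 ℕ.^ (∑ℕ p m ℕ.+ 1))
      L₁ = ∑± (p ℕ.+ r) Li₁
      L₂ = ∑± (p ℕ.+ r) Li₂
      Z  = ζ (descending m p p Vec.++ ones r) (descending++ones-admissible m p r 1≤p 1≤mₚ)
      E : Seq
      E n = ∣ seq Z n ∣ * error-term log2-degree n + error-term (full-degree p r m) n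
      bound : ∀ ν → ∣ seq (∑ᴿ p left-terms) (suc ν) - seq (right-side at-doubles) (suc ν) ∣ ≤ E (suc ν)
      bound ν = ℚ.≤-trans (ℚ.≤-reflexive (cong ∣_∣ (cong₂ _-_ lhs≡ rhs≡))) truncated-error
        where
        open Truncated p r m 1≤m₁ ν hiding (Z)
        lhs≡ : seq (∑ᴿ p left-terms) (suc ν) ≡ lhs
        lhs≡ = seq-∑ᴿ p left-terms (suc ν)
          (λ j → (- 1ℚ) ^ (j ℕ.∸ 1) * ζ-sum (descending m p (p ℕ.∸ j)) (suc ν) * ζB⋆-sum (r ℕ.+ 2) (prefix m j ^∨) (suc ν))
          λ _ _ _ → refl
        rhs≡ : seq (right-side at-doubles) (suc ν) ≡ rhs
        rhs≡ = cong₂ _+_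
          (cong₂ _+_
            (seq-∑ᴿ r right-terms (suc ν)
              (λ j → (- 1ℚ) ^ (r ℕ.∸ j) * ζ-sum (descending m p p Vec.++ ones (r ℕ.∸ j)) (suc ν) * ζB⋆-sum (j ℕ.+ 1) [] (suc ν))
              λ _ _ _ → refl)
            (cong ((- 1ℚ) ^ r * S * log2-sum (suc ν) *_) (seq-∑± (p ℕ.+ r) Li₁ (double (suc ν)))))
          (cong ((- 1ℚ) ^ r * S *_) (seq-∑± (p ℕ.+ r) Li₂ (double (suc ν))))

open import Data.List using ([])
open import Data.List.Relation.Unary.All using ([])
open import Data.Nat using (ℕ; _+_; _∸_; _^_; _≤_)
open import Data.Nat.Properties using (m≤n+m; +-monoˡ-≤)
open import Data.Sign using (Sign)
open import Data.Vec using (_++_; _∷ʳ_)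

theorem4p3 : (p r : ℕ) (m : ℕ → ℕ) (1≤p : 1 ≤ p) (1≤m₁ : 1 ≤ m 1) (1≤mₚ : 1 ≤ m p) →
    ∑ᴿ p (λ j _ →
    [-1]^ (j ∸ 1)
    *ᴿ ζ (descending m p (p ∸ j)) (descending-admissible m p (p ∸ j) 1≤mₚ)
    *ᴿ ζB⋆ (r + 2) (prefix m j ^∨) (m≤n+m 2 r)
    (indices≥1 (^∨-isHoffmanDual (prefix m j) (prefix-positive m j 1≤m₁))))
    ≃
    ∑ᴿ r (λ j 1≤j →
    [-1]^ (r ∸ j)
    *ᴿ ζ (descending m p p ++ ones (r ∸ j)) (descending++ones-admissible m p (r ∸ j) 1≤p 1≤mₚ)
    *ᴿ ζB⋆ (j + 1) [] (+-monoˡ-≤ 1 1≤j) [])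
    +ᴿ [-1]^ r *ᴿ fromℕ (2 ^ (∑ℕ p m + 1)) *ᴿ log2
    *ᴿ ∑± (p + r) (λ σ →
    Li (descending m p p ++ ones r)
    (consecutive σ)
    (descending++ones-admissible m p r 1≤p 1≤mₚ))
    +ᴿ [-1]^ r *ᴿ fromℕ (2 ^ (∑ℕ p m + 1))
    *ᴿ ∑± (p + r) (λ σ →
    Li ((descending m p p ++ ones r) ∷ʳ 1)
    (consecutive (σ ∷ʳ Sign.-))
    (descending++ones∷ʳ1-admissible m p r 1≤p 1≤mₚ))
theorem4p3 = Truncations.identity
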